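{- Consider the abstract elementary class ${}^\perp(\mathbb{Z}^\omega/\mathbb{Z}^{(\omega)})$ with its strong submodel relation $<$ given by: $G<H$ iff $G$ is a subgroup of $H$ and both $G$ and $H/G$ belong to ${}^\perp(\mathbb{Z}^\omega/\mathbb{Z}^{(\omega)})$. (1) If CH holds, then ${}^\perp(\mathbb{Z}^\omega/\mathbb{Z}^{(\omega)})$ is stable in $\aleph_1$ (in fact in all $\aleph_n$, $0<n<\omega$), but not stable in $\aleph_\omega$. (2) If CH fails, then ${}^\perp(\mathbb{Z}^\omega/\mathbb{Z}^{(\omega)})$ is not stable in $\aleph_1$.
   Context: All groups are abelian. For a group $X$, ${}^\perp X$ is the class of all abelian groups $G$ with $\mathrm{Ext}(G,X)=0$. $\mathbb{Z}^\omega$ is the direct product and $\mathbb{Z}^{(\omega)}$ the direct sum of countably many copies of $\mathbb{Z}$. CH is the continuum hypothesis $2^{\aleph_0}=\aleph_1$. Stability is meant in the sense of Galois types in an abstract elementary class. For $M$ in the class, consider triples $(M,a,N)$ with $M<N$ and $a\in N$. Two triples $(M,a,N)$ and $(M,b,N')$ are directly related if there are $N''$ in the class and embeddings $f:N\to N''$, $g:N'\to N''$, whose images are strong submodels of $N''$, which are the identity on $M$ and satisfy $f(a)=g(b)$. Galois types over $M$ are the classes of the equivalence relation generated by this relation. The class is stable in an infinite cardinal $\lambda$ if for every member $M$ of the class of cardinality $\lambda$ there are at most $\lambda$ Galois types over $M$. -}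

-- Sets are setoids and groups are setoid-based, so that quotients exist.  All groups live in
-- the lowest universe, which plays the role of the universe of sets.
module Defs where

open import Algebra.Bundles using (AbelianGroup)
open import Algebra.Morphism.Bundles using (GroupHomomorphism)
import Algebra.Construct.DirectProduct as DirectProduct
import Algebra.Construct.Pointwise as Pointwise
import Algebra.Properties.AbelianGroup as AbelianGroupProperties
import Algebra.Properties.CommutativeSemigroup as CommutativeSemigroupProperties
open import Data.Bool.Base using (Bool)
open import Data.Integer.Base using (0ℤ)
import Data.Integer.Base as ℤ
import Data.Integer.Properties as ℤ
open import Data.Nat.Base using (ℕ; zero; suc; _≤_; _⊔_)
import Data.Nat.Properties as ℕ
open import Data.Product.Base using (Σ; Σ-syntax; ∃; _×_; _,_; proj₁; proj₂)
open import Function.Bundles using (Func; Injection; Surjection; Bijection; _⇔_; mk⇔)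
open import Function.Definitions using (Injective; Surjective)
open import Level using (0ℓ; Lift) renaming (suc to lsuc; _⊔_ to _⊔ˡ_)
open import Relation.Binary.Bundles using (Setoid)
open import Relation.Binary.Construct.Closure.Equivalence using () renaming (setoid to closureSetoid)
open import Relation.Binary.Core using (Rel)
open import Relation.Binary.Definitions using (_Respects_)
open import Relation.Binary.PropositionalEquality.Core using (_≡_; refl; sym; trans; cong; cong₂)
open import Relation.Binary.PropositionalEquality using (_→-setoid_)
open import Relation.Binary.PropositionalEquality.Properties using () renaming (setoid to ≡-setoid)
import Relation.Binary.Reasoning.Setoid as SetoidReasoning
open import Relation.Nullary.Negation.Core using (¬_)
open import Relation.Unary using (Pred)

------------------------------------------------------------------------
-- The axiom of choice

-- This is stronger than the distributivity of Π over Σ, which holds in type theory anyway: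
-- the section has to respect the equality of B.
SurjectionsSplit : ∀ a ℓ₁ b ℓ₂ → Set (lsuc (a ⊔ˡ ℓ₁ ⊔ˡ b ⊔ˡ ℓ₂))
SurjectionsSplit a ℓ₁ b ℓ₂ =
  (A : Setoid a ℓ₁) (B : Setoid b ℓ₂) (f : Surjection A B) →
  Σ[ s ∈ Func B A ] (∀ y → Setoid._≈_ B (Surjection.to f (Func.to s y)) y)

------------------------------------------------------------------------
-- Cardinals

Card : Set₁
Card = Setoid 0ℓ 0ℓ

_≼_ : Card → Card → Set
κ ≼ μ = Injection κ μ

_≺_ : Card → Card → Set
κ ≺ μ = κ ≼ μ × ¬ (μ ≼ κ)

IsSuccessor : Card → Card → Set₁
IsSuccessor κ μ = κ ≺ μ × (∀ ν → κ ≺ ν → μ ≼ ν)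

-- κ has cardinality ℵₙ; this avoids choosing representatives (initial ordinals).
IsAleph : ℕ → Card → Set₁
IsAleph zero    κ = Lift (lsuc 0ℓ) (Bijection (≡-setoid ℕ) κ)
IsAleph (suc n) κ = Σ[ μ ∈ Card ] (IsAleph n μ × IsSuccessor μ κ)

UpperBoundOfAlephs : Card → Set₁
UpperBoundOfAlephs κ = ∀ n μ → IsAleph n μ → μ ≼ κ

-- ℵ_ω is the supremum of the ℵₙ.
IsAlephω : Card → Set₁
IsAlephω κ = UpperBoundOfAlephs κ × (∀ ν → UpperBoundOfAlephs ν → κ ≼ ν)

-- Assuming excluded middle, functions into Bool are the same as subsets.
CH : Set₁
CH = IsAleph 1 (ℕ →-setoid Bool)

------------------------------------------------------------------------
-- Abelian groups, subgroups and quotients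

AbGroup : Set₁
AbGroup = AbelianGroup 0ℓ 0ℓ

∣_∣ : AbGroup → Card
∣ G ∣ = AbelianGroup.setoid G

Hom : AbGroup → AbGroup → Set
Hom G H = GroupHomomorphism (AbelianGroup.rawGroup G) (AbelianGroup.rawGroup H)

open GroupHomomorphism using (⟦_⟧)

record Subgroup (H : AbGroup) : Set₁ where
  open AbelianGroup H
  field
    Member    : Pred Carrier 0ℓ
    resp      : Member Respects _≈_
    ε-closed  : Member ε
    ∙-closed  : ∀ {x y} → Member x → Member y → Member (x ∙ y)
    ⁻¹-closed : ∀ {x} → Member x → Member (x ⁻¹)

asGroup : {H : AbGroup} → Subgroup H → AbGroup
asGroup {H} S = record
  { Carrier = Σ Carrier Member
  ; _≈_     = λ x y → proj₁ x ≈ proj₁ y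
  ; _∙_     = λ (x , p) (y , q) → x ∙ y , ∙-closed p q
  ; ε       = ε , ε-closed
  ; _⁻¹     = λ (x , p) → x ⁻¹ , ⁻¹-closed p
  ; isAbelianGroup = record
    { isGroup = record
      { isMonoid = record
        { isSemigroup = record
          { isMagma = record
            { isEquivalence = record { refl = H.refl ; sym = H.sym ; trans = H.trans }
            ; ∙-cong = ∙-cong
            }
          ; assoc = λ _ _ _ → assoc _ _ _
          }
        ; identity = (λ _ → identityˡ _) , (λ _ → identityʳ _)
        }
      ; inverse = (λ _ → inverseˡ _) , (λ _ → inverseʳ _)
      ; ⁻¹-cong = ⁻¹-cong
      }
    ; comm = λ _ _ → comm _ _
    }
  }
  where
  module H = AbelianGroup H
  open H
  open Subgroup S

infixl 7 _/_

-- The quotient has the elements of H, identified when their difference lies in S.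
_/_ : (H : AbGroup) → Subgroup H → AbGroup
H / S = record
  { Carrier = Carrier
  ; _≈_     = λ x y → Member (x - y)
  ; _∙_     = _∙_
  ; ε       = ε
  ; _⁻¹     = _⁻¹
  ; isAbelianGroup = record
    { isGroup = record
      { isMonoid = record
        { isSemigroup = record
          { isMagma = record
            { isEquivalence = record
              { refl  = fromEq H.refl
              ; sym   = λ {x} {y} p → resp (flip-diff x y) (⁻¹-closed p)
              ; trans = λ {x} {y} {z} p q → resp (telescope x y z) (∙-closed p q)
              }
            ; ∙-cong = λ {x} {y} {u} {v} p q → resp (diff-∙ x y u v) (∙-closed p q)
            }
          ; assoc = λ _ _ _ → fromEq (assoc _ _ _)
          }
        ; identity = (λ _ → fromEq (identityˡ _)) , (λ _ → fromEq (identityʳ _))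
        }
      ; inverse = (λ _ → fromEq (inverseˡ _)) , (λ _ → fromEq (inverseʳ _))
      ; ⁻¹-cong = λ {x} {y} p → resp (H.sym (⁻¹-∙-comm x (y ⁻¹))) (⁻¹-closed p)
      }
    ; comm = λ _ _ → fromEq (comm _ _)
    }
  }
  where
  module H = AbelianGroup H
  open H
  open Subgroup S
  open AbelianGroupProperties H
  open CommutativeSemigroupProperties H.commutativeSemigroup using (interchange)
  open SetoidReasoning H.setoid

  fromEq : ∀ {x y} → x ≈ y → Member (x - y)
  fromEq {x} {y} p = resp (H.sym (H.trans (∙-congʳ p) (inverseʳ y))) ε-closed

  flip-diff : ∀ x y → (x - y) ⁻¹ ≈ y - x
  flip-diff x y = begin
    (x ∙ y ⁻¹) ⁻¹    ≈⟨ ⁻¹-∙-comm x (y ⁻¹) ⟨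
    x ⁻¹ ∙ y ⁻¹ ⁻¹   ≈⟨ ∙-congˡ (⁻¹-involutive y) ⟩
    x ⁻¹ ∙ y         ≈⟨ comm _ _ ⟩
    y ∙ x ⁻¹         ∎

  telescope : ∀ x y z → (x - y) ∙ (y - z) ≈ x - z
  telescope x y z = begin
    (x ∙ y ⁻¹) ∙ (y ∙ z ⁻¹)   ≈⟨ assoc _ _ _ ⟩
    x ∙ (y ⁻¹ ∙ (y ∙ z ⁻¹))   ≈⟨ ∙-congˡ (assoc _ _ _) ⟨
    x ∙ ((y ⁻¹ ∙ y) ∙ z ⁻¹)   ≈⟨ ∙-congˡ (∙-congʳ (inverseˡ y)) ⟩
    x ∙ (ε ∙ z ⁻¹)            ≈⟨ ∙-congˡ (identityˡ _) ⟩
    x ∙ z ⁻¹                  ∎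

  diff-∙ : ∀ x y u v → (x - y) ∙ (u - v) ≈ (x ∙ u) - (y ∙ v)
  diff-∙ x y u v = begin
    (x ∙ y ⁻¹) ∙ (u ∙ v ⁻¹)   ≈⟨ interchange _ _ _ _ ⟩
    (x ∙ u) ∙ (y ⁻¹ ∙ v ⁻¹)   ≈⟨ ∙-congˡ (⁻¹-∙-comm y v) ⟩
    (x ∙ u) ∙ (y ∙ v) ⁻¹      ∎

image : {G H : AbGroup} → Hom G H → Subgroup H
image {G} {H} f = record
  { Member    = λ y → ∃ λ x → ⟦ f ⟧ x H.≈ y
  ; resp      = λ y≈z (x , p) → x , H.trans p y≈z
  ; ε-closed  = G.ε , f.ε-homo
  ; ∙-closed  = λ (x , p) (y , q) → x G.∙ y , H.trans (f.homo x y) (H.∙-cong p q)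
  ; ⁻¹-closed = λ (x , p) → x G.⁻¹ , H.trans (f.⁻¹-homo x) (H.⁻¹-cong p)
  }
  where
  module G = AbelianGroup G
  module H = AbelianGroup H
  module f = GroupHomomorphism f

IsInjective : {G H : AbGroup} → Hom G H → Set
IsInjective {G} {H} f = Injective (AbelianGroup._≈_ G) (AbelianGroup._≈_ H) ⟦ f ⟧

IsSurjective : {G H : AbGroup} → Hom G H → Set
IsSurjective {G} {H} f = Surjective (AbelianGroup._≈_ G) (AbelianGroup._≈_ H) ⟦ f ⟧

------------------------------------------------------------------------
-- Ext and the class ⊥X

-- Short exact sequences 0 → X → E → G → 0.
record Extension (G X : AbGroup) : Set₁ where
  field
    E       : AbGroup
    ι       : Hom X E
    π       : Hom E G
    ι-inj   : IsInjective {X} {E} ι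
    π-surj  : IsSurjective {E} {G} π
    exact   : ∀ e → AbelianGroup._≈_ G (⟦ π ⟧ e) (AbelianGroup.ε G)
                    ⇔ Subgroup.Member (image {X} {E} ι) e

-- Yoneda equivalence; by the five lemma such a φ is an isomorphism.
_~_ : {G X : AbGroup} → Rel (Extension G X) 0ℓ
_~_ {G} {X} 𝓔 𝓕 = Σ[ φ ∈ Hom 𝓔.E 𝓕.E ]
  (∀ x → ⟦ φ ⟧ (⟦ 𝓔.ι ⟧ x) F.≈ ⟦ 𝓕.ι ⟧ x) ×
  (∀ e → ⟦ 𝓕.π ⟧ (⟦ φ ⟧ e) G.≈ ⟦ 𝓔.π ⟧ e)
  where
  module 𝓔 = Extension 𝓔
  module 𝓕 = Extension 𝓕
  module F = AbelianGroup 𝓕.E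
  module G = AbelianGroup G

splitExtension : (G X : AbGroup) → Extension G X
splitExtension G X = record
  { E = DirectProduct.abelianGroup X G
  ; ι = record
    { ⟦_⟧ = λ x → x , G.ε
    ; isGroupHomomorphism = record
      { isMonoidHomomorphism = record
        { isMagmaHomomorphism = record
          { isRelHomomorphism = record { cong = λ p → p , G.refl }
          ; homo = λ _ _ → X.refl , G.sym (G.identityˡ G.ε)
          }
        ; ε-homo = X.refl , G.refl
        }
      ; ⁻¹-homo = λ _ → X.refl , G.sym (AbelianGroupProperties.ε⁻¹≈ε G)
      }
    }
  ; π = record
    { ⟦_⟧ = proj₂
    ; isGroupHomomorphism = record
      { isMonoidHomomorphism = record
        { isMagmaHomomorphism = record
          { isRelHomomorphism = record { cong = proj₂ }
          ; homo = λ _ _ → G.refl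
          }
        ; ε-homo = G.refl
        }
      ; ⁻¹-homo = λ _ → G.refl
      }
    }
  ; ι-inj  = proj₁
  ; π-surj = λ g → (X.ε , g) , proj₂
  ; exact  = λ (x , g) → mk⇔ (λ p → x , X.refl , G.sym p) (λ (_ , _ , p) → G.sym p)
  }
  where
  module G = AbelianGroup G
  module X = AbelianGroup X

-- Ext(G, X) is the group of extensions up to equivalence, with zero the class of the split one.
Ext[_,_]≡0 : AbGroup → AbGroup → Set₁
Ext[ G , X ]≡0 = (𝓔 : Extension G X) → 𝓔 ~ splitExtension G X

-- Perp X is the class ⊥X.
Perp : AbGroup → AbGroup → Set₁
Perp X G = Ext[ G , X ]≡0

-- S < H in the class ⊥X, for a subgroup S of H.
PerpStrong : (X : AbGroup) {H : AbGroup} → Subgroup H → Set₁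
PerpStrong X {H} S = Perp X (asGroup S) × Perp X (H / S)

------------------------------------------------------------------------
-- Galois types and stability, for a class of groups with a strong submodel relation

module Galois (InClass : AbGroup → Set₁) (Strong : {H : AbGroup} → Subgroup H → Set₁) where

  record StrongEmbedding (M N : AbGroup) : Set₁ where
    field
      hom       : Hom M N
      injective : IsInjective {M} {N} hom
      strong    : Strong (image {M} {N} hom)

  infixl 20 _·_

  _·_ : {M N : AbGroup} → StrongEmbedding M N → AbelianGroup.Carrier M → AbelianGroup.Carrier N
  f · x = ⟦ StrongEmbedding.hom f ⟧ x

  -- A triple (M, a, N).  As groups have no common ambient universe of elements, M < N is given
  -- by an embedding of M onto a strong submodel of N.
  record Triple (M : AbGroup) : Set₁ where
    field
      N       : AbGroup
      inClass : InClass N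
      incl    : StrongEmbedding M N
      a       : AbelianGroup.Carrier N

  record DirectlyRelated {M : AbGroup} (s t : Triple M) : Set₁ where
    private
      module s = Triple s
      module t = Triple t
    field
      N″      : AbGroup
      inClass : InClass N″
      f       : StrongEmbedding s.N N″
      g       : StrongEmbedding t.N N″

    open AbelianGroup N″ using (_≈_)

    field
      agreeOnM : ∀ m → f · (s.incl · m) ≈ g · (t.incl · m)
      agreeOna : f · s.a ≈ g · t.a

  GaloisTypes : AbGroup → Setoid (lsuc 0ℓ) (lsuc 0ℓ)
  GaloisTypes M = closureSetoid (DirectlyRelated {M})

  Stable : Card → Set₁
  Stable κ = ∀ M → InClass M → Bijection ∣ M ∣ κ → Injection (GaloisTypes M) κ

  -- The alephs are determined only up to bijection, so stability in one of them is a
  -- condition on all sets of that cardinality.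
  StableInAleph : ℕ → Set₁
  StableInAleph n = ∀ κ → IsAleph n κ → Stable κ

  StableInAlephω : Set₁
  StableInAlephω = ∀ κ → IsAlephω κ → Stable κ

module PerpGalois (X : AbGroup) = Galois (Perp X) (PerpStrong X)

------------------------------------------------------------------------
-- The group ℤ^ω / ℤ^(ω)

ℤ^ω : AbGroup
ℤ^ω = Pointwise.abelianGroup ℕ ℤ.+-0-abelianGroup

ℤ^⟨ω⟩ : Subgroup ℤ^ω
ℤ^⟨ω⟩ = record
  { Member    = λ x → ∃ λ N → ∀ n → N ≤ n → x n ≡ 0ℤ
  ; resp      = λ x≈y (N , p) → N , λ n N≤n → trans (sym (x≈y n)) (p n N≤n)
  ; ε-closed  = 0 , λ _ _ → refl
  ; ∙-closed  = λ (N , p) (N′ , q) → N ⊔ N′ , λ n b →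
      cong₂ ℤ._+_ (p n (ℕ.m⊔n≤o⇒m≤o N N′ b)) (q n (ℕ.m⊔n≤o⇒n≤o N N′ b))
  ; ⁻¹-closed = λ (N , p) → N , λ n N≤n → cong ℤ.-_ (p n N≤n)
  }

{-# OPTIONS --safe #-}
-- The group X = ℤ^ω / ℤ^⟨ω⟩ is torsion-free, and it is algebraically compact, because
-- countable coherent systems of congruences are solved diagonally.  Hence Ext(G, X) = 0 for
-- torsion-free G.  Conversely, a torsion element g of G has non-zero value under some
-- character G → ℚ/ℤ, and the pullback of ℚ^ω / ℤ^⟨ω⟩ → (ℚ/ℤ)^ω along the diagonal of that
-- character is a non-split extension.  So ⊥X is the class of torsion-free groups, its strong
-- submodels are the pure subgroups, and amalgamation over pure subgroups shows that the
-- Galois type of a over M amounts to the relation n ∣ a + m with n ∈ ℕ and m ∈ M.  For each n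
-- the set of such m is empty or a coset of nM, so there are at most |M|^ω types.  Under CH,
-- Hausdorff's formula gives ℵₙ^ω = ℵₙ for 0 < n.
--
-- For instability let M be the group of finitely supported functions Σₙ κₙ → ℤ, inside the
-- group of all functions.  A choice of points fₙ ∈ κₙ yields the function with value 2ⁿ at fₙ
-- and 0 elsewhere, whose type over M determines f because its finite truncations lie in M.
-- So there are at least ∏ₙ κₙ types over M.  With κₙ = ℵ₁ stability gives 2^ω ≤ ℵ₁, and with
-- κₙ = ℵₙ₊₁ it contradicts König's theorem.
module Submission where

open import Defs
open import Algebra.Bundles using (AbelianGroup)
import Algebra.Construct.DirectProduct as DirectProduct
import Algebra.Construct.Pointwise as Pointwise
open import Algebra.Morphism.Bundles using (GroupHomomorphism)
import Algebra.Properties.AbelianGroup as AbelianGroupProperties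
import Algebra.Properties.CommutativeSemigroup as CommutativeSemigroupProperties
open import Axiom.ExcludedMiddle using (ExcludedMiddle)
open import Data.Bool.Base using (Bool; true; false; T; if_then_else_)
open import Data.Bool.Properties using (T-≡)
open import Data.Empty using (⊥; ⊥-elim)
open import Data.Fin.Base as Fin using (Fin)
import Data.Fin.Properties as Fin
open import Data.Integer.Base as ℤ using (ℤ; +_; -[1+_]; 0ℤ; 1ℤ)
import Data.Integer.DivMod as ℤ
import Data.Integer.Properties as ℤ
import Data.Integer.Solver as IntegerSolver
open import Data.List.Base using (List; []; _∷_; _++_)
open import Data.List.Relation.Binary.Pointwise as ListPointwise using (Pointwise; []; _∷_)
open import Data.List.Relation.Unary.All as All using (All; []; _∷_)
open import Data.List.Relation.Unary.Any as Any using (Any; here; there)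
import Data.List.Relation.Unary.Any.Properties as Any
open import Data.Nat using (ℕ; zero; suc; _<_)
import Data.Nat.Base as ℕ
open import Data.Nat.Divisibility using (divides)
open import Data.Nat.GCD as GCD using (GCD; mkGCD)
open import Data.Nat.Induction using (<-wellFounded)
import Data.Nat.Properties as ℕ
open import Data.Product using (Σ; Σ-syntax; ∃; _×_; _,_; proj₁; proj₂)
open import Data.Product.Relation.Binary.Pointwise.NonDependent using (×-setoid)
import Data.Rational.Unnormalised.Base as ℚ
import Data.Rational.Unnormalised.Properties as ℚ
open import Data.Sum as Sum using (_⊎_; inj₁; inj₂)
open import Data.Unit using (⊤; tt)
open import Data.Vec.Base as Vec using (Vec; []; _∷_)
import Data.Vec.Properties as Vec
open import Function using (_∘_; id)
open import Function.Bundles using (Func; Injection; Surjection; Bijection; Equivalence; _⇔_; mk⇔)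
import Function.Construct.Composition as Composition
import Function.Construct.Identity as Identity
open import Induction.WellFounded using (WellFounded; Acc; acc)
open import Level using (Level; 0ℓ; lift) renaming (suc to lsuc; _⊔_ to _⊔ˡ_)
open import Relation.Binary.Bundles using (Setoid)
import Relation.Binary.Construct.Closure.Equivalence as EqClosure
import Relation.Binary.Construct.On as On
open import Relation.Binary.Core using (Rel)
open import Relation.Binary.Definitions using (tri<; tri≈; tri>)
open import Relation.Binary.PropositionalEquality
  using (_≡_; refl; sym; trans; cong; cong₂; subst; _→-setoid_; module ≡-Reasoning)
open import Relation.Binary.PropositionalEquality.Properties using () renaming (setoid to ≡-setoid)
import Relation.Binary.Reasoning.Setoid as SetoidReasoning
open import Relation.Binary.Structures using (IsEquivalence)
open import Relation.Nullary using (¬_; Dec; does; yes; no; contradiction)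
open import Relation.Nullary.Decidable using (isYes; toWitness; fromWitness)
open import Relation.Unary using (Pred)

-- Cardinals here are setoids compared by injections, without initial ordinals. The upper bounds for
-- infinite cardinals rest on one recursion: a well-ordered κ embeds in μ as soon as μ embeds in no
-- proper segment of κ. Ranking finite lists, and then sequences, by a bound in a successor cardinal
-- turns it into the theorems of Hessenberg and Hausdorff. On the algebraic side `Adjoin` does
-- double duty. It enlarges the graph of a homomorphism on a pure subgroup by one pair (e, x), and
-- it needs that the divisibilities of e over the domain pass to x. In splitting an extension, x
-- comes from algebraic compactness; in amalgamation, e and x are the two given elements and the
-- hypothesis is that their divisibility relations agree. The congruences imposed on x are indexed
-- by a modulus and an element of the domain, which may be arbitrarily large. Purity of the domain
-- makes any two with the same modulus equivalent, so countably many remain, and countable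
-- compactness is enough for groups of every size. The weights 2ⁿ put the function built from f into
-- the 2-adic closure of M, so that its divisibilities over M see every coordinate of f.

module Classical (em : ∀ ℓ → ExcludedMiddle ℓ)
  (ac : ∀ a ℓ₁ b ℓ₂ → SurjectionsSplit a ℓ₁ b ℓ₂) where

  private variable
    a b ℓ ℓ₁ ℓ₂ : Level

  -- Sets, choice and Zorn's lemma

  dec : (P : Set ℓ) → Dec P
  dec P = em _ {P}

  by-contradiction : {P : Set ℓ} → ¬ ¬ P → P
  by-contradiction {P = P} ¬¬p with dec P
  ... | yes p = p
  ... | no ¬p = contradiction ¬p ¬¬p

  counterexample : {A : Set a} {P : A → Set ℓ} → ¬ (∀ x → P x) → ∃ λ x → ¬ P x
  counterexample ¬∀ = by-contradiction λ ¬∃ → ¬∀ λ x → by-contradiction λ ¬p → ¬∃ (x , ¬p)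

  abstract
    -- `Graph` compares only the components in A and B and ignores the proof of R, so a section of
    -- its projection yields a function that respects the equality of A. `resp` is needed because
    -- the section returns a point over an element merely equal to x.
    choose : ∀ {a b ℓ ℓ₁ ℓ₂} (A : Setoid a ℓ₁) (B : Setoid b ℓ₂)
             (R : Setoid.Carrier A → Setoid.Carrier B → Set ℓ) →
             (∀ {x y z} → Setoid._≈_ A x y → R x z → R y z) → (∀ x → ∃ (R x)) →
             Σ[ f ∈ Func A B ] (∀ x → R x (Func.to f x))
    choose {a} {b} {ℓ} {ℓ₁} {ℓ₂} A B R resp total = record
      { to   = λ x → proj₁ (proj₂ (to x))
      ; cong = λ p → proj₂ (cong′ p)
      } , λ x → resp (section x) (proj₂ (proj₂ (to x)))
      where
      Graph : Setoid (a ⊔ˡ b ⊔ˡ ℓ) (ℓ₁ ⊔ˡ ℓ₂)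
      Graph = record
        { Carrier = ∃ λ x → ∃ (R x)
        ; _≈_     = λ (x , y , _) (x′ , y′ , _) → Setoid._≈_ A x x′ × Setoid._≈_ B y y′
        ; isEquivalence = record
          { refl  = Setoid.refl A , Setoid.refl B
          ; sym   = λ (p , q) → Setoid.sym A p , Setoid.sym B q
          ; trans = λ (p , q) (p′ , q′) → Setoid.trans A p p′ , Setoid.trans B q q′
          }
        }
      projection : Surjection Graph A
      projection = record { to = proj₁ ; cong = proj₁ ; surjective = λ x → (x , total x) , proj₁ }
      split : Σ[ s ∈ Func A Graph ] (∀ x → Setoid._≈_ A (Surjection.to projection (Func.to s x)) x)
      split = ac _ _ _ _ Graph A projection
      section : ∀ x → Setoid._≈_ A (Surjection.to projection (Func.to (proj₁ split) x)) x
      section = proj₂ split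
      open Func (proj₁ split) renaming (cong to cong′)

  -- Subsets with values in Bool keep power sets, and unions of families of subsets, in the
  -- lowest universe.
  Sub : Set a → Set a
  Sub A = A → Bool

  infix 4 _∈_ _⊆_ _≐_

  record _∈_ {A : Set a} (x : A) (S : Sub A) : Set where
    constructor holds
    field isTrue : T (S x)

  _⊆_ _≐_ : {A : Set a} → Rel (Sub A) a
  S ⊆ R = ∀ x → x ∈ S → x ∈ R
  S ≐ R = S ⊆ R × R ⊆ S

  abstract
    sub : {A : Set a} → (A → Set ℓ) → Sub A
    sub P x = isYes (dec (P x))

    ∈-intro : {A : Set a} {P : A → Set ℓ} {x : A} → P x → x ∈ sub P
    ∈-intro p = holds (fromWitness p)

    ∈-elim : {A : Set a} {P : A → Set ℓ} {x : A} → x ∈ sub P → P x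
    ∈-elim (holds t) = toWitness t

  ⊆-refl : {A : Set a} {S : Sub A} → S ⊆ S
  ⊆-refl _ x∈S = x∈S

  ⊆-trans : {A : Set a} {S R Q : Sub A} → S ⊆ R → R ⊆ Q → S ⊆ Q
  ⊆-trans p q x x∈S = q x (p x x∈S)

  powerSetoid : Set a → Setoid a a
  powerSetoid A = record
    { Carrier = Sub A
    ; _≈_ = _≐_
    ; isEquivalence = record
      { refl  = ⊆-refl , ⊆-refl
      ; sym   = λ (p , q) → q , p
      ; trans = λ (p , q) (p′ , q′) → ⊆-trans p p′ , ⊆-trans q′ q
      }
    }

  ⋃ : {A : Set a} → Sub (Sub A) → Sub A
  ⋃ F = sub λ x → ∃ λ S → S ∈ F × x ∈ S

  ⋃-upper : {A : Set a} {F : Sub (Sub A)} {S : Sub A} → S ∈ F → S ⊆ ⋃ F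
  ⋃-upper S∈F x x∈S = ∈-intro (_ , S∈F , x∈S)

  ⋃-least : {A : Set a} {F : Sub (Sub A)} {R : Sub A} → (∀ {S} → S ∈ F → S ⊆ R) → ⋃ F ⊆ R
  ⋃-least upper x x∈ with ∈-elim x∈
  ... | _ , S∈F , x∈S = upper S∈F x x∈S

  -- The transfinite iteration of f from base, as an inductive definition without ordinals.
  module Tower {A : Set a} (base : Sub A) (f : Sub A → Sub A)
               (f-cong : ∀ {S R} → S ≐ R → f S ⊆ f R) (f-incr : ∀ {S} → S ⊆ f S) where

    data Stage : Sub A → Set (lsuc a) where
      start : Stage base
      step  : ∀ {S} → Stage S → Stage (f S)
      union : ∀ F → ∃ (_∈ F) → (∀ {S} → S ∈ F → Stage S) → Stage (⋃ F)

    base⊆ : ∀ {S} → Stage S → base ⊆ S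
    base⊆ start = ⊆-refl
    base⊆ (step s) = ⊆-trans (base⊆ s) f-incr
    base⊆ (union F (S , S∈F) stages) = ⊆-trans (base⊆ (stages S∈F)) (⋃-upper S∈F)

    -- The second alternative puts `f R`, and not just `R`, inside S. This stronger form, from the
    -- Bourbaki-Witt argument, carries the induction through a step.
    Comparable : Sub A → Set _
    Comparable S = ∀ {R} → Stage R → S ⊆ R ⊎ f R ⊆ S

    -- A stage can pass S only by first being equal to S, and the step from there lands on `f S`.
    -- This is where `f` has to respect the equality of subsets.
    no-gap : ∀ {S} → Stage S → Comparable S → ∀ {R} → Stage R → S ⊆ R → R ⊆ S ⊎ f S ⊆ R
    no-gap s cmp start _ = inj₁ (base⊆ s)
    no-gap s cmp (step r) S⊆fR with cmp r
    ... | inj₂ fR⊆S = inj₁ fR⊆S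
    ... | inj₁ S⊆R with no-gap s cmp r S⊆R
    ...   | inj₁ R⊆S  = inj₂ (f-cong (S⊆R , R⊆S))
    ...   | inj₂ fS⊆R = inj₂ (⊆-trans fS⊆R f-incr)
    no-gap {S} s cmp (union F inhabited stages) S⊆⋃ with dec (∃ λ R → R ∈ F × ¬ R ⊆ S)
    ... | no all = inj₁ (⋃-least λ R∈F → by-contradiction λ R⊈S → all (_ , R∈F , R⊈S))
    ... | yes (R , R∈F , R⊈S) with cmp (stages R∈F)
    ...   | inj₂ fR⊆S = contradiction (⊆-trans f-incr fR⊆S) R⊈S
    ...   | inj₁ S⊆R with no-gap s cmp (stages R∈F) S⊆R
    ...     | inj₁ R⊆S  = contradiction R⊆S R⊈S
    ...     | inj₂ fS⊆R = inj₂ (⊆-trans fS⊆R (⋃-upper R∈F))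

    comparable : ∀ {S} → Stage S → Comparable S
    comparable start r = inj₁ (base⊆ r)
    comparable (step s) r with comparable s r
    ... | inj₂ fR⊆S = inj₂ (⊆-trans fR⊆S f-incr)
    ... | inj₁ S⊆R with no-gap s (comparable s) r S⊆R
    ...   | inj₁ R⊆S  = inj₂ (f-cong (R⊆S , S⊆R))
    ...   | inj₂ fS⊆R = inj₁ fS⊆R
    comparable (union F _ stages) {R} r with dec (∃ λ S → S ∈ F × ¬ S ⊆ R)
    ... | no all = inj₁ (⋃-least λ S∈F → by-contradiction λ S⊈R → all (_ , S∈F , S⊈R))
    ... | yes (S , S∈F , S⊈R) with comparable (stages S∈F) r
    ...   | inj₁ S⊆R  = contradiction S⊆R S⊈R
    ...   | inj₂ fR⊆S = inj₂ (⊆-trans fR⊆S (⋃-upper S∈F))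

  IsChain : {A : Set a} → Sub (Sub A) → Set a
  IsChain F = ∀ {S R} → S ∈ F → R ∈ F → S ⊆ R ⊎ R ⊆ S

  -- `f` picks a good proper extension where there is one and stands still otherwise. The stages
  -- form a chain, so their union is good; as it is itself a stage, `f` cannot enlarge it.
  zorn : {A : Set a} (Good : Sub A → Set ℓ) →
         (∀ {S R} → S ≐ R → Good S → Good R) →
         (∀ F → IsChain F → ∃ (_∈ F) → (∀ {S} → S ∈ F → Good S) → Good (⋃ F)) →
         ∀ {S} → Good S → ∃ λ M → S ⊆ M × Good M × (∀ {R} → Good R → M ⊆ R → R ⊆ M)
  zorn {A = A} Good resp chain {S₀} good₀ =
    top , base⊆ topStage , good topStage , maximal
    where
    ProperExtension : Sub A → Sub A → Set _
    ProperExtension S R = Good R × S ⊆ R × ¬ R ⊆ S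

    Next : Sub A → Sub A → Set _
    Next S R = ProperExtension S R ⊎ (¬ ∃ (ProperExtension S) × S ≐ R)

    next : Σ[ f ∈ Func (powerSetoid A) (powerSetoid A) ] (∀ S → Next S (Func.to f S))
    next = choose _ _ Next next-resp next-total
      where
      move : ∀ {S S′ R} → S ≐ S′ → ProperExtension S R → ProperExtension S′ R
      move (p , q) (g , i , j) = g , ⊆-trans q i , λ k → j (⊆-trans k q)
      next-resp : ∀ {S S′ R} → S ≐ S′ → Next S R → Next S′ R
      next-resp p (inj₁ e) = inj₁ (move p e)
      next-resp p@(i , j) (inj₂ (n , k , l)) =
        inj₂ ((λ (R , e) → n (R , move (j , i) e)) , ⊆-trans j k , ⊆-trans l i)
      next-total : ∀ S → ∃ (Next S)
      next-total S with dec (∃ (ProperExtension S))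
      ... | yes (R , e) = R , inj₁ e
      ... | no none = S , inj₂ (none , ⊆-refl , ⊆-refl)

    f : Sub A → Sub A
    f = Func.to (proj₁ next)

    f-incr : ∀ {S} → S ⊆ f S
    f-incr {S} with proj₂ next S
    ... | inj₁ (_ , i , _) = i
    ... | inj₂ (_ , i , _) = i

    open Tower S₀ f (λ {S} {R} p → proj₁ (Func.cong (proj₁ next) {S} {R} p)) f-incr

    good : ∀ {S} → Stage S → Good S
    good start = good₀
    good (step {S} s) with proj₂ next S
    ... | inj₁ (g , _) = g
    ... | inj₂ (_ , S≐fS) = resp S≐fS (good s)
    good (union F inhabited stages) = chain F linear inhabited λ S∈F → good (stages S∈F)
      where
      linear : IsChain F
      linear S∈F R∈F with comparable (stages S∈F) (stages R∈F)
      ... | inj₁ S⊆R  = inj₁ S⊆R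
      ... | inj₂ fR⊆S = inj₂ (⊆-trans f-incr fR⊆S)

    stages : Sub (Sub A)
    stages = sub Stage

    top : Sub A
    top = ⋃ stages

    -- `Stage` lives in a higher universe, but `sub` makes a Bool-valued family of it, to which
    -- `union` applies.
    topStage : Stage top
    topStage = union stages (S₀ , ∈-intro start) ∈-elim

    maximal : ∀ {R} → Good R → top ⊆ R → R ⊆ top
    maximal {R} g i with proj₂ next top
    ... | inj₁ (_ , _ , j) = contradiction (⋃-upper (∈-intro (step topStage))) j
    ... | inj₂ (none , _) = by-contradiction λ R⊈top → none (R , g , i , R⊈top)

  -- Well-orderings

  record WellOrder (A : Setoid a ℓ) : Set (a ⊔ˡ lsuc ℓ) where
    open Setoid A using (Carrier; _≈_)
    infix 4 _≺′_
    field
      _≺′_ : Rel Carrier ℓ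
      resp : ∀ {x x′ y y′} → x ≈ x′ → y ≈ y′ → x ≺′ y → x′ ≺′ y′
      wf   : WellFounded _≺′_
      trn  : ∀ {x y z} → x ≺′ y → y ≺′ z → x ≺′ z
      tri  : ∀ x y → x ≺′ y ⊎ x ≈ y ⊎ y ≺′ x

  -- Zermelo's proof: the tower starts from the empty set and adds one chosen missing equivalence
  -- class at a time. `below y` is the largest stage that avoids y, and x precedes y when it lies
  -- there.
  wellOrdering : (A : Card) → WellOrder A
  wellOrdering A = record
    { _≺′_ = λ x y → x ∈ below y
    ; resp = below-resp
    ; wf   = λ x → accessible (step (belowStage x)) (∈-below⁺ x)
    ; trn  = λ {x} {y} {z} x<y y<z → below-mono y z y<z x x<y
    ; tri  = below-tri
    }
    where
    open Setoid A using (Carrier; _≈_) renaming (refl to ≈-refl; sym to ≈-sym; trans to ≈-trans)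

    Missing : Sub Carrier → Set
    Missing S = ∃ λ x → ¬ x ∈ S

    -- Equality ignores which missing element witnesses that a set is not full, so that `new S m`
    -- depends on S alone.
    NonFull : Setoid 0ℓ 0ℓ
    NonFull = record
      { Carrier = ∃ Missing
      ; _≈_ = λ S R → proj₁ S ≐ proj₁ R
      ; isEquivalence = record
        { refl  = λ {S} → P.refl {proj₁ S}
        ; sym   = λ {S} {R} → P.sym {proj₁ S} {proj₁ R}
        ; trans = λ {S} {R} {Q} → P.trans {proj₁ S} {proj₁ R} {proj₁ Q}
        }
      }
      where module P = Setoid (powerSetoid Carrier)

    chosen = choose NonFull A (λ (S , _) x → ¬ x ∈ S) (λ (_ , R⊆S) x∉S x∈R → x∉S (R⊆S _ x∈R)) proj₂

    new : ∀ S → Missing S → Carrier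
    new S m = Func.to (proj₁ chosen) (S , m)

    new∉ : ∀ S m → ¬ new S m ∈ S
    new∉ S m = proj₂ chosen (S , m)

    new-cong : ∀ {S R} m m′ → S ≐ R → new S m ≈ new R m′
    new-cong m m′ p = Func.cong (proj₁ chosen) {_ , m} {_ , m′} p

    f : Sub Carrier → Sub Carrier
    f S = sub λ x → x ∈ S ⊎ Σ[ m ∈ Missing S ] x ≈ new S m

    f-cong : ∀ {S R} → S ≐ R → f S ⊆ f R
    f-cong (i , j) x x∈ with ∈-elim x∈
    ... | inj₁ x∈S = ∈-intro (inj₁ (i x x∈S))
    ... | inj₂ (m@(y , y∉) , x≈) = ∈-intro (inj₂ (m′ , ≈-trans x≈ (new-cong m m′ (i , j))))
      where m′ = y , λ y∈R → y∉ (j y y∈R)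

    open Tower (sub λ _ → ⊥) f f-cong (λ _ x∈S → ∈-intro (inj₁ x∈S))

    stage-resp : ∀ {S} → Stage S → ∀ {x y} → x ≈ y → x ∈ S → y ∈ S
    stage-resp start _ x∈ = ⊥-elim (∈-elim x∈)
    stage-resp (step s) x≈y x∈ with ∈-elim x∈
    ... | inj₁ x∈S = ∈-intro (inj₁ (stage-resp s x≈y x∈S))
    ... | inj₂ (m , x≈) = ∈-intro (inj₂ (m , ≈-trans (≈-sym x≈y) x≈))
    stage-resp (union F _ stages) x≈y x∈ with ∈-elim x∈
    ... | S , S∈F , x∈S = ⋃-upper S∈F _ (stage-resp (stages S∈F) x≈y x∈S)

    Avoiding : Carrier → Sub (Sub Carrier)
    Avoiding x = sub λ S → Stage S × ¬ x ∈ S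

    below : Carrier → Sub Carrier
    below x = ⋃ (Avoiding x)

    belowStage : ∀ x → Stage (below x)
    belowStage x = union (Avoiding x) (_ , ∈-intro (start , ∈-elim)) λ S∈ → proj₁ (∈-elim S∈)

    ∉-below : ∀ x → ¬ x ∈ below x
    ∉-below x x∈ with ∈-elim x∈
    ... | S , S∈ , x∈S = proj₂ (∈-elim S∈) x∈S

    below-max : ∀ {x S} → Stage S → ¬ x ∈ S → S ⊆ below x
    below-max s x∉S = ⋃-upper (∈-intro (s , x∉S))

    -- If x were still missing, `f (below x)` would be a stage avoiding x, hence contained in
    -- `below x`, and its new element is not there.
    ∈-below⁺ : ∀ x → x ∈ f (below x)
    ∈-below⁺ x = by-contradiction λ x∉ →
      new∉ (below x) m (below-max (step (belowStage x)) x∉ _ (∈-intro (inj₂ (m , ≈-refl))))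
      where m = x , ∉-below x

    isNew : ∀ x → x ≈ new (below x) (x , ∉-below x)
    isNew x with ∈-elim (∈-below⁺ x)
    ... | inj₁ x∈ = contradiction x∈ (∉-below x)
    ... | inj₂ (m , x≈) = ≈-trans x≈ (new-cong m _ (⊆-refl , ⊆-refl))

    below-mono : ∀ x y → x ∈ below y → below x ⊆ below y
    below-mono x y x∈ with comparable (belowStage x) (belowStage y)
    ... | inj₁ i = i
    ... | inj₂ i = contradiction (i x (∈-intro (inj₁ x∈))) (∉-below x)

    below-resp : ∀ {x x′ y y′} → x ≈ x′ → y ≈ y′ → x ∈ below y → x′ ∈ below y′
    below-resp {x} {x′} {y} {y′} p q x∈ = stage-resp (belowStage y′) p
      (below-max (belowStage y) (λ y′∈ → ∉-below y (stage-resp (belowStage y) (≈-sym q) y′∈)) x x∈)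

    below-tri : ∀ x y → x ∈ below y ⊎ x ≈ y ⊎ y ∈ below x
    below-tri x y with comparable (belowStage x) (belowStage y)
    ... | inj₂ i = inj₂ (inj₂ (i y (∈-below⁺ y)))
    ... | inj₁ i with comparable (belowStage y) (belowStage x)
    ...   | inj₂ j = inj₁ (j x (∈-below⁺ x))
    ...   | inj₁ j = inj₂ (inj₁ (≈-trans (isNew x) (≈-trans (new-cong _ _ (i , j)) (≈-sym (isNew y)))))

    accessible : ∀ {S} → Stage S → ∀ {x} → x ∈ S → Acc (λ x y → x ∈ below y) x
    accessible start x∈ = ⊥-elim (∈-elim x∈)
    accessible (step {S} s) {x} x∈ with dec (x ∈ S)
    ... | yes x∈S = accessible s x∈S
    ... | no x∉S = acc λ y<x → accessible s (below⊆S _ y<x)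
      where
      below⊆S : below x ⊆ S
      below⊆S with comparable (belowStage x) s
      ... | inj₁ i = i
      ... | inj₂ i = contradiction (i x x∈) (∉-below x)
    accessible (union F _ stages) x∈ with ∈-elim x∈
    ... | S , S∈F , x∈S = accessible (stages S∈F) x∈S

  -- Cardinals

  infixl 25 _↾_

  _↾_ : (A : Setoid a ℓ₁) → (Setoid.Carrier A → Set ℓ) → Setoid (a ⊔ˡ ℓ) ℓ₁
  A ↾ P = On.setoid {B = Σ (Setoid.Carrier A) P} A proj₁

  ≼-refl : (κ : Card) → κ ≼ κ
  ≼-refl κ = Identity.injection κ

  ≼-trans : {κ μ ν : Card} → κ ≼ μ → μ ≼ ν → κ ≼ ν
  ≼-trans = Composition.injection

  ↾-mono : (κ : Card) {P Q : Setoid.Carrier κ → Set} → (∀ {x} → P x → Q x) → κ ↾ P ≼ κ ↾ Q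
  ↾-mono κ imp = record { to = λ (x , p) → x , imp p ; cong = id ; injective = id }

  ↾-≼ : (κ : Card) {P : Setoid.Carrier κ → Set} → κ ↾ P ≼ κ
  ↾-≼ κ = record { to = proj₁ ; cong = id ; injective = id }

  choose-injection :
    (A : Setoid a ℓ₁) (B : Setoid b ℓ₂) (R : Setoid.Carrier A → Setoid.Carrier B → Set ℓ) →
    (∀ {x y z} → Setoid._≈_ A x y → R x z → R y z) → (∀ x → ∃ (R x)) →
    (∀ {x x′ y y′} → R x y → R x′ y′ → Setoid._≈_ B y y′ → Setoid._≈_ A x x′) →
    Injection A B
  choose-injection A B R resp total separates with choose A B R resp total
  ... | f , spec = record
    { to = Func.to f ; cong = Func.cong f ; injective = λ {x} {y} → separates (spec x) (spec y) }

  minimal : {A : Set a} {_<_ : Rel A ℓ} → WellFounded _<_ → (P : A → Set ℓ₂) →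
            ∃ P → ∃ λ x → P x × (∀ {y} → y < x → ¬ P y)
  minimal {_<_ = _<_} wf P (x , px) = descend (wf x) px
    where
    descend : ∀ {x} → Acc _<_ x → P x → ∃ λ x → P x × (∀ {y} → y < x → ¬ P y)
    descend {x} (acc rs) px with dec (∃ λ y → y < x × P y)
    ... | yes (y , y<x , py) = descend (rs y<x) py
    ... | no none = x , px , λ y<x py → none (_ , y<x , py)

  segment : {κ : Card} → WellOrder κ → Setoid.Carrier κ → Card
  segment {κ} w x = κ ↾ λ y → WellOrder._≺′_ w y x

  closedSegment : {κ : Card} → WellOrder κ → Setoid.Carrier κ → Card
  closedSegment {κ} w x = κ ↾ λ y → ¬ WellOrder._≺′_ w x y

  pullback : {κ μ : Card} → κ ≼ μ → WellOrder μ → WellOrder κ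
  pullback {κ} i w = record
    { _≺′_ = λ x y → to x w.≺′ to y
    ; resp = λ p q → w.resp (Injection.cong i p) (Injection.cong i q)
    ; wf   = On.wellFounded to w.wf
    ; trn  = w.trn
    ; tri  = tri
    }
    where
    module w = WellOrder w
    open Injection i using (to; injective)
    tri : ∀ x y → to x w.≺′ to y ⊎ Setoid._≈_ κ x y ⊎ to y w.≺′ to x
    tri x y with w.tri (to x) (to y)
    ... | inj₁ p = inj₁ p
    ... | inj₂ (inj₁ p) = inj₂ (inj₁ (injective p))
    ... | inj₂ (inj₂ p) = inj₂ (inj₂ p)

  -- Every x is sent to an element of μ that no predecessor of x is sent to.
  segments-small⇒≼ : {κ : Card} (w : WellOrder κ) (μ : Card) → (∀ x → ¬ μ ≼ segment w x) → κ ≼ μ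
  segments-small⇒≼ {κ} w μ small with dec (Setoid.Carrier μ)
  ... | no empty = record
    { to = λ x → ⊥-elim (noElement x)
    ; cong = λ {x} → ⊥-elim (noElement x)
    ; injective = λ {x} → ⊥-elim (noElement x)
    }
    where
    noElement : ¬ Setoid.Carrier κ
    noElement x = small x record
      { to = λ y → contradiction y empty
      ; cong = λ {y} → contradiction y empty
      ; injective = λ {y} → contradiction y empty
      }
  ... | yes y₀ = record
    { to = λ x → go (w.wf x)
    ; cong = go-cong (w.wf _) (w.wf _)
    ; injective = λ {x} {x′} eq → injective x x′ eq (w.tri x x′)
    }
    where
    module w = WellOrder w
    open w using (_≺′_)
    module κ = Setoid κ
    module μ = Setoid μ

    -- The premise makes the relation total: on a full S any value will do. `go-fresh` shows that
    -- the values used before some x never fill μ.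
    Fresh : Sub μ.Carrier → μ.Carrier → Set
    Fresh S y = ∃ (λ z → ¬ z ∈ S) → ¬ y ∈ S

    fresh-total : ∀ S → ∃ (Fresh S)
    fresh-total S with dec (∃ λ z → ¬ z ∈ S)
    ... | yes (z , z∉S) = z , λ _ → z∉S
    ... | no none = y₀ , λ m → contradiction m none

    fresh : Σ[ f ∈ Func (powerSetoid μ.Carrier) μ ] (∀ S → Fresh S (Func.to f S))
    fresh = choose _ μ Fresh
      (λ (S⊆R , R⊆S) h (z , z∉R) y∈R → h (z , λ z∈S → z∉R (S⊆R z z∈S)) (R⊆S _ y∈R)) fresh-total

    go : ∀ {x} → Acc _≺′_ x → μ.Carrier
    used : ∀ {x} → (∀ {y} → y ≺′ x → Acc _≺′_ y) → Sub μ.Carrier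

    go (acc rs) = Func.to (proj₁ fresh) (used rs)
    used {x} rs = sub λ z → ∃ λ y → Σ[ y<x ∈ y ≺′ x ] z μ.≈ go (rs y<x)

    go-cong : ∀ {x x′} (p : Acc _≺′_ x) (p′ : Acc _≺′_ x′) → x κ.≈ x′ → go p μ.≈ go p′
    used-mono : ∀ {x x′} (rs : ∀ {y} → y ≺′ x → Acc _≺′_ y) (rs′ : ∀ {y} → y ≺′ x′ → Acc _≺′_ y) →
                x κ.≈ x′ → used rs ⊆ used rs′

    go-cong (acc rs) (acc rs′) x≈ = Func.cong (proj₁ fresh)
      (used-mono rs rs′ x≈ , used-mono rs′ rs (κ.sym x≈))
    used-mono rs rs′ x≈ z z∈ with ∈-elim z∈
    ... | y , y<x , z≈ = ∈-intro (y , w.resp κ.refl x≈ y<x ,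
                           μ.trans z≈ (go-cong (rs y<x) (rs′ _) κ.refl))

    -- If all of μ were used before x, sending each element of μ to a predecessor of x that took it
    -- would embed μ in the segment of x.
    go-fresh : ∀ {x} (rs : ∀ {y} → y ≺′ x → Acc _≺′_ y) → ¬ go (acc rs) ∈ used rs
    go-fresh {x} rs = proj₂ fresh (used rs) (counterexample {P = _∈ used rs} λ all → small x
      (choose-injection μ (segment w x)
        (λ z (y , y<x) → z μ.≈ go (rs y<x))
        (λ z≈z′ e → μ.trans (μ.sym z≈z′) e)
        (λ z → let y , y<x , e = ∈-elim (all z) in (y , y<x) , e)
        (λ e e′ y≈y′ → μ.trans e (μ.trans (go-cong (rs _) (rs _) y≈y′) (μ.sym e′)))))

    go-≉ : ∀ {x x′} (p : Acc _≺′_ x) (p′ : Acc _≺′_ x′) → x ≺′ x′ → ¬ go p′ μ.≈ go p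
    go-≉ p (acc rs′) x<x′ e =
      go-fresh rs′ (∈-intro (_ , x<x′ , μ.trans e (go-cong p (rs′ x<x′) κ.refl)))

    injective : ∀ x x′ → go (w.wf x) μ.≈ go (w.wf x′) → x ≺′ x′ ⊎ x κ.≈ x′ ⊎ x′ ≺′ x → x κ.≈ x′
    injective x x′ e (inj₁ x<x′) = contradiction (μ.sym e) (go-≉ (w.wf x) (w.wf x′) x<x′)
    injective x x′ e (inj₂ (inj₁ x≈x′)) = x≈x′
    injective x x′ e (inj₂ (inj₂ x′<x)) = contradiction e (go-≉ (w.wf x′) (w.wf x) x′<x)

  ≼-total : (κ μ : Card) → ¬ κ ≼ μ → μ ≼ κ
  ≼-total κ μ κ⋠μ = by-contradiction λ μ⋠κ →
    κ⋠μ (segments-small⇒≼ w μ λ x i → μ⋠κ (≼-trans i (↾-≼ κ)))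
    where w = wellOrdering κ

  Upward : (Card → Set ℓ) → Set _
  Upward P = ∀ {κ μ} → κ ≼ μ → P κ → P μ

  -- A substitute for initial ordinals: the order is cut off at the first point whose segment
  -- satisfies P.
  leastWellOrdered : (P : Card → Set ℓ) → Upward P → ∀ {κ} → P κ →
    Σ[ μ ∈ Card ] Σ[ w ∈ WellOrder μ ] P μ × (∀ x → ¬ P (segment w x))
  leastWellOrdered P up {κ} pκ with dec (∃ λ x → P (segment (wellOrdering κ) x))
  ... | no none = κ , wellOrdering κ , pκ , λ x p → none (x , p)
  ... | yes some with minimal (WellOrder.wf w) (λ x → P (segment w x)) some
    where w = wellOrdering κ
  ...   | x , px , min = segment w x , pullback (↾-≼ κ) w , px ,
          λ (y , y<x) p → min y<x (up record { to = λ ((z , _) , z<y) → z , z<y ; cong = id ; injective = id } p)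
    where w = wellOrdering κ

  -- A ν with P embeds in no proper segment of the minimal order, since P would pass up to that
  -- segment; the recursion then embeds the whole order in ν.
  least : (P : Card → Set ℓ) → Upward P → ∀ {κ} → P κ →
          Σ[ μ ∈ Card ] P μ × (∀ ν → P ν → μ ≼ ν)
  least P up pκ with leastWellOrdered P up pκ
  ... | μ , w , pμ , min = μ , pμ , λ ν pν → segments-small⇒≼ w ν λ x i → min x (up i pν)

  ≺-upward : (κ : Card) → Upward (κ ≺_)
  ≺-upward κ μ≼ν (κ≼μ , μ⋠κ) = ≼-trans κ≼μ μ≼ν , λ ν≼κ → μ⋠κ (≼-trans μ≼ν ν≼κ)

  -- Bool-valued functions constant on equivalence classes: the power set of the set that the setoid
  -- presents.
  𝒫 : Card → Card
  𝒫 κ = (Setoid.Carrier κ →-setoid Bool) ↾ λ S → ∀ {x y} → Setoid._≈_ κ x y → S x ≡ S y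

  sub-≡ : {A : Set a} {S R : Sub A} → S ≐ R → ∀ x → S x ≡ R x
  sub-≡ {S = S} {R} (S⊆R , R⊆S) x with S x in p | R x in q
  ... | true  | true  = refl
  ... | false | false = refl
  ... | true  | false with S⊆R x (holds (Equivalence.from T-≡ p))
  ...   | holds t = ⊥-elim (subst T q t)
  sub-≡ {S = S} {R} (S⊆R , R⊆S) x | false | true with R⊆S x (holds (Equivalence.from T-≡ q))
  ...   | holds t = ⊥-elim (subst T p t)

  cantor : (κ : Card) → κ ≺ 𝒫 κ
  cantor κ = singletons , λ i → noInjection i
    where
    open Setoid κ using (Carrier; _≈_) renaming (refl to ≈-refl; sym to ≈-sym; trans to ≈-trans)

    respects : {P : Carrier → Set} → (∀ {x y} → x ≈ y → P x → P y) →
               ∀ {x y} → x ≈ y → sub P x ≡ sub P y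
    respects {P} resp {x} {y} x≈y = sub-≡ {S = λ _ → sub P x} {R = λ _ → sub P y}
      ((λ _ (holds t) → holds (_∈_.isTrue (∈-intro {x = y} (resp x≈y (∈-elim {x = x} (holds t)))))) ,
       (λ _ (holds t) → holds (_∈_.isTrue (∈-intro {x = x} (resp (≈-sym x≈y) (∈-elim {x = y} (holds t)))))))
      x

    singletons : κ ≼ 𝒫 κ
    singletons = record
      { to = λ x → sub (x ≈_) , respects (λ p q → ≈-trans q p)
      ; cong = λ x≈y → sub-≡ ((λ z z∈ → ∈-intro (≈-trans (≈-sym x≈y) (∈-elim z∈))) ,
                              (λ z z∈ → ∈-intro (≈-trans x≈y (∈-elim z∈))))
      ; injective = λ {x} {y} e → ≈-sym (∈-elim (holds (subst T (e x) (_∈_.isTrue (∈-intro {x = x} ≈-refl)))))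
      }

    noInjection : ¬ 𝒫 κ ≼ κ
    noInjection i = d∉ (∈-intro (D , ≈-refl , d∉))
      where
      open Injection i
      Diagonal : Carrier → Set
      Diagonal x = Σ[ S ∈ Setoid.Carrier (𝒫 κ) ] to S ≈ x × ¬ x ∈ proj₁ S
      D : Setoid.Carrier (𝒫 κ)
      D = sub Diagonal , respects λ x≈y (S , e , x∉S) → S , ≈-trans e x≈y ,
            λ (holds t) → x∉S (holds (subst T (sym (proj₂ S x≈y)) t))
      d∉ : ¬ to D ∈ sub Diagonal
      d∉ d∈ = let S , e , d∉S = ∈-elim d∈ in d∉S (holds (subst T (sym (injective e (to D))) (_∈_.isTrue d∈)))

  abstract
    successor : (μ : Card) → Σ[ κ ∈ Card ] IsSuccessor μ κ
    successor μ = let κ , μ≺κ , min = least (μ ≺_) (≺-upward μ) (cantor μ) in κ , μ≺κ , min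

  aleph : ∀ n → Σ[ κ ∈ Card ] IsAleph n κ
  aleph zero = ≡-setoid ℕ , lift record
    { to = id ; cong = id ; bijective = id , λ n → n , id }
  aleph (suc n) = let μ , isAleph = aleph n ; κ , isSuc = successor μ in κ , μ , isAleph , isSuc

  aleph-unique : ∀ n {κ μ} → IsAleph n κ → IsAleph n μ → κ ≼ μ
  aleph-unique zero {κ} {μ} (lift f) (lift g) = ≼-trans inverse (Bijection.injection g)
    where
    module κ = Setoid κ
    inverse : κ ≼ ≡-setoid ℕ
    inverse = choose-injection κ (≡-setoid ℕ) (λ y n → Bijection.to f n κ.≈ y)
      (λ y≈y′ e → κ.trans e y≈y′) (Bijection.strictlySurjective f)
      (λ { e e′ refl → κ.trans (κ.sym e) e′ })
  aleph-unique (suc n) (κ′ , a , _ , min) (μ′ , b , (μ′≼μ , μ⋠μ′) , _) =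
    min _ (≼-trans i μ′≼μ , λ μ≼κ′ → μ⋠μ′ (≼-trans μ≼κ′ i))
    where i = aleph-unique n a b

  aleph-resp : ∀ n {κ μ} → IsAleph (suc n) κ → κ ≼ μ → μ ≼ κ → IsAleph (suc n) μ
  aleph-resp n (ν , isAleph , ν≺κ , min) κ≼μ μ≼κ =
    ν , isAleph , ≺-upward ν κ≼μ ν≺κ , λ ρ ν≺ρ → ≼-trans μ≼κ (min ρ ν≺ρ)

  -- An arbitrary well-order of κ may have segments as large as κ. So take a well-order of minimal
  -- type not embeddable in μ, embed κ in it by the minimality of successors, and pull the order
  -- back.
  successorOrder : {μ κ : Card} → IsSuccessor μ κ → Σ[ w ∈ WellOrder κ ] (∀ x → segment w x ≼ μ)
  successorOrder {μ} {κ} ((μ≼κ , κ⋠μ) , min)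
    with leastWellOrdered (λ ν → ¬ ν ≼ μ) (λ i n j → n (≼-trans i j)) κ⋠μ
  ... | ν , w , ν⋠μ , small = pullback i w , λ x → ≼-trans (segmentMap x) (by-contradiction (small (to x)))
    where
    i = min ν (≼-total ν μ ν⋠μ , ν⋠μ)
    open Injection i
    segmentMap : ∀ x → segment (pullback i w) x ≼ segment w (to x)
    segmentMap x = record { to = λ (y , y<x) → to y , y<x ; cong = Injection.cong i ; injective = injective }

  -- S is well-ordered lexicographically, first by rank.
  ranked⇒≼ : (σ ι : Card) (w : WellOrder ι) (ρ : Func σ ι) (ν : Card) →
             (∀ i → ¬ ν ≼ σ ↾ λ s → ¬ WellOrder._≺′_ w i (Func.to ρ s)) → σ ≼ ν
  ranked⇒≼ σ ι w ρ ν small = segments-small⇒≼ lex ν λ s i → small (rank s)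
    (≼-trans i (↾-mono σ λ { (inj₁ p) q → w-irrefl (w.trn p q) ; (inj₂ (p , _)) q → w-irrefl (w.resp ι.refl p q) }))
    where
    module w = WellOrder w
    module v = WellOrder (wellOrdering σ)
    module ι = Setoid ι
    module σ = Setoid σ
    rank = Func.to ρ

    w-irrefl : ∀ {i} → ¬ i w.≺′ i
    w-irrefl {i} = go (w.wf i)
      where
      go : ∀ {i} → Acc w._≺′_ i → ¬ i w.≺′ i
      go (acc rs) p = go (rs p) p

    _⊏_ : Rel σ.Carrier 0ℓ
    s ⊏ t = rank s w.≺′ rank t ⊎ (rank s ι.≈ rank t × s v.≺′ t)

    accessible : ∀ {i s} → Acc w._≺′_ i → Acc v._≺′_ s → rank s ι.≈ i → ∀ {t} → t ⊏ s → Acc _⊏_ t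
    accessible (acc rs) _ e (inj₁ p) = acc (accessible (rs (w.resp ι.refl e p)) (v.wf _) ι.refl)
    accessible p (acc rs) e (inj₂ (q , t<s)) = acc (accessible p (rs t<s) (ι.trans q e))

    lex : WellOrder σ
    lex = record
      { _≺′_ = _⊏_
      ; resp = λ { p q (inj₁ r) → inj₁ (w.resp (Func.cong ρ p) (Func.cong ρ q) r)
                 ; p q (inj₂ (e , r)) →
                     inj₂ (ι.trans (ι.sym (Func.cong ρ p)) (ι.trans e (Func.cong ρ q)) , v.resp p q r) }
      ; wf  = λ s → acc (accessible (w.wf (rank s)) (v.wf s) ι.refl)
      ; trn = λ { (inj₁ p) (inj₁ q) → inj₁ (w.trn p q)
                ; (inj₁ p) (inj₂ (e , _)) → inj₁ (w.resp ι.refl e p)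
                ; (inj₂ (e , _)) (inj₁ q) → inj₁ (w.resp (ι.sym e) ι.refl q)
                ; (inj₂ (e , p)) (inj₂ (e′ , q)) → inj₂ (ι.trans e e′ , v.trn p q) }
      ; tri = tri
      }
      where
      tri : ∀ s t → s ⊏ t ⊎ s σ.≈ t ⊎ t ⊏ s
      tri s t with w.tri (rank s) (rank t) | v.tri s t
      ... | inj₁ p | _ = inj₁ (inj₁ p)
      ... | inj₂ (inj₂ p) | _ = inj₂ (inj₂ (inj₁ p))
      ... | inj₂ (inj₁ e) | inj₁ p = inj₁ (inj₂ (e , p))
      ... | inj₂ (inj₁ e) | inj₂ (inj₁ p) = inj₂ (inj₁ p)
      ... | inj₂ (inj₁ e) | inj₂ (inj₂ p) = inj₂ (inj₂ (inj₂ (ι.sym e , p)))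

  -- Arithmetic of the alephs

  infixl 25 _×ᶜ_

  _×ᶜ_ : Card → Card → Card
  _×ᶜ_ = ×-setoid

  ListOf : Card → Card
  ListOf = ListPointwise.setoid

  Π Σᶜ : (ℕ → Card) → Card
  Π κ = record
    { Carrier = ∀ n → Setoid.Carrier (κ n)
    ; _≈_ = λ f g → ∀ n → Setoid._≈_ (κ n) (f n) (g n)
    ; isEquivalence = record
      { refl  = λ n → Setoid.refl (κ n)
      ; sym   = λ p n → Setoid.sym (κ n) (p n)
      ; trans = λ p q n → Setoid.trans (κ n) (p n) (q n)
      }
    }

  data SameFibre (κ : ℕ → Card) : Rel (Σ ℕ λ n → Setoid.Carrier (κ n)) 0ℓ where
    inFibre : ∀ {n x y} → Setoid._≈_ (κ n) x y → SameFibre κ (n , x) (n , y)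

  Σᶜ κ = record
    { Carrier = Σ ℕ λ n → Setoid.Carrier (κ n)
    ; _≈_ = SameFibre κ
    ; isEquivalence = record
      { refl  = inFibre (Setoid.refl (κ _))
      ; sym   = λ { (inFibre p) → inFibre (Setoid.sym (κ _) p) }
      ; trans = λ { (inFibre p) (inFibre q) → inFibre (Setoid.trans (κ _) p q) }
      }
    }

  fibre-injective : ∀ {κ n x y} → SameFibre κ (n , x) (n , y) → Setoid._≈_ (κ n) x y
  fibre-injective (inFibre p) = p

  fibre-≼ : ∀ κ n → κ n ≼ Σᶜ κ
  fibre-≼ κ n = record { to = n ,_ ; cong = inFibre ; injective = fibre-injective }

  Π-mono : {κ μ : ℕ → Card} → (∀ n → κ n ≼ μ n) → Π κ ≼ Π μ
  Π-mono i = record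
    { to = λ f n → Injection.to (i n) (f n)
    ; cong = λ p n → Injection.cong (i n) (p n)
    ; injective = λ p n → Injection.injective (i n) (p n)
    }

  Sequences : Card → Card
  Sequences κ = Π λ _ → κ

  ×-mono : {κ κ′ μ μ′ : Card} → κ ≼ μ → κ′ ≼ μ′ → κ ×ᶜ κ′ ≼ μ ×ᶜ μ′
  ×-mono i j = record
    { to = λ (x , y) → Injection.to i x , Injection.to j y
    ; cong = λ (p , q) → Injection.cong i p , Injection.cong j q
    ; injective = λ (p , q) → Injection.injective i p , Injection.injective j q
    }

  List-mono : {κ μ : Card} → κ ≼ μ → ListOf κ ≼ ListOf μ
  List-mono {κ} {μ} i = record { to = to ; cong = cong′ ; injective = injective }
    where
    to : List (Setoid.Carrier κ) → List (Setoid.Carrier μ)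
    to [] = []
    to (x ∷ xs) = Injection.to i x ∷ to xs
    cong′ : ∀ {xs ys} → Pointwise (Setoid._≈_ κ) xs ys → Pointwise (Setoid._≈_ μ) (to xs) (to ys)
    cong′ [] = []
    cong′ (p ∷ ps) = Injection.cong i p ∷ cong′ ps
    injective : ∀ {xs ys} → Pointwise (Setoid._≈_ μ) (to xs) (to ys) → Pointwise (Setoid._≈_ κ) xs ys
    injective {[]} {[]} [] = []
    injective {_ ∷ _} {_ ∷ _} (p ∷ ps) = Injection.injective i p ∷ injective ps

  All⇒List : (κ : Card) (P : Setoid.Carrier κ → Set) → ListOf κ ↾ All P ≼ ListOf (κ ↾ P)
  All⇒List κ P = record { to = λ (_ , ps) → to ps ; cong = cong′ _ _ ; injective = injective _ _ }
    where
    to : ∀ {xs} → All P xs → List (Σ (Setoid.Carrier κ) P)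
    to [] = []
    to (p ∷ ps) = (_ , p) ∷ to ps
    cong′ : ∀ {xs ys} (ps : All P xs) (qs : All P ys) → Pointwise (Setoid._≈_ κ) xs ys →
            Pointwise (Setoid._≈_ (κ ↾ P)) (to ps) (to qs)
    cong′ [] [] [] = []
    cong′ (_ ∷ ps) (_ ∷ qs) (e ∷ es) = e ∷ cong′ ps qs es
    injective : ∀ {xs ys} (ps : All P xs) (qs : All P ys) →
                Pointwise (Setoid._≈_ (κ ↾ P)) (to ps) (to qs) → Pointwise (Setoid._≈_ κ) xs ys
    injective [] [] [] = []
    injective (_ ∷ ps) (_ ∷ qs) (e ∷ es) = e ∷ injective ps qs es

  ×⇒List : (κ : Card) → κ ×ᶜ κ ≼ ListOf κ
  ×⇒List κ = record
    { to = λ (x , y) → x ∷ y ∷ []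
    ; cong = λ (p , q) → p ∷ q ∷ []
    ; injective = λ { (p ∷ q ∷ []) → p , q }
    }

  -- The lists over κ stand for finite words, so that the following property absorbs
  -- finite products, countable coproducts and the successor of ordinals.
  ListClosed : Card → Set
  ListClosed κ = ≡-setoid ℕ ≼ κ × ListOf κ ≼ κ

  ListClosed-× : ∀ {κ μ ν} → ListClosed ν → κ ≼ ν → μ ≼ ν → κ ×ᶜ μ ≼ ν
  ListClosed-× {ν = ν} (_ , j) p q = ≼-trans (×-mono p q) (≼-trans (×⇒List ν) j)

  -- There is one class more than in the open segment: x itself goes to the empty list, everything
  -- below it to a singleton.
  closedSegment-≼ : ∀ {κ μ} (w : WellOrder κ) → (∀ x → segment w x ≼ μ) → ListClosed μ →
                    ∀ x → closedSegment w x ≼ μ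
  closedSegment-≼ {κ} {μ} w small (_ , j) x = ≼-trans
    record { to = to′ ; cong = λ {y} {z} → cong′ y z ; injective = λ {y} {z} → injective′ y z } j
    where
    module w = WellOrder w
    module κ = Setoid κ
    open Injection (small x) using (to; injective)

    to′ : Setoid.Carrier (closedSegment w x) → List (Setoid.Carrier μ)
    to′ (y , _) with dec (y w.≺′ x)
    ... | yes y<x = to (y , y<x) ∷ []
    ... | no _ = []

    cong′ : ∀ y z → proj₁ y κ.≈ proj₁ z → Setoid._≈_ (ListOf μ) (to′ y) (to′ z)
    cong′ (y , _) (z , _) e with dec (y w.≺′ x) | dec (z w.≺′ x)
    ... | yes p | yes q = Injection.cong (small x) e ∷ []
    ... | yes p | no ¬q = contradiction (w.resp e κ.refl p) ¬q
    ... | no ¬p | yes q = contradiction (w.resp (κ.sym e) κ.refl q) ¬p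
    ... | no _ | no _ = []

    maximum : ∀ {y} → ¬ x w.≺′ y → ¬ y w.≺′ x → y κ.≈ x
    maximum {y} ¬p ¬q with w.tri x y
    ... | inj₁ p = contradiction p ¬p
    ... | inj₂ (inj₁ e) = κ.sym e
    ... | inj₂ (inj₂ q) = contradiction q ¬q

    injective′ : ∀ y z → Setoid._≈_ (ListOf μ) (to′ y) (to′ z) → proj₁ y κ.≈ proj₁ z
    injective′ (y , ¬x<y) (z , ¬x<z) es with dec (y w.≺′ x) | dec (z w.≺′ x) | es
    ... | yes p | yes q | e ∷ [] = injective e
    ... | yes p | no ¬q | ()
    ... | no ¬p | yes q | ()
    ... | no ¬p | no ¬q | [] = κ.trans (maximum ¬x<y ¬p) (κ.sym (maximum ¬x<z ¬q))

  bounded-≮ : {κ : Card} (w : WellOrder κ) {x y z : Setoid.Carrier κ} →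
              ¬ WellOrder._≺′_ w x y → ¬ WellOrder._≺′_ w y z → ¬ WellOrder._≺′_ w x z
  bounded-≮ {κ} w {x} {y} {z} ¬x<y ¬y<z x<z with WellOrder.tri w y z
  ... | inj₁ y<z = ¬y<z y<z
  ... | inj₂ (inj₁ y≈z) = ¬x<y (WellOrder.resp w (Setoid.refl κ) (Setoid.sym κ y≈z) x<z)
  ... | inj₂ (inj₂ z<y) = ¬x<y (WellOrder.trn w x<z z<y)

  double : ℕ → ℕ
  double n = n ℕ.+ n

  double-injective : ∀ m n → double m ≡ double n → m ≡ n
  double-injective zero zero _ = refl
  double-injective (suc m) (suc n) e = cong suc (double-injective m n
    (ℕ.suc-injective (trans (sym (ℕ.+-suc m m)) (trans (ℕ.suc-injective e) (ℕ.+-suc n n)))))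

  double≢odd : ∀ m n → ¬ double m ≡ suc (double n)
  double≢odd (suc m) n e = double≢odd n m (sym (trans (sym (ℕ.+-suc m m)) (ℕ.suc-injective e)))

  -- 2ⁿ(2m + 1)
  pair : ℕ → ℕ → ℕ
  pair zero m = suc (double m)
  pair (suc n) m = double (pair n m)

  pair-injective : ∀ n n′ {m m′} → pair n m ≡ pair n′ m′ → n ≡ n′ × m ≡ m′
  pair-injective zero zero e = refl , double-injective _ _ (ℕ.suc-injective e)
  pair-injective zero (suc n′) {m} {m′} e = contradiction (sym e) (double≢odd (pair n′ m′) m)
  pair-injective (suc n) zero {m} {m′} e = contradiction e (double≢odd (pair n m) m′)
  pair-injective (suc n) (suc n′) e =
    let p , q = pair-injective n n′ (double-injective _ _ e) in cong suc p , q

  pair≢0 : ∀ n m → ¬ pair n m ≡ 0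
  pair≢0 (suc n) m e with pair n m in eq
  ... | zero = pair≢0 n m eq

  -- `pair` never takes the value 0, which is therefore free to code the empty list.
  ℕ-ListClosed : ListClosed (≡-setoid ℕ)
  ℕ-ListClosed = ≼-refl _ , record { to = code ; cong = code-cong ; injective = injective _ _ }
    where
    code : List ℕ → ℕ
    code [] = 0
    code (x ∷ xs) = pair x (code xs)
    code-cong : ∀ {xs ys} → Pointwise _≡_ xs ys → code xs ≡ code ys
    code-cong [] = refl
    code-cong {x ∷ _} (refl ∷ ps) = cong (pair x) (code-cong ps)
    injective : ∀ xs ys → code xs ≡ code ys → Pointwise _≡_ xs ys
    injective [] [] _ = []
    injective [] (y ∷ ys) e = contradiction (sym e) (pair≢0 y _)
    injective (x ∷ xs) [] e = contradiction e (pair≢0 x _)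
    injective (x ∷ xs) (y ∷ ys) e =
      let p , q = pair-injective x y e in p ∷ injective xs ys q

  module Successor {μ κ : Card} (μ≺κ : μ ≺ κ) (w : WellOrder κ) (segment-small : ∀ x → segment w x ≼ μ)
                   (closed : ListClosed μ) where
    private
      module w = WellOrder w
      module κ = Setoid κ
      open w using (_≺′_)

      closedSegment-small : ∀ x → closedSegment w x ≼ μ
      closedSegment-small = closedSegment-≼ w segment-small closed

      κ⋠μ : ¬ κ ≼ μ
      κ⋠μ = proj₂ μ≺κ

    -- Rank each s by a chosen bound. The elements of rank at most x all have x as a bound, so they
    -- number at most μ, and κ does not embed in them; `ranked⇒≼` applies.
    bounded⇒≼ : (σ : Card) (Bound : κ.Carrier → Setoid.Carrier σ → Set) →
                (∀ {s t x} → Setoid._≈_ σ s t → Bound x s → Bound x t) →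
                (∀ s → ∃ λ x → Bound x s) →
                (∀ {x y s} → ¬ x ≺′ y → Bound y s → Bound x s) →
                (∀ x → σ ↾ Bound x ≼ μ) → σ ≼ κ
    bounded⇒≼ σ Bound resp total weaken small with choose σ κ (λ s x → Bound x s) resp total
    ... | ρ , spec = ranked⇒≼ σ κ w ρ κ λ x i →
      κ⋠μ (≼-trans i (≼-trans (↾-mono σ λ {s} ¬x<ρs → weaken ¬x<ρs (spec s)) (small x)))

    -- Hessenberg's theorem at a successor: a finite list is bounded by its maximum, and the lists
    -- below a given bound are lists over a closed segment, of which there are at most μ.
    listClosed : ListClosed κ
    listClosed = ≼-trans (proj₁ closed) μ≼κ ,
      bounded⇒≼ (ListOf κ) (λ x → All λ y → ¬ x ≺′ y) resp total
        (λ x≮y → All.map (bounded-≮ w x≮y))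
        (λ x → ≼-trans (All⇒List κ _) (≼-trans (List-mono (closedSegment-small x)) (proj₂ closed)))
      where
      μ≼κ = proj₁ μ≺κ
      resp : ∀ {xs ys z} → Pointwise κ._≈_ xs ys → All (λ y → ¬ z ≺′ y) xs → All (λ y → ¬ z ≺′ y) ys
      resp [] [] = []
      resp (e ∷ es) (p ∷ ps) = (λ z<y → p (w.resp κ.refl (κ.sym e) z<y)) ∷ resp es ps
      irrefl : ∀ {x} → Acc _≺′_ x → ¬ x ≺′ x
      irrefl (acc rs) p = irrefl (rs p) p
      total : ∀ xs → ∃ λ x → All (λ y → ¬ x ≺′ y) xs
      total [] = Injection.to (≼-trans (proj₁ closed) μ≼κ) 0 , []
      total (x ∷ xs) with total xs
      ... | y , ps with dec (y ≺′ x)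
      ...   | no y≮x = y , y≮x ∷ ps
      ...   | yes y<x = x , irrefl (w.wf x) ∷ All.map (bounded-≮ w λ x<y → irrefl (w.wf x) (w.trn x<y y<x)) ps

    -- Hausdorff's argument: a successor cardinal has uncountable cofinality.
    sequences : Sequences μ ≼ μ → Sequences κ ≼ κ
    sequences i = bounded⇒≼ (Sequences κ) (λ x f → ∀ n → ¬ x ≺′ f n)
      (λ e p n x<g → p n (w.resp κ.refl (κ.sym (e n)) x<g)) total
      (λ x≮y p n → bounded-≮ w x≮y (p n))
      (λ x → ≼-trans (into x) (≼-trans (Π-mono λ _ → closedSegment-small x) i))
      where
      into : ∀ x → Sequences κ ↾ (λ f → ∀ n → ¬ x ≺′ f n) ≼ Sequences (closedSegment w x)
      into x = record { to = λ (f , p) n → f n , p n ; cong = id ; injective = id }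

      -- If f were unbounded, every x would lie below some f n. Pairing such an n with the place of
      -- x in the segment of f n would give κ ≼ ℕ × μ ≼ μ.
      total : ∀ f → ∃ λ x → ∀ n → ¬ x ≺′ f n
      total f = by-contradiction λ unbounded → κ⋠μ (≼-trans (cofinal unbounded)
        (ListClosed-× closed (proj₁ closed) (≼-refl μ)))
        where
        cofinal : ¬ (∃ λ x → ∀ n → ¬ x ≺′ f n) → κ ≼ ≡-setoid ℕ ×ᶜ μ
        cofinal unbounded = choose-injection κ (≡-setoid ℕ ×ᶜ μ)
          (λ x (n , y) → Σ[ x<f ∈ x ≺′ f n ] Setoid._≈_ μ (Injection.to (segment-small (f n)) (x , x<f)) y)
          (λ { {x} {x′} {n , y} e (p , q) → w.resp e κ.refl p ,
               Setoid.trans μ (Injection.cong (segment-small (f n)) {x′ , w.resp e κ.refl p} {x , p} (κ.sym e)) q })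
          (λ x → let n , ¬¬p = counterexample (λ h → unbounded (x , h))
                     p = by-contradiction ¬¬p in (n , Injection.to (segment-small (f n)) (x , p)) , p , Setoid.refl μ)
          (λ { {y = n , _} (p , q) (p′ , q′) (refl , e) →
               Injection.injective (segment-small (f n)) (Setoid.trans μ q (Setoid.trans μ e (Setoid.sym μ q′))) })

  ListClosed-resp : ∀ {κ μ} → κ ≼ μ → μ ≼ κ → ListClosed κ → ListClosed μ
  ListClosed-resp i j (p , q) = ≼-trans p i , ≼-trans (List-mono j) (≼-trans q i)

  aleph-ListClosed : ∀ n {κ} → IsAleph n κ → ListClosed κ
  aleph-ListClosed zero isAleph@(lift f) =
    ListClosed-resp (Bijection.injection f) (aleph-unique 0 isAleph (proj₂ (aleph 0))) ℕ-ListClosed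
  aleph-ListClosed (suc n) (μ , isAleph , isSuc) =
    Successor.listClosed (proj₁ isSuc) w small (aleph-ListClosed n isAleph)
    where
    w = proj₁ (successorOrder isSuc)
    small = proj₂ (successorOrder isSuc)

  -- Countable powers of alephs under CH, and König's theorem

  2^ω : Card
  2^ω = ℕ →-setoid Bool

  Sequences-2^ω : Sequences 2^ω ≼ 2^ω
  Sequences-2^ω = record
    { to = code
    ; cong = λ p → sub-≡ ((λ _ x∈ → ∈-intro (move p (∈-elim x∈))) ,
                          (λ _ x∈ → ∈-intro (move (λ i j → sym (p i j)) (∈-elim x∈))))
    ; injective = λ {F} {G} e i → sub-≡
        ( (λ j → decode F G (e (pair i j)) i j refl) , (λ j → decode G F (sym (e (pair i j))) i j refl))
    }
    where
    Code : (ℕ → ℕ → Bool) → ℕ → Set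
    Code F m = ∃ λ i → ∃ λ j → pair i j ≡ m × j ∈ F i
    code : (ℕ → ℕ → Bool) → ℕ → Bool
    code F = sub (Code F)
    move : ∀ {F G m} → (∀ i j → F i j ≡ G i j) → Code F m → Code G m
    move p (i , j , e , holds t) = i , j , e , holds (subst T (p i j) t)
    decode : ∀ F G {m} → code F m ≡ code G m → ∀ i j → pair i j ≡ m → j ∈ F i → j ∈ G i
    decode F G e i j e′ j∈
      with ∈-elim {P = Code G} (holds (subst T e (_∈_.isTrue (∈-intro {P = Code F} (i , j , e′ , j∈)))))
    ... | i′ , j′ , e″ , j′∈ with pair-injective i′ i (trans e″ (sym e′))
    ...   | refl , refl = j′∈

  -- The induction starts at ℵ₁, which is 2^ω by CH; at ℵ₀ the claim is false.
  CH⇒aleph-Sequences : CH → ∀ n {κ} → IsAleph (suc n) κ → Sequences κ ≼ κ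
  CH⇒aleph-Sequences ch zero isAleph =
    ≼-trans (Π-mono λ _ → aleph-unique 1 isAleph ch) (≼-trans Sequences-2^ω (aleph-unique 1 ch isAleph))
  CH⇒aleph-Sequences ch (suc n) (μ , isAleph , isSuc) =
    Successor.sequences (proj₁ isSuc) w small (aleph-ListClosed (suc n) isAleph)
      (CH⇒aleph-Sequences ch n isAleph)
    where
    w = proj₁ (successorOrder isSuc)
    small = proj₂ (successorOrder isSuc)

  ℵ : ℕ → Card
  ℵ n = proj₁ (aleph n)

  ℵ-isAleph : ∀ n → IsAleph n (ℵ n)
  ℵ-isAleph n = proj₂ (aleph n)

  ℵ-suc : ∀ n → IsSuccessor (ℵ n) (ℵ (suc n))
  ℵ-suc n = proj₂ (successor (ℵ n))

  ℵ-mono : ∀ {m n} → m ℕ.≤′ n → ℵ m ≼ ℵ n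
  ℵ-mono ℕ.≤′-refl = ≼-refl _
  ℵ-mono {n = suc n} (ℕ.≤′-step p) = ≼-trans (ℵ-mono p) (proj₁ (proj₁ (ℵ-suc n)))

  ℕ≺2^ω : ≡-setoid ℕ ≺ 2^ω
  ℕ≺2^ω = ≼-trans (proj₁ (cantor (≡-setoid ℕ))) (↾-≼ 2^ω) , λ i → proj₂ (cantor (≡-setoid ℕ)) (≼-trans (↾-≼ 2^ω) i)

  CH-if : ∀ {κ} → IsAleph 1 κ → 2^ω ≼ κ → CH
  CH-if {κ} isAleph@(μ , isAleph₀ , _ , min) i = ≡-setoid ℕ , ℵ-isAleph 0 , ℕ≺2^ω ,
    λ ν ℕ≺ν → ≼-trans i (min ν (≺-ν ℕ≺ν))
    where
    ≺-ν : ∀ {ν} → ≡-setoid ℕ ≺ ν → μ ≺ ν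
    ≺-ν (j , k) = ≼-trans (aleph-unique 0 isAleph₀ (ℵ-isAleph 0)) j ,
      λ l → k (≼-trans l (aleph-unique 0 isAleph₀ (ℵ-isAleph 0)))

  -- The functions sent into fibre n have at most ℵₙ different n-th coordinates, so some element of
  -- ℵₙ₊₁ is missed. The function `d` made of missed elements has no possible image.
  könig : ¬ Π (λ n → ℵ (suc n)) ≼ Σᶜ ℵ
  könig i = impossible (to d) refl
    where
    open Injection i
    module ℵ n = Setoid (ℵ n)
    Reached : ∀ n → ℵ.Carrier (suc n) → ℵ.Carrier n → Set
    Reached n z y = ∃ λ f → SameFibre ℵ (to f) (n , y) × ℵ._≈_ (suc n) (f n) z
    missed : ∀ n → ∃ λ z → ¬ ∃ (Reached n z)
    missed n = counterexample λ all → proj₂ (proj₁ (ℵ-suc n)) (choose-injection (ℵ (suc n)) (ℵ n) (Reached n)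
      (λ { e (f , p , q) → f , p , ℵ.trans (suc n) q e }) all
      (λ { (f , p , q) (f′ , p′ , q′) e → ℵ.trans (suc n) (ℵ.sym (suc n) q) (ℵ.trans (suc n)
           (injective (Setoid.trans (Σᶜ ℵ) p (Setoid.trans (Σᶜ ℵ) (inFibre e) (Setoid.sym (Σᶜ ℵ) p′))) n) q′) }))
    d : ∀ n → ℵ.Carrier (suc n)
    d n = proj₁ (missed n)
    impossible : ∀ s → to d ≡ s → ⊥
    impossible (n , y) e = proj₂ (missed n) (y , d , subst (SameFibre ℵ (to d)) e (Setoid.refl (Σᶜ ℵ)) , ℵ.refl (suc n))

  UpperBound-Σℵ : UpperBoundOfAlephs (Σᶜ ℵ)
  UpperBound-Σℵ n μ isAleph = ≼-trans (aleph-unique n isAleph (ℵ-isAleph n)) (fibre-≼ ℵ n)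

  ℕ-order : WellOrder (≡-setoid ℕ)
  ℕ-order = record
    { _≺′_ = _<_
    ; resp = λ { refl refl p → p }
    ; wf = <-wellFounded
    ; trn = ℕ.<-trans
    ; tri = tri
    }
    where
    tri : ∀ m n → m < n ⊎ m ≡ n ⊎ n < m
    tri m n with ℕ.<-cmp m n
    ... | tri< p _ _ = inj₁ p
    ... | tri≈ _ p _ = inj₂ (inj₁ p)
    ... | tri> _ _ p = inj₂ (inj₂ p)

  -- Rank each element by the index of a piece containing it. An initial part lies in a single
  -- piece, of size at most ℵₙ₊₁, whereas an upper bound ν of the alephs dominates ℵₙ₊₂ and cannot
  -- embed there.
  filtered⇒≼ : (σ : Card) (InPiece : ℕ → Setoid.Carrier σ → Set) →
               (∀ {s t n} → Setoid._≈_ σ s t → InPiece n s → InPiece n t) →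
               (∀ s → ∃ λ n → InPiece n s) →
               (∀ {m n s} → m ℕ.≤ n → InPiece m s → InPiece n s) →
               (∀ n → σ ↾ InPiece n ≼ ℵ (suc n)) →
               ∀ {ν} → UpperBoundOfAlephs ν → σ ≼ ν
  filtered⇒≼ σ InPiece resp total mono small {ν} upper with choose σ (≡-setoid ℕ) (λ s n → InPiece n s) resp total
  ... | ρ , spec = ranked⇒≼ σ (≡-setoid ℕ) ℕ-order ρ ν λ n i →
    proj₂ (proj₁ (ℵ-suc (suc n))) (≼-trans (upper (suc (suc n)) _ (ℵ-isAleph (suc (suc n))))
      (≼-trans i (≼-trans (↾-mono σ λ {s} n≮ → mono (ℕ.≮⇒≥ n≮) (spec s)) (small n))))

  module ℤSolver = IntegerSolver.+-*-Solver

  -- Abelian groups as ℤ-modules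

  -- The action depends on the operations alone, so that a group and its quotients share it.
  module Scalar {A : Set a} (_∙_ : A → A → A) (ε : A) (_⁻¹ : A → A) where
    infixr 7.5 _·ℕ_ _·_

    _·ℕ_ : ℕ → A → A
    zero ·ℕ x = ε
    suc n ·ℕ x = x ∙ (n ·ℕ x)

    _·_ : ℤ → A → A
    (+ n) · x = n ·ℕ x
    -[1+ n ] · x = (suc n ·ℕ x) ⁻¹

  module Module (G : AbGroup) where
    open AbelianGroup G public renaming (refl to ≈-refl; sym to ≈-sym; trans to ≈-trans; reflexive to ≈-reflexive)
    open Scalar _∙_ ε _⁻¹ public
    open AbelianGroupProperties G public using (ε⁻¹≈ε; ⁻¹-∙-comm; ⁻¹-involutive; ⁻¹-injective)
    open CommutativeSemigroupProperties commutativeSemigroup public using (interchange)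
    open SetoidReasoning setoid

    ·ℕ-cong : ∀ n {x y} → x ≈ y → n ·ℕ x ≈ n ·ℕ y
    ·ℕ-cong zero p = ≈-refl
    ·ℕ-cong (suc n) p = ∙-cong p (·ℕ-cong n p)

    ·-cong : ∀ n {x y} → x ≈ y → n · x ≈ n · y
    ·-cong (+ n) p = ·ℕ-cong n p
    ·-cong -[1+ n ] p = ⁻¹-cong (·ℕ-cong (suc n) p)

    ·ℕ-+ : ∀ m n x → (m ℕ.+ n) ·ℕ x ≈ m ·ℕ x ∙ n ·ℕ x
    ·ℕ-+ zero n x = ≈-sym (identityˡ _)
    ·ℕ-+ (suc m) n x = ≈-trans (∙-congˡ (·ℕ-+ m n x)) (≈-sym (assoc _ _ _))

    ·ℕ-∙ : ∀ n x y → n ·ℕ (x ∙ y) ≈ n ·ℕ x ∙ n ·ℕ y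
    ·ℕ-∙ zero x y = ≈-sym (identityˡ _)
    ·ℕ-∙ (suc n) x y = ≈-trans (∙-congˡ (·ℕ-∙ n x y)) (interchange _ _ _ _)

    ·-∙ : ∀ n x y → n · (x ∙ y) ≈ n · x ∙ n · y
    ·-∙ (+ n) x y = ·ℕ-∙ n x y
    ·-∙ -[1+ n ] x y = ≈-trans (⁻¹-cong (·ℕ-∙ (suc n) x y)) (≈-sym (⁻¹-∙-comm _ _))

    ·-⊖ : ∀ m n x → (m ℤ.⊖ n) · x ≈ m ·ℕ x ∙ (n ·ℕ x) ⁻¹
    ·-⊖ m zero x = ≈-sym (≈-trans (∙-congˡ ε⁻¹≈ε) (identityʳ _))
    ·-⊖ zero (suc n) x = ≈-sym (identityˡ _)
    ·-⊖ (suc m) (suc n) x = begin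
      (suc m ℤ.⊖ suc n) · x                        ≡⟨ cong (_· x) (ℤ.[1+m]⊖[1+n]≡m⊖n m n) ⟩
      (m ℤ.⊖ n) · x                                ≈⟨ ·-⊖ m n x ⟩
      m ·ℕ x ∙ (n ·ℕ x) ⁻¹                         ≈⟨ identityˡ _ ⟨
      ε ∙ (m ·ℕ x ∙ (n ·ℕ x) ⁻¹)                   ≈⟨ ∙-congʳ (inverseʳ x) ⟨
      (x ∙ x ⁻¹) ∙ (m ·ℕ x ∙ (n ·ℕ x) ⁻¹)          ≈⟨ interchange _ _ _ _ ⟩
      (x ∙ m ·ℕ x) ∙ (x ⁻¹ ∙ (n ·ℕ x) ⁻¹)          ≈⟨ ∙-congˡ (⁻¹-∙-comm _ _) ⟩
      (x ∙ m ·ℕ x) ∙ (x ∙ n ·ℕ x) ⁻¹               ∎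

    ·-+ : ∀ m n x → (m ℤ.+ n) · x ≈ m · x ∙ n · x
    ·-+ (+ m) (+ n) x = ·ℕ-+ m n x
    ·-+ (+ m) -[1+ n ] x = ·-⊖ m (suc n) x
    ·-+ -[1+ m ] (+ n) x = ≈-trans (·-⊖ n (suc m) x) (comm _ _)
    ·-+ -[1+ m ] -[1+ n ] x = begin
      (suc (suc (m ℕ.+ n)) ·ℕ x) ⁻¹         ≡⟨ cong (λ k → (suc k ·ℕ x) ⁻¹) (ℕ.+-suc m n) ⟨
      ((suc m ℕ.+ suc n) ·ℕ x) ⁻¹           ≈⟨ ⁻¹-cong (·ℕ-+ (suc m) (suc n) x) ⟩
      (suc m ·ℕ x ∙ suc n ·ℕ x) ⁻¹          ≈⟨ ⁻¹-∙-comm _ _ ⟨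
      (suc m ·ℕ x) ⁻¹ ∙ (suc n ·ℕ x) ⁻¹     ∎

    ·-neg : ∀ n x → (ℤ.- n) · x ≈ (n · x) ⁻¹
    ·-neg (+ zero) x = ≈-sym ε⁻¹≈ε
    ·-neg (+ suc n) x = ≈-refl
    ·-neg -[1+ n ] x = ≈-sym (⁻¹-involutive _)

    ·-ε : ∀ n → n · ε ≈ ε
    ·-ε n = AbelianGroupProperties.identityʳ-unique G (n · ε) (n · ε)
      (≈-trans (≈-sym (·-∙ n ε ε)) (·-cong n (identityˡ ε)))

    ·-⁻¹ : ∀ n x → n · (x ⁻¹) ≈ (n · x) ⁻¹
    ·-⁻¹ n x = AbelianGroupProperties.inverseʳ-unique G (n · x) (n · (x ⁻¹))
      (≈-trans (≈-sym (·-∙ n x (x ⁻¹))) (≈-trans (·-cong n (inverseʳ x)) (·-ε n)))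

    ·ℕ-* : ∀ m n x → (+ m ℤ.* n) · x ≈ m ·ℕ (n · x)
    ·ℕ-* zero n x = ≈-reflexive (cong (_· x) (ℤ.*-zeroˡ n))
    ·ℕ-* (suc m) n x = begin
      (+ suc m ℤ.* n) · x             ≡⟨ cong (_· x) (ℤ.suc-* (+ m) n) ⟩
      (n ℤ.+ + m ℤ.* n) · x           ≈⟨ ·-+ n (+ m ℤ.* n) x ⟩
      n · x ∙ (+ m ℤ.* n) · x         ≈⟨ ∙-congˡ (·ℕ-* m n x) ⟩
      n · x ∙ m ·ℕ (n · x)            ∎

    ·-* : ∀ m n x → (m ℤ.* n) · x ≈ m · (n · x)
    ·-* (+ m) n x = ·ℕ-* m n x
    ·-* -[1+ m ] n x = begin
      (-[1+ m ] ℤ.* n) · x            ≡⟨ cong (_· x) (ℤ.neg-distribˡ-* (+ suc m) n) ⟨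
      (ℤ.- (+ suc m ℤ.* n)) · x       ≈⟨ ·-neg (+ suc m ℤ.* n) x ⟩
      ((+ suc m ℤ.* n) · x) ⁻¹        ≈⟨ ⁻¹-cong (·ℕ-* (suc m) n x) ⟩
      (suc m ·ℕ (n · x)) ⁻¹           ∎

    1· : ∀ x → 1ℤ · x ≈ x
    1· x = identityʳ x

    open ℤSolver using (Polynomial; con; normalise; correct)

    infixl 6 _⊕_
    infixr 8 _⊙_
    infix 9 ⊖_
    infix 4 _⊜_

    data Expr (n m : ℕ) : Set where
      var : Fin m → Expr n m
      𝟘   : Expr n m
      _⊕_ : (e f : Expr n m) → Expr n m
      ⊖_  : Expr n m → Expr n m
      _⊙_ : Polynomial n → Expr n m → Expr n m

    record Equation (n m : ℕ) : Set where
      constructor _⊜_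
      field lhs rhs : Expr n m

    private variable n m : ℕ

    eval : Vec ℤ n → Vec Carrier m → Expr n m → Carrier
    eval ρ σ (var i) = Vec.lookup σ i
    eval ρ σ 𝟘 = ε
    eval ρ σ (e ⊕ f) = eval ρ σ e ∙ eval ρ σ f
    eval ρ σ (⊖ e) = eval ρ σ e ⁻¹
    eval ρ σ (p ⊙ e) = ℤSolver.⟦ p ⟧ ρ · eval ρ σ e

    coefficient : Expr n m → Fin m → Polynomial n
    coefficient (var i) j = con (if does (i Fin.≟ j) then 1ℤ else 0ℤ)
    coefficient 𝟘 j = con 0ℤ
    coefficient (e ⊕ f) j = coefficient e j ℤSolver.:+ coefficient f j
    coefficient (⊖ e) j = ℤSolver.:- coefficient e j
    coefficient (p ⊙ e) j = p ℤSolver.:* coefficient e j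

    linear : (Fin m → ℤ) → Vec Carrier m → Carrier
    linear c [] = ε
    linear c (x ∷ xs) = c Fin.zero · x ∙ linear (c ∘ Fin.suc) xs

    linear-cong : ∀ {c d : Fin m → ℤ} → (∀ j → c j ≡ d j) → ∀ σ → linear c σ ≈ linear d σ
    linear-cong p [] = ≈-refl
    linear-cong p (x ∷ σ) = ∙-cong (≈-reflexive (cong (_· x) (p Fin.zero))) (linear-cong (p ∘ Fin.suc) σ)

    linear-0 : (σ : Vec Carrier m) → ε ≈ linear (λ _ → 0ℤ) σ
    linear-0 [] = ≈-refl
    linear-0 (x ∷ σ) = ≈-trans (linear-0 σ) (≈-sym (identityˡ _))

    linear-var : ∀ (σ : Vec Carrier m) i → Vec.lookup σ i ≈ linear (λ j → if does (i Fin.≟ j) then 1ℤ else 0ℤ) σ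
    linear-var (x ∷ σ) Fin.zero = ≈-trans (≈-sym (identityʳ x)) (∙-cong (≈-sym (1· x)) (linear-0 σ))
    linear-var (x ∷ σ) (Fin.suc i) = ≈-trans (linear-var σ i) (≈-sym (identityˡ _))

    linear-+ : ∀ (c d : Fin m → ℤ) σ → linear c σ ∙ linear d σ ≈ linear (λ j → c j ℤ.+ d j) σ
    linear-+ c d [] = identityˡ ε
    linear-+ c d (x ∷ σ) = ≈-trans (interchange _ _ _ _)
      (∙-cong (≈-sym (·-+ (c Fin.zero) (d Fin.zero) x)) (linear-+ (c ∘ Fin.suc) (d ∘ Fin.suc) σ))

    linear-neg : ∀ (c : Fin m → ℤ) σ → linear c σ ⁻¹ ≈ linear (λ j → ℤ.- c j) σ
    linear-neg c [] = ε⁻¹≈ε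
    linear-neg c (x ∷ σ) = ≈-trans (≈-sym (⁻¹-∙-comm _ _))
      (∙-cong (≈-sym (·-neg (c Fin.zero) x)) (linear-neg (c ∘ Fin.suc) σ))

    linear-* : ∀ k (c : Fin m → ℤ) σ → k · linear c σ ≈ linear (λ j → k ℤ.* c j) σ
    linear-* k c [] = ·-ε k
    linear-* k c (x ∷ σ) = ≈-trans (·-∙ k _ _)
      (∙-cong (≈-sym (·-* k (c Fin.zero) x)) (linear-* k (c ∘ Fin.suc) σ))

    eval-linear : ∀ (ρ : Vec ℤ n) (σ : Vec Carrier m) e →
                  eval ρ σ e ≈ linear (λ j → ℤSolver.⟦ coefficient e j ⟧ ρ) σ
    eval-linear ρ σ (var i) = linear-var σ i
    eval-linear ρ σ 𝟘 = linear-0 σ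
    eval-linear ρ σ (e ⊕ f) = ≈-trans (∙-cong (eval-linear ρ σ e) (eval-linear ρ σ f)) (linear-+ _ _ σ)
    eval-linear ρ σ (⊖ e) = ≈-trans (⁻¹-cong (eval-linear ρ σ e)) (linear-neg _ σ)
    eval-linear ρ σ (p ⊙ e) = ≈-trans (·-cong (ℤSolver.⟦ p ⟧ ρ) (eval-linear ρ σ e))
      (linear-* (ℤSolver.⟦ p ⟧ ρ) (λ j → ℤSolver.⟦ coefficient e j ⟧ ρ) σ)

    -- Both sides are linear combinations of the variables, and the ring solver compares
    -- their coefficients.
    solve : (ρ : Vec ℤ n) (σ : Vec Carrier m)
            (eq : Vec (Polynomial n) n → Vec (Expr n m) m → Equation n m) →
            let l ⊜ r = eq (Vec.tabulate ℤSolver.var) (Vec.tabulate var) in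
            Vec.tabulate (normalise ∘ coefficient l) ≡ Vec.tabulate (normalise ∘ coefficient r) →
            eval ρ σ l ≈ eval ρ σ r
    solve ρ σ eq p = let l ⊜ r = eq (Vec.tabulate ℤSolver.var) (Vec.tabulate var) in
      ≈-trans (eval-linear ρ σ l) (≈-trans (linear-cong (λ j → trans (sym (correct (coefficient l j) ρ))
        (trans (cong (λ q → ℤSolver.⟦ q ⟧N ρ) (agree l r p j)) (correct (coefficient r j) ρ))) σ)
      (≈-sym (eval-linear ρ σ r)))
      where
      agree : ∀ (l r : Expr _ _) → Vec.tabulate (normalise ∘ coefficient l) ≡ Vec.tabulate (normalise ∘ coefficient r) →
              ∀ j → normalise (coefficient l j) ≡ normalise (coefficient r j)
      agree l r p j = trans (sym (Vec.lookup∘tabulate (normalise ∘ coefficient l) j))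
        (trans (cong (λ v → Vec.lookup v j) p) (Vec.lookup∘tabulate (normalise ∘ coefficient r) j))

    x∙y⁻¹≈ε⇒x≈y : ∀ {x y} → x ∙ y ⁻¹ ≈ ε → x ≈ y
    x∙y⁻¹≈ε⇒x≈y {x} {y} p = begin
      x                  ≈⟨ solve [] (x ∷ y ∷ []) (λ { [] (x ∷ y ∷ []) → x ⊜ (x ⊕ ⊖ y) ⊕ y }) refl ⟩
      x ∙ y ⁻¹ ∙ y       ≈⟨ ∙-congʳ p ⟩
      ε ∙ y              ≈⟨ identityˡ y ⟩
      y                  ∎

    x-ε≈x : ∀ x → x - ε ≈ x
    x-ε≈x x = ≈-trans (∙-congˡ ε⁻¹≈ε) (identityʳ x)

    x∙y-y≈x : ∀ x y → (x ∙ y) - y ≈ x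
    x∙y-y≈x x y = ≈-trans (assoc x y (y ⁻¹)) (≈-trans (∙-congˡ (inverseʳ y)) (identityʳ x))

  -- Torsion-free groups and divisibility

  infixl 25 _×ᴳ_

  _×ᴳ_ : AbGroup → AbGroup → AbGroup
  _×ᴳ_ = DirectProduct.abelianGroup

  TorsionFree : AbGroup → Set
  TorsionFree G = ∀ n x → ¬ n ≡ 0ℤ → n · x ≈ ε → x ≈ ε
    where open Module G

  -- For n = 0 this says y ≈ ε. Transferring divisibility by 0 thus expresses that a relation is
  -- functional.
  Divides : (G : AbGroup) → ℤ → AbelianGroup.Carrier G → Set
  Divides G n y = ∃ λ x → n · x ≈ y
    where open Module G

  ·-homo : ∀ {G H} (f : Hom G H) n x →
           AbelianGroup._≈_ H (GroupHomomorphism.⟦_⟧ f (Module._·_ G n x)) (Module._·_ H n (GroupHomomorphism.⟦_⟧ f x))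
  ·-homo {G} {H} f = λ { (+ n) x → ℕ-homo n x ; -[1+ n ] x → H.≈-trans (f.⁻¹-homo _) (H.⁻¹-cong (ℕ-homo (suc n) x)) }
    where
    module G = Module G
    module H = Module H
    module f = GroupHomomorphism f
    ℕ-homo : ∀ n x → f.⟦ n G.·ℕ x ⟧ H.≈ n H.·ℕ f.⟦ x ⟧
    ℕ-homo zero x = f.ε-homo
    ℕ-homo (suc n) x = H.≈-trans (f.homo _ _) (H.∙-congˡ (ℕ-homo n x))

  ·-pair : ∀ G H n x y →
           AbelianGroup._≈_ (G ×ᴳ H) (Module._·_ (G ×ᴳ H) n (x , y)) (Module._·_ G n x , Module._·_ H n y)
  ·-pair G H = λ { (+ n) x y → ℕ-pair n x y ; -[1+ n ] x y → P.⁻¹-cong (ℕ-pair (suc n) x y) }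
    where
    module G = Module G
    module H = Module H
    module P = Module (G ×ᴳ H)
    ℕ-pair : ∀ n x y → n P.·ℕ (x , y) P.≈ (n G.·ℕ x , n H.·ℕ y)
    ℕ-pair zero x y = P.≈-refl
    ℕ-pair (suc n) x y = P.∙-congˡ (ℕ-pair n x y)

  ·-closed : ∀ {G} (S : Subgroup G) n {x} → Subgroup.Member S x → Subgroup.Member S (Module._·_ G n x)
  ·-closed {G} S = λ { (+ n) m → ℕ-closed n m ; -[1+ n ] m → ⁻¹-closed (ℕ-closed (suc n) m) }
    where
    open Module G
    open Subgroup S
    ℕ-closed : ∀ n {x} → Member x → Member (n ·ℕ x)
    ℕ-closed zero m = ε-closed
    ℕ-closed (suc n) m = ∙-closed m (ℕ-closed n m)

  -- Integers

  nonzero-* : ∀ {m n} → ¬ m ≡ 0ℤ → ¬ n ≡ 0ℤ → ¬ m ℤ.* n ≡ 0ℤ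
  nonzero-* {m} m≢0 n≢0 e with ℤ.i*j≡0⇒i≡0∨j≡0 m e
  ... | inj₁ p = m≢0 p
  ... | inj₂ p = n≢0 p

  -- `d` is a greatest common divisor with its sign chosen so that the cofactor `n′` of n is a
  -- natural number, because divisibility is assumed to transfer only for natural moduli.
  record Bézout (k n : ℤ) : Set where
    field
      d k′ u v : ℤ
      n′       : ℕ
      d≢0      : ¬ d ≡ 0ℤ
      n≡       : n ≡ d ℤ.* + n′
      k≡       : k ≡ d ℤ.* k′
      identity : u ℤ.* k′ ℤ.+ v ℤ.* + n′ ≡ 1ℤ

  unit : ∀ i → ∃ λ s → s ℤ.* s ≡ 1ℤ × i ≡ s ℤ.* + ℤ.∣ i ∣
  unit (+ n) = 1ℤ , refl , sym (ℤ.*-identityˡ (+ n))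
  unit -[1+ n ] = -[1+ 0 ] , refl , sym (ℤ.-1*i≡-i (+ suc n))

  ℕ-bézout : ∀ d q r → ¬ d ≡ 0 → GCD.Bézout.Identity d (q ℕ.* d) (r ℕ.* d) →
             ∃ λ u → ∃ λ v → u ℤ.* + q ℤ.+ v ℤ.* + r ≡ 1ℤ
  ℕ-bézout d q r d≢0 (GCD.Bézout.+- x y eq) = + x , ℤ.- (+ y) ,
    ℤ.*-cancelˡ-≡ (+ d) _ _ {{ℕ.≢-nonZero d≢0}} (begin
      + d ℤ.* (+ x ℤ.* + q ℤ.+ ℤ.- (+ y) ℤ.* + r)
        ≡⟨ ℤSolver.solve 5 (λ d x q y r → d :* (x :* q :+ :- y :* r) := x :* (q :* d) :- y :* (r :* d)) refl
             (+ d) (+ x) (+ q) (+ y) (+ r) ⟩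
      + x ℤ.* (+ q ℤ.* + d) ℤ.- + y ℤ.* (+ r ℤ.* + d)
        ≡⟨ cong (ℤ._- + y ℤ.* (+ r ℤ.* + d)) (cast x q) ⟨
      + (x ℕ.* (q ℕ.* d)) ℤ.- + y ℤ.* (+ r ℤ.* + d)
        ≡⟨ cong (λ n → + n ℤ.- + y ℤ.* (+ r ℤ.* + d)) eq ⟨
      + d ℤ.+ + (y ℕ.* (r ℕ.* d)) ℤ.- + y ℤ.* (+ r ℤ.* + d)
        ≡⟨ cong (λ n → + d ℤ.+ n ℤ.- + y ℤ.* (+ r ℤ.* + d)) (cast y r) ⟩
      + d ℤ.+ + y ℤ.* (+ r ℤ.* + d) ℤ.- + y ℤ.* (+ r ℤ.* + d)
        ≡⟨ ℤSolver.solve 2 (λ d n → d :+ n :- n := d :* con 1ℤ) refl (+ d) (+ y ℤ.* (+ r ℤ.* + d)) ⟩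
      + d ℤ.* 1ℤ ∎)
    where
    open ≡-Reasoning
    open ℤSolver using (_:*_; _:+_; :-_; _:-_; _:=_; con)
    cast : ∀ x q → + (x ℕ.* (q ℕ.* d)) ≡ + x ℤ.* (+ q ℤ.* + d)
    cast x q = trans (ℤ.pos-* x (q ℕ.* d)) (cong (+ x ℤ.*_) (ℤ.pos-* q d))
  ℕ-bézout d q r d≢0 (GCD.Bézout.-+ x y eq) with ℕ-bézout d r q d≢0 (GCD.Bézout.+- y x eq)
  ... | u , v , e = v , u , trans (ℤ.+-comm (v ℤ.* + q) (u ℤ.* + r)) e

  bézout : ∀ k n → ¬ k ≡ 0ℤ ⊎ ¬ n ≡ 0ℤ → Bézout k n
  bézout k n nonzero with unit k | unit n | mkGCD ℤ.∣ k ∣ ℤ.∣ n ∣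
  ... | σ , σσ , k≡ | s , ss , n≡ | d , gcd
    with GCD.commonDivisor gcd | GCD.Bézout.identity gcd
  ... | divides q e , divides r e′ | eq = record
    { d = s ℤ.* + d ; k′ = s ℤ.* σ ℤ.* + q ; u = u ℤ.* (s ℤ.* σ) ; v = v ; n′ = r
    ; d≢0 = d≢0
    ; n≡ = trans n≡ (trans (cong (s ℤ.*_) (trans (cong +_ e′) (ℤ.pos-* r d)))
        (ℤSolver.solve 3 (λ s r d → s :* (r :* d) := s :* d :* r) refl s (+ r) (+ d)))
    ; k≡ = trans k≡ (trans (cong (σ ℤ.*_) (trans (cong +_ e) (trans (ℤ.pos-* q d) (sym (ℤ.*-identityˡ _)))))
        (trans (cong (λ t → σ ℤ.* (t ℤ.* (+ q ℤ.* + d))) (sym ss))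
        (ℤSolver.solve 4 (λ s σ q d → σ :* (s :* s :* (q :* d)) := s :* d :* (s :* σ :* q)) refl s σ (+ q) (+ d))))
    ; identity = trans (ℤSolver.solve 6 (λ u v s σ q r → u :* (s :* σ) :* (s :* σ :* q) :+ v :* r :=
                           u :* ((s :* s) :* (σ :* σ) :* q) :+ v :* r) refl u v s σ (+ q) (+ r))
        (trans (cong₂ (λ a b → u ℤ.* (a ℤ.* b ℤ.* + q) ℤ.+ v ℤ.* + r) ss σσ)
        (trans (cong (λ t → u ℤ.* t ℤ.+ v ℤ.* + r) (ℤ.*-identityˡ (+ q))) uv))
    }
    where
    open ℤSolver using (_:*_; _:+_; _:=_)
    d≢0ℕ : ¬ d ≡ 0
    d≢0ℕ d≡0 = Sum.[ (λ k≢0 → k≢0 (ℤ.∣i∣≡0⇒i≡0 (trans e (trans (cong (q ℕ.*_) d≡0) (ℕ.*-zeroʳ q)))))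
                   , (λ n≢0 → n≢0 (ℤ.∣i∣≡0⇒i≡0 (trans e′ (trans (cong (r ℕ.*_) d≡0) (ℕ.*-zeroʳ r))))) ] nonzero
    d≢0 : ¬ s ℤ.* + d ≡ 0ℤ
    d≢0 = nonzero-* {s} (λ s≡0 → contradiction (trans (sym (cong (λ t → t ℤ.* t) s≡0)) ss) λ ())
      λ p → d≢0ℕ (ℤ.+-injective p)
    uv′ = ℕ-bézout d q r d≢0ℕ (subst (λ (m , n) → GCD.Bézout.Identity d m n) (cong₂ _,_ e e′) eq)
    u = proj₁ uv′
    v = proj₁ (proj₂ uv′)
    uv = proj₂ (proj₂ uv′)

  -- Extending partial homomorphisms

  -- C is a condition on single members, monotone in the subgroup, so it survives unions of chains.
  -- It will be `Compatible` for homomorphisms into X and `IntegralFibre` for characters.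
  maximalSubgroup : (H : AbGroup) (C : Pred (AbelianGroup.Carrier H) 0ℓ → Pred (AbelianGroup.Carrier H) 0ℓ) →
    (∀ {P Q} → (∀ {x} → P x → Q x) → ∀ {x} → C P x → C Q x) →
    (S : Subgroup H) → (∀ {x} → Subgroup.Member S x → C (Subgroup.Member S) x) →
    Σ[ M ∈ Subgroup H ] (∀ {x} → Subgroup.Member S x → Subgroup.Member M x) ×
      (∀ {x} → Subgroup.Member M x → C (Subgroup.Member M) x) ×
      (∀ (R : Subgroup H) → (∀ {x} → Subgroup.Member R x → C (Subgroup.Member R) x) →
         (∀ {x} → Subgroup.Member M x → Subgroup.Member R x) → ∀ {x} → Subgroup.Member R x → Subgroup.Member M x)
  maximalSubgroup H C C-mono S C-S =
    asSubgroup top goodTop , (λ x∈S → S⊆top _ (∈-intro x∈S)) , compatible goodTop , λ R C-R top⊆R x∈R →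
      maximal (fromSubgroup R C-R) (λ _ x∈ → ∈-intro (top⊆R x∈)) _ (∈-intro x∈R)
    where
    open AbelianGroup H hiding (refl; sym; trans)

    record Good (A : Sub Carrier) : Set where
      field
        resp       : ∀ {x y} → x ≈ y → x ∈ A → y ∈ A
        ε-closed   : ε ∈ A
        ∙-closed   : ∀ {x y} → x ∈ A → y ∈ A → x ∙ y ∈ A
        ⁻¹-closed  : ∀ {x} → x ∈ A → x ⁻¹ ∈ A
        compatible : ∀ {x} → x ∈ A → C (_∈ A) x
    open Good

    asSubgroup : ∀ A → Good A → Subgroup H
    asSubgroup A g = record
      { Member = _∈ A ; resp = resp g ; ε-closed = ε-closed g ; ∙-closed = ∙-closed g ; ⁻¹-closed = ⁻¹-closed g }

    fromSubgroup : ∀ R → (∀ {x} → Subgroup.Member R x → C (Subgroup.Member R) x) → Good (sub (Subgroup.Member R))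
    fromSubgroup R C-R = record
      { resp       = λ x≈y x∈ → ∈-intro (R.resp x≈y (∈-elim x∈))
      ; ε-closed   = ∈-intro R.ε-closed
      ; ∙-closed   = λ x∈ y∈ → ∈-intro (R.∙-closed (∈-elim x∈) (∈-elim y∈))
      ; ⁻¹-closed  = λ x∈ → ∈-intro (R.⁻¹-closed (∈-elim x∈))
      ; compatible = λ x∈ → C-mono ∈-intro (C-R (∈-elim x∈))
      }
      where module R = Subgroup R

    good-resp : ∀ {A B} → A ≐ B → Good A → Good B
    good-resp (A⊆B , B⊆A) g = record
      { resp       = λ x≈y x∈ → A⊆B _ (resp g x≈y (B⊆A _ x∈))
      ; ε-closed   = A⊆B _ (ε-closed g)
      ; ∙-closed   = λ x∈ y∈ → A⊆B _ (∙-closed g (B⊆A _ x∈) (B⊆A _ y∈))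
      ; ⁻¹-closed  = λ x∈ → A⊆B _ (⁻¹-closed g (B⊆A _ x∈))
      ; compatible = λ x∈ → C-mono (A⊆B _) (compatible g (B⊆A _ x∈))
      }

    good-⋃ : ∀ F → IsChain F → ∃ (_∈ F) → (∀ {A} → A ∈ F → Good A) → Good (⋃ F)
    good-⋃ F chain (A₀ , A₀∈F) good = record
      { resp       = λ x≈y x∈ → let A , A∈F , x∈A = ∈-elim x∈ in
                       ⋃-upper A∈F _ (resp (good A∈F) x≈y x∈A)
      ; ε-closed   = ⋃-upper A₀∈F _ (ε-closed (good A₀∈F))
      ; ∙-closed   = λ x∈ y∈ → ∙-closed′ (∈-elim x∈) (∈-elim y∈)
      ; ⁻¹-closed  = λ x∈ → let A , A∈F , x∈A = ∈-elim x∈ in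
                       ⋃-upper A∈F _ (⁻¹-closed (good A∈F) x∈A)
      ; compatible = λ x∈ → let A , A∈F , x∈A = ∈-elim x∈ in
                       C-mono (⋃-upper A∈F _) (compatible (good A∈F) x∈A)
      }
      where
      ∙-closed′ : ∀ {x y} → (∃ λ A → A ∈ F × x ∈ A) → (∃ λ A → A ∈ F × y ∈ A) → x ∙ y ∈ ⋃ F
      ∙-closed′ (A , A∈F , x∈A) (B , B∈F , y∈B) with chain A∈F B∈F
      ... | inj₁ A⊆B = ⋃-upper B∈F _ (∙-closed (good B∈F) (A⊆B _ x∈A) y∈B)
      ... | inj₂ B⊆A = ⋃-upper A∈F _ (∙-closed (good A∈F) x∈A (B⊆A _ y∈B))

    maximum = zorn Good good-resp good-⋃ (fromSubgroup S C-S)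
    top = proj₁ maximum
    S⊆top = proj₁ (proj₂ maximum)
    goodTop = proj₁ (proj₂ (proj₂ maximum))
    maximal = proj₂ (proj₂ (proj₂ maximum))

  module Combination (G : AbGroup) where
    open Module G
    open ℤSolver using (_:*_; _:+_; :-_)

    combine-∙ : ∀ n k n₁ k₁ {z z₁ w w₁} e → n · z ≈ k · e ∙ w → n₁ · z₁ ≈ k₁ · e ∙ w₁ →
      (n ℤ.* n₁) · (z ∙ z₁) ≈ (n₁ ℤ.* k ℤ.+ n ℤ.* k₁) · e ∙ (n₁ · w ∙ n · w₁)
    combine-∙ n k n₁ k₁ {z} {z₁} {w} {w₁} e p q = ≈-trans
      (solve (n ∷ n₁ ∷ []) (z ∷ z₁ ∷ []) (λ { (n ∷ n₁ ∷ []) (z ∷ z₁ ∷ []) →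
        (n :* n₁) ⊙ (z ⊕ z₁) ⊜ n₁ ⊙ (n ⊙ z) ⊕ n ⊙ (n₁ ⊙ z₁) }) refl)
      (≈-trans (∙-cong (·-cong n₁ p) (·-cong n q))
      (solve (n ∷ k ∷ n₁ ∷ k₁ ∷ []) (e ∷ w ∷ w₁ ∷ []) (λ { (n ∷ k ∷ n₁ ∷ k₁ ∷ []) (e ∷ w ∷ w₁ ∷ []) →
        n₁ ⊙ (k ⊙ e ⊕ w) ⊕ n ⊙ (k₁ ⊙ e ⊕ w₁) ⊜ (n₁ :* k :+ n :* k₁) ⊙ e ⊕ (n₁ ⊙ w ⊕ n ⊙ w₁) }) refl))

    combine-⁻¹ : ∀ n k {z w} e → n · z ≈ k · e ∙ w → n · (z ⁻¹) ≈ (ℤ.- k) · e ∙ w ⁻¹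
    combine-⁻¹ n k {z} {w} e p = ≈-trans (·-⁻¹ n z) (≈-trans (⁻¹-cong p)
      (solve (k ∷ []) (e ∷ w ∷ []) (λ { (k ∷ []) (e ∷ w ∷ []) → ⊖ (k ⊙ e ⊕ w) ⊜ (:- k) ⊙ e ⊕ ⊖ w }) refl))

  -- For a subgroup Γ of E × X: Γ is the graph of a homomorphism on a pure subgroup of E.
  Compatible : (E X : AbGroup) → Pred (AbelianGroup.Carrier (E ×ᴳ X)) 0ℓ → Pred (AbelianGroup.Carrier (E ×ᴳ X)) 0ℓ
  Compatible E X Γ (w , v) =
    (w E.≈ E.ε → v X.≈ X.ε) × (∀ n z → ¬ n ≡ 0ℤ → n E.· z E.≈ w → ∃ λ y → Γ (z , y))
    where
    module E = Module E
    module X = Module X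

  module PartialHom {E X : AbGroup} (Γ : Subgroup (E ×ᴳ X))
                    (compatible : ∀ {p} → Subgroup.Member Γ p → Compatible E X (Subgroup.Member Γ) p) where
    module E = Module E
    module X = Module X
    open Subgroup Γ public

    unique : ∀ {w w′ v v′} → Member (w , v) → Member (w′ , v′) → w E.≈ w′ → v X.≈ v′
    unique {w} {w′} m m′ p = X.x∙y⁻¹≈ε⇒x≈y (proj₁ (compatible (∙-closed m (⁻¹-closed m′)))
      (E.≈-trans (E.∙-congʳ p) (E.inverseʳ w′)))

    scale : ∀ n {w v} → Member (w , v) → Member (n E.· w , n X.· v)
    scale n {w} {v} m = resp (·-pair E X n w v) (·-closed Γ n m)

    divide : ∀ n {w v} z → ¬ n ≡ 0ℤ → n E.· z E.≈ w → Member (w , v) → ∃ λ y → Member (z , y) × n X.· y X.≈ v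
    divide n z n≢0 p m = let y , m′ = proj₂ (compatible m) n z n≢0 p in y , m′ , unique (scale n m′) m p

    -- The pure closure of Γ + ℤ(e, x), which is again such a graph if x has, over the values
    -- of Γ, all the divisibility properties of e over the domain of Γ.
    module Adjoin (e : E.Carrier) (x : X.Carrier) where

      Closure : Pred (AbelianGroup.Carrier (E ×ᴳ X)) 0ℓ
      Closure (z , y) = ∃ λ n → ∃ λ k → ∃ λ w → ∃ λ v → ¬ n ≡ 0ℤ × Member (w , v) ×
        n E.· z E.≈ k E.· e E.∙ w × n X.· y X.≈ k X.· x X.∙ v

      closure : Subgroup (E ×ᴳ X)
      closure = record
        { Member    = Closure
        ; resp      = λ (p , q) (n , k , w , v , n≢0 , m , r , s) →
            n , k , w , v , n≢0 , m , E.≈-trans (E.·-cong n (E.≈-sym p)) r , X.≈-trans (X.·-cong n (X.≈-sym q)) s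
        ; ε-closed  = 1ℤ , 0ℤ , E.ε , X.ε , (λ ()) , ε-closed , E.≈-refl , X.≈-refl
        ; ∙-closed  = λ (n , k , w , v , n≢0 , m , r , s) (n₁ , k₁ , w₁ , v₁ , n₁≢0 , m₁ , r₁ , s₁) →
            n ℤ.* n₁ , n₁ ℤ.* k ℤ.+ n ℤ.* k₁ , _ , _ , nonzero-* n≢0 n₁≢0 , ∙-closed (scale n₁ m) (scale n m₁) ,
            Combination.combine-∙ E n k n₁ k₁ e r r₁ , Combination.combine-∙ X n k n₁ k₁ x s s₁
        ; ⁻¹-closed = λ (n , k , w , v , n≢0 , m , r , s) →
            n , ℤ.- k , _ , _ , n≢0 , ⁻¹-closed m , Combination.combine-⁻¹ E n k e r , Combination.combine-⁻¹ X n k x s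
        }

      ⊆closure : ∀ {p} → Member p → Closure p
      ⊆closure {w , v} m = 1ℤ , 0ℤ , w , v , (λ ()) , m ,
        E.≈-trans (E.1· w) (E.≈-sym (E.identityˡ w)) , X.≈-trans (X.1· v) (X.≈-sym (X.identityˡ v))

      ∈closure : Closure (e , x)
      ∈closure = 1ℤ , 1ℤ , E.ε , X.ε , (λ ()) , ε-closed , E.≈-sym (E.identityʳ _) , X.≈-sym (X.identityʳ _)

      -- For the amalgam: the quotient of E × X by `closure` is torsion-free.
      closure-pure : ∀ j {z y} → ¬ j ≡ 0ℤ → Closure (j E.· z , j X.· y) → Closure (z , y)
      closure-pure j {z} {y} j≢0 (n , k , w , v , n≢0 , m , r , s) =
        n ℤ.* j , k , w , v , nonzero-* n≢0 j≢0 , m , E.≈-trans (E.·-* n j z) r , X.≈-trans (X.·-* n j y) s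

      module _ (tfX : TorsionFree X) (transfer : ∀ n {w v} → Member (w , v) →
                  Divides E (+ n) (e E.∙ w) → Divides X (+ n) (x X.∙ v)) where
        open ℤSolver using (_:*_; _:+_; :-_)

        -- The hypothesis concerns e itself, not k · e. Dividing nz = ke + w by d gives w = dw′ with
        -- w′ = n′z - k′e, and uk′ + βn′ = 1 turns this into n′(βe + uz) = e + uw′, to which
        -- `transfer` applies. Purity of the domain supplies the value `v′` at w′, and the same
        -- identity assembles the quotient in X.
        transfer-coprime : ∀ k n {w v} → Bézout k n → Member (w , v) →
                           Divides E n (k E.· e E.∙ w) → Divides X n (k X.· x X.∙ v)
        transfer-coprime k n {w} {v} B m (z , p) = k′ X.· q X.∙ β X.· v′ , eqX
          where
          open Bézout B renaming (v to β)

          w′ : E.Carrier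
          w′ = + n′ E.· z E.∙ (k′ E.· e) E.⁻¹

          dw′≈w : d E.· w′ E.≈ w
          dw′≈w = begin
            d E.· (+ n′ E.· z E.∙ (k′ E.· e) E.⁻¹)
              ≈⟨ E.solve (d ∷ + n′ ∷ k′ ∷ []) (z ∷ e ∷ []) (λ { (d ∷ n′ ∷ k′ ∷ []) (z ∷ e ∷ []) →
                   d E.⊙ (n′ E.⊙ z E.⊕ E.⊖ (k′ E.⊙ e)) E.⊜ (d :* n′) E.⊙ z E.⊕ E.⊖ ((d :* k′) E.⊙ e) }) refl ⟩
            (d ℤ.* + n′) E.· z E.∙ ((d ℤ.* k′) E.· e) E.⁻¹
              ≡⟨ cong₂ (λ a b → a E.· z E.∙ (b E.· e) E.⁻¹) n≡ k≡ ⟨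
            n E.· z E.∙ (k E.· e) E.⁻¹
              ≈⟨ E.∙-congʳ p ⟩
            (k E.· e E.∙ w) E.∙ (k E.· e) E.⁻¹
              ≈⟨ E.solve [] (k E.· e ∷ w ∷ []) (λ { [] (a ∷ w ∷ []) → (a E.⊕ w) E.⊕ E.⊖ a E.⊜ w }) refl ⟩
            w ∎
            where open SetoidReasoning E.setoid

          division = divide d w′ d≢0 dw′≈w m
          v′ = proj₁ division

          eqE : + n′ E.· (β E.· e E.∙ u E.· z) E.≈ e E.∙ u E.· w′
          eqE = begin
            + n′ E.· (β E.· e E.∙ u E.· z)
              ≈⟨ E.solve (+ n′ ∷ k′ ∷ u ∷ β ∷ []) (z ∷ e ∷ []) (λ { (n′ ∷ k′ ∷ u ∷ β ∷ []) (z ∷ e ∷ []) →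
                   n′ E.⊙ (β E.⊙ e E.⊕ u E.⊙ z) E.⊜
                   (u :* k′ :+ β :* n′) E.⊙ e E.⊕ u E.⊙ (n′ E.⊙ z E.⊕ E.⊖ (k′ E.⊙ e)) }) refl ⟩
            (u ℤ.* k′ ℤ.+ β ℤ.* + n′) E.· e E.∙ u E.· w′
              ≡⟨ cong (λ a → a E.· e E.∙ u E.· w′) identity ⟩
            1ℤ E.· e E.∙ u E.· w′
              ≈⟨ E.∙-congʳ (E.1· e) ⟩
            e E.∙ u E.· w′ ∎
            where open SetoidReasoning E.setoid

          quotient = transfer n′ (scale u (proj₁ (proj₂ division))) (_ , eqE)
          q = proj₁ quotient

          eqX : n X.· (k′ X.· q X.∙ β X.· v′) X.≈ k X.· x X.∙ v
          eqX = begin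
            n X.· (k′ X.· q X.∙ β X.· v′)
              ≡⟨ cong (λ a → a X.· (k′ X.· q X.∙ β X.· v′)) n≡ ⟩
            (d ℤ.* + n′) X.· (k′ X.· q X.∙ β X.· v′)
              ≈⟨ X.solve (d ∷ + n′ ∷ k′ ∷ β ∷ []) (q ∷ v′ ∷ []) (λ { (d ∷ n′ ∷ k′ ∷ β ∷ []) (q ∷ v′ ∷ []) →
                   (d :* n′) X.⊙ (k′ X.⊙ q X.⊕ β X.⊙ v′) X.⊜ (d :* k′) X.⊙ (n′ X.⊙ q) X.⊕ (n′ :* β :* d) X.⊙ v′ }) refl ⟩
            (d ℤ.* k′) X.· (+ n′ X.· q) X.∙ (+ n′ ℤ.* β ℤ.* d) X.· v′
              ≈⟨ X.∙-congʳ (X.·-cong (d ℤ.* k′) (proj₂ quotient)) ⟩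
            (d ℤ.* k′) X.· (x X.∙ u X.· v′) X.∙ (+ n′ ℤ.* β ℤ.* d) X.· v′
              ≈⟨ X.solve (d ∷ + n′ ∷ k′ ∷ u ∷ β ∷ []) (x ∷ v′ ∷ []) (λ { (d ∷ n′ ∷ k′ ∷ u ∷ β ∷ []) (x ∷ v′ ∷ []) →
                   (d :* k′) X.⊙ (x X.⊕ u X.⊙ v′) X.⊕ (n′ :* β :* d) X.⊙ v′ X.⊜
                   (d :* k′) X.⊙ x X.⊕ (u :* k′ :+ β :* n′) X.⊙ (d X.⊙ v′) }) refl ⟩
            (d ℤ.* k′) X.· x X.∙ (u ℤ.* k′ ℤ.+ β ℤ.* + n′) X.· (d X.· v′)
              ≡⟨ cong₂ (λ a b → a X.· x X.∙ b X.· (d X.· v′)) (sym k≡) identity ⟩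
            k X.· x X.∙ 1ℤ X.· (d X.· v′)
              ≈⟨ X.∙-congˡ (X.≈-trans (X.1· _) (proj₂ (proj₂ division))) ⟩
            k X.· x X.∙ v ∎
            where open SetoidReasoning X.setoid

        transfer-multiples : ∀ k n {w v} → Member (w , v) →
                             Divides E n (k E.· e E.∙ w) → Divides X n (k X.· x X.∙ v)
        transfer-multiples k n {w} {v} m (z , p) with dec (k ≡ 0ℤ) | dec (n ≡ 0ℤ)
        -- With k = n = 0 there is no gcd to divide by; the claim is just that Γ takes ε to ε.
        ... | yes refl | yes refl = X.ε , X.≈-sym (X.≈-trans (X.identityˡ v)
                (proj₁ (compatible m) (E.≈-sym (E.≈-trans p (E.identityˡ w)))))
        ... | no k≢0 | _ = transfer-coprime k n (bézout k n (inj₁ k≢0)) m (z , p)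
        ... | yes _ | no n≢0 = transfer-coprime k n (bézout k n (inj₂ n≢0)) m (z , p)

        closure-compatible : ∀ {p} → Closure p → Compatible E X Closure p
        closure-compatible {z , y} (n , k , w , v , n≢0 , m , r , s) = functional , pure
          where
          -- When z ≈ ε, the element ke + w is divisible by 0. Hence so is kx + v, that is, n · y ≈
          -- ε.
          functional : z E.≈ E.ε → y X.≈ X.ε
          functional z≈ε = tfX n y n≢0 (X.≈-trans s (X.≈-sym (proj₂ (transfer-multiples k 0ℤ m
            (E.ε , E.≈-trans (E.≈-sym (E.≈-trans (E.·-cong n z≈ε) (E.·-ε n))) r)))))

          pure : ∀ j z′ → ¬ j ≡ 0ℤ → j E.· z′ E.≈ z → ∃ λ y′ → Closure (z′ , y′)
          pure j z′ j≢0 p = let y′ , s′ = transfer-multiples k (n ℤ.* j) m (z′ , r′) in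
            y′ , n ℤ.* j , k , w , v , nonzero-* n≢0 j≢0 , m , r′ , s′
            where
            r′ : (n ℤ.* j) E.· z′ E.≈ k E.· e E.∙ w
            r′ = E.≈-trans (E.·-* n j z′) (E.≈-trans (E.·-cong n p) r)

  -- Solvability of a coherent system of congruences x ≡ − v j modulo L j.
  Complete : AbGroup → Set
  Complete X = (L : ℕ → ℤ) (v : ℕ → Carrier) → (∀ j → ∃ λ u → L (suc j) ≡ L j ℤ.* u) →
               (∀ j → Divides X (L j) (v (suc j) ∙ v j ⁻¹)) → ∃ λ x → ∀ j → Divides X (L j) (x ∙ v j)
    where open Module X

  module Value {E X : AbGroup} (complete : Complete X) (Γ : Subgroup (E ×ᴳ X))
               (compatible : ∀ {p} → Subgroup.Member Γ p → Compatible E X (Subgroup.Member Γ) p)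
               (e : AbelianGroup.Carrier E) (e∉ : ¬ ∃ λ y → Subgroup.Member Γ (e , y)) where
    open PartialHom Γ compatible
    open ℤSolver using (_:*_; _:+_; :-_)

    -- A demand on the value x to be found for e: as L divides e + w, it has to divide x + v.
    record Congruence : Set where
      field
        L   : ℤ
        w z : E.Carrier
        v   : X.Carrier
        L≢0 : ¬ L ≡ 0ℤ
        mem : Member (w , v)
        eq  : L E.· z E.≈ e E.∙ w

    open Congruence

    -- Subtracting two relations with the same modulus eliminates e. The difference lies in the
    -- domain of Γ, and purity divides it there, so its value is divisible too.
    agree : ∀ (a : Congruence) {w′ v′} z′ → Member (w′ , v′) → L a E.· z′ E.≈ e E.∙ w′ →
            Divides X (L a) (v′ X.∙ v a X.⁻¹)
    agree a {w′} {v′} z′ m p =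
      let y , _ , q = divide (L a) (z′ E.∙ z a E.⁻¹) (L≢0 a) difference (∙-closed m (⁻¹-closed (mem a))) in y , q
      where
      difference : L a E.· (z′ E.∙ z a E.⁻¹) E.≈ w′ E.∙ w a E.⁻¹
      difference = begin
        L a E.· (z′ E.∙ z a E.⁻¹)
          ≈⟨ E.≈-trans (E.·-∙ (L a) _ _) (E.∙-cong p (E.≈-trans (E.·-⁻¹ (L a) _) (E.⁻¹-cong (eq a)))) ⟩
        (e E.∙ w′) E.∙ (e E.∙ w a) E.⁻¹
          ≈⟨ E.solve [] (e ∷ w′ ∷ w a ∷ []) (λ { [] (e ∷ w′ ∷ w ∷ []) →
               (e E.⊕ w′) E.⊕ E.⊖ (e E.⊕ w) E.⊜ w′ E.⊕ E.⊖ w }) refl ⟩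
        w′ E.∙ w a E.⁻¹ ∎
        where open SetoidReasoning E.setoid

    -- The Chinese remainder theorem, for possibly non-coprime moduli.
    join : ∀ a b → Σ[ c ∈ Congruence ] (∃ λ u → L c ≡ L a ℤ.* u) × (∃ λ u → L c ≡ L b ℤ.* u)
    join a b = record
      { L   = L a ℤ.* + n′
      ; w   = w a E.∙ ((u ℤ.* L a) E.· ν) E.⁻¹
      ; z   = β E.· z a E.∙ u E.· z b
      ; v   = v a X.∙ ((u ℤ.* L a) X.· proj₁ division) X.⁻¹
      ; L≢0 = nonzero-* (L≢0 a) λ n′≡0 → L≢0 b (trans n≡ (trans (cong (d ℤ.*_) n′≡0) (ℤ.*-zeroʳ d)))
      ; mem = ∙-closed (mem a) (⁻¹-closed (scale (u ℤ.* L a) (proj₁ (proj₂ division))))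
      ; eq  = E.≈-sym eq′
      } , (+ n′ , refl) , k′ ,
      trans (cong (ℤ._* + n′) k≡) (trans
        (ℤSolver.solve 3 (λ d k n → d :* k :* n ℤSolver.:= d :* n :* k) refl d k′ (+ n′))
        (cong (ℤ._* k′) (sym n≡)))
      where
      open Bézout (bézout (L a) (L b) (inj₁ (L≢0 a))) renaming (v to β)
      open SetoidReasoning E.setoid

      -- As d · ν is the difference of `w a` and `w b`, purity puts ν in the domain. The correction
      -- by (u · L a) · ν makes e + w a a multiple of L a · n′, a common multiple of both moduli.
      ν : E.Carrier
      ν = k′ E.· z a E.∙ (+ n′ E.· z b) E.⁻¹

      dν≈ : d E.· ν E.≈ w a E.∙ w b E.⁻¹
      dν≈ = begin
        d E.· ν
          ≈⟨ E.solve (d ∷ k′ ∷ + n′ ∷ []) (z a ∷ z b ∷ []) (λ { (d ∷ k′ ∷ n′ ∷ []) (z ∷ z′ ∷ []) →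
               d E.⊙ (k′ E.⊙ z E.⊕ E.⊖ (n′ E.⊙ z′)) E.⊜ (d :* k′) E.⊙ z E.⊕ E.⊖ ((d :* n′) E.⊙ z′) }) refl ⟩
        (d ℤ.* k′) E.· z a E.∙ ((d ℤ.* + n′) E.· z b) E.⁻¹
          ≡⟨ cong₂ (λ k n → k E.· z a E.∙ (n E.· z b) E.⁻¹) k≡ n≡ ⟨
        L a E.· z a E.∙ (L b E.· z b) E.⁻¹
          ≈⟨ E.∙-cong (eq a) (E.⁻¹-cong (eq b)) ⟩
        (e E.∙ w a) E.∙ (e E.∙ w b) E.⁻¹
          ≈⟨ E.solve [] (e ∷ w a ∷ w b ∷ []) (λ { [] (e ∷ w ∷ w′ ∷ []) →
               (e E.⊕ w) E.⊕ E.⊖ (e E.⊕ w′) E.⊜ w E.⊕ E.⊖ w′ }) refl ⟩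
        w a E.∙ w b E.⁻¹ ∎

      division = divide d ν d≢0 dν≈ (∙-closed (mem a) (⁻¹-closed (mem b)))

      eq′ : e E.∙ (w a E.∙ ((u ℤ.* L a) E.· ν) E.⁻¹) E.≈ (L a ℤ.* + n′) E.· (β E.· z a E.∙ u E.· z b)
      eq′ = begin
        e E.∙ (w a E.∙ ((u ℤ.* L a) E.· ν) E.⁻¹)
          ≈⟨ E.assoc _ _ _ ⟨
        (e E.∙ w a) E.∙ ((u ℤ.* L a) E.· ν) E.⁻¹
          ≈⟨ E.∙-congʳ (eq a) ⟨
        L a E.· z a E.∙ ((u ℤ.* L a) E.· ν) E.⁻¹
          ≈⟨ E.∙-congʳ (E.·-cong (L a) (E.1· (z a))) ⟨
        L a E.· (1ℤ E.· z a) E.∙ ((u ℤ.* L a) E.· ν) E.⁻¹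
          ≡⟨ cong (λ i → L a E.· (i E.· z a) E.∙ ((u ℤ.* L a) E.· ν) E.⁻¹) identity ⟨
        L a E.· ((u ℤ.* k′ ℤ.+ β ℤ.* + n′) E.· z a) E.∙ ((u ℤ.* L a) E.· ν) E.⁻¹
          ≈⟨ E.solve (L a ∷ u ∷ k′ ∷ β ∷ + n′ ∷ []) (z a ∷ z b ∷ []) (λ { (L ∷ u ∷ k′ ∷ β ∷ n′ ∷ []) (z ∷ z′ ∷ []) →
               L E.⊙ ((u :* k′ :+ β :* n′) E.⊙ z) E.⊕ E.⊖ ((u :* L) E.⊙ (k′ E.⊙ z E.⊕ E.⊖ (n′ E.⊙ z′))) E.⊜
               (L :* n′) E.⊙ (β E.⊙ z E.⊕ u E.⊙ z′) }) refl ⟩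
        (L a ℤ.* + n′) E.· (β E.· z a E.∙ u E.· z b) ∎

    -- One solution for each modulus is enough, since by `agree` all solutions impose the same
    -- congruence. So the stages run through the positive integers and join in one solution wherever
    -- there is any.
    Solved : ℕ → Set
    Solved j = Σ[ a ∈ Congruence ] L a ≡ + suc j

    stage : ℕ → Congruence
    extend : ∀ j → Dec (Solved j) → Congruence
    stage zero = record
      { L = 1ℤ ; w = E.ε ; z = e ; v = X.ε ; L≢0 = λ () ; mem = ε-closed
      ; eq = E.≈-trans (E.1· e) (E.≈-sym (E.identityʳ e)) }
    stage (suc j) = extend j (dec (Solved j))
    extend j (yes (a , _)) = proj₁ (join (stage j) a)
    extend j (no _) = stage j

    extend-divides : ∀ j s → ∃ λ u → L (extend j s) ≡ L (stage j) ℤ.* u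
    extend-divides j (yes (a , _)) = proj₁ (proj₂ (join (stage j) a))
    extend-divides j (no _) = 1ℤ , sym (ℤ.*-identityʳ _)

    extend-solves : ∀ j s → Solved j → ∃ λ u → L (extend j s) ≡ + suc j ℤ.* u
    extend-solves j (yes (a , p)) _ =
      let u , q = proj₂ (proj₂ (join (stage j) a)) in u , trans q (cong (ℤ._* u) p)
    extend-solves j (no unsolved) solved = contradiction solved unsolved

    limit : ∃ λ x → ∀ j → Divides X (L (stage j)) (x X.∙ v (stage j))
    limit = complete (L ∘ stage) (v ∘ stage) (λ j → extend-divides j (dec (Solved j))) λ j →
      let u , p = extend-divides j (dec (Solved j)) in
      agree (stage j) (u E.· z (stage (suc j))) (mem (stage (suc j)))
        (E.≈-trans (E.≈-sym (E.·-* (L (stage j)) u _))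
        (E.≈-trans (E.≈-reflexive (cong (E._· z (stage (suc j))) (sym p))) (eq (stage (suc j)))))

    value : X.Carrier
    value = proj₁ limit

    -- Divisibility of e + w by 0 would put e in the domain. For a positive modulus, stage `suc j`
    -- has a multiple of it as its modulus, and `agree` replaces the value used at that stage by the
    -- given one.
    value-transfers : ∀ n {w v} → Member (w , v) → Divides E (+ n) (e E.∙ w) → Divides X (+ n) (value X.∙ v)
    value-transfers zero {w} {v} m (z , p) = contradiction
      (v X.⁻¹ , resp (E.≈-sym (AbelianGroupProperties.inverseˡ-unique E e w (E.≈-sym p)) , X.≈-refl) (⁻¹-closed m)) e∉
    value-transfers (suc j) {w₀} {v₀} m (z₀ , p) = u X.· q X.∙ r X.⁻¹ , (begin
      + suc j X.· (u X.· q X.∙ r X.⁻¹)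
        ≈⟨ X.·-∙ (+ suc j) _ _ ⟩
      + suc j X.· (u X.· q) X.∙ + suc j X.· (r X.⁻¹)
        ≈⟨ X.∙-cong (X.≈-sym (X.·-* (+ suc j) u q)) (X.·-⁻¹ (+ suc j) r) ⟩
      (+ suc j ℤ.* u) X.· q X.∙ (+ suc j X.· r) X.⁻¹
        ≡⟨ cong (λ i → i X.· q X.∙ (+ suc j X.· r) X.⁻¹) (sym u≡) ⟩
      L s X.· q X.∙ (+ suc j X.· r) X.⁻¹
        ≈⟨ X.∙-cong (proj₂ (proj₂ limit (suc j))) (X.⁻¹-cong (proj₂ difference)) ⟩
      (value X.∙ v s) X.∙ (v s X.∙ v₀ X.⁻¹) X.⁻¹
        ≈⟨ X.solve [] (value ∷ v s ∷ v₀ ∷ []) (λ { [] (x ∷ v ∷ v₀ ∷ []) →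
             (x X.⊕ v) X.⊕ X.⊖ (v X.⊕ X.⊖ v₀) X.⊜ x X.⊕ v₀ }) refl ⟩
      value X.∙ v₀ ∎)
      where
      open SetoidReasoning X.setoid
      given : Congruence
      given = record { L = + suc j ; w = w₀ ; z = z₀ ; v = v₀ ; L≢0 = λ () ; mem = m ; eq = p }
      s = stage (suc j)
      solves = extend-solves j (dec (Solved j)) (given , refl)
      u = proj₁ solves
      u≡ = proj₂ solves
      q = proj₁ (proj₂ limit (suc j))
      difference : Divides X (+ suc j) (v s X.∙ v₀ X.⁻¹)
      difference = agree given (u E.· z s) (mem s) (E.≈-trans (E.≈-sym (E.·-* (+ suc j) u (z s)))
        (E.≈-trans (E.≈-reflexive (cong (E._· z s) (sym u≡))) (eq s)))
      r = proj₁ difference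

  module _ {X : AbGroup} (tfX : TorsionFree X) (complete : Complete X) where
    private module X = Module X

    -- A maximal compatible graph is total: at a missing e, `Value` finds an x with the
    -- divisibilities of e, and `Adjoin` enlarges the graph.
    totalExtension : ∀ {E} (Γ : Subgroup (E ×ᴳ X)) →
      (∀ {p} → Subgroup.Member Γ p → Compatible E X (Subgroup.Member Γ) p) →
      Σ[ M ∈ Subgroup (E ×ᴳ X) ] (∀ {p} → Subgroup.Member Γ p → Subgroup.Member M p) ×
        (∀ {p} → Subgroup.Member M p → Compatible E X (Subgroup.Member M) p) ×
        (∀ e → ∃ λ x → Subgroup.Member M (e , x))
    totalExtension {E} Γ compatible
      with maximalSubgroup (E ×ᴳ X) (Compatible E X)
             (λ imp (f , p) → f , λ n z n≢0 e → let y , m = p n z n≢0 e in y , imp m) Γ compatible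
    ... | M , Γ⊆M , compatibleM , maximal = M , Γ⊆M , compatibleM , λ e → by-contradiction λ e∉ →
      let open Value {E} {X} complete M compatibleM e e∉
          open PartialHom.Adjoin M compatibleM e value
      in e∉ (value , maximal closure (closure-compatible tfX value-transfers) ⊆closure ∈closure)

    -- The inverse of ι is defined on the image of X, which is pure in E because G is torsion-free.
    -- Extended to E it becomes a retraction, and φ pairs it with π.
    torsionFree⇒Perp : ∀ {G} → TorsionFree G → Perp X G
    torsionFree⇒Perp {G} tfG 𝓔 = φ , onX , λ _ → G.≈-refl
      where
      open Extension 𝓔
      module G = Module G
      module E = Module E
      module ι = GroupHomomorphism ι
      module π = GroupHomomorphism π

      graph : Subgroup (E ×ᴳ X)
      graph = record
        { Member    = λ (e , x) → ι.⟦ x ⟧ E.≈ e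
        ; resp      = λ (p , q) r → E.≈-trans (ι.⟦⟧-cong (X.≈-sym q)) (E.≈-trans r p)
        ; ε-closed  = ι.ε-homo
        ; ∙-closed  = λ p q → E.≈-trans (ι.homo _ _) (E.∙-cong p q)
        ; ⁻¹-closed = λ p → E.≈-trans (ι.⁻¹-homo _) (E.⁻¹-cong p)
        }

      compatible : ∀ {p} → Subgroup.Member graph p → Compatible E X (Subgroup.Member graph) p
      compatible {e , x} p = (λ e≈ε → ι-inj (E.≈-trans p (E.≈-trans e≈ε (E.≈-sym ι.ε-homo)))) ,
        λ n z n≢0 q → Equivalence.to (exact z) (tfG n π.⟦ z ⟧ n≢0
          (G.≈-trans (G.≈-sym (·-homo {E} {G} π n z)) (G.≈-trans (π.⟦⟧-cong q) (Equivalence.from (exact e) (x , p)))))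

      extension = totalExtension graph compatible
      M = proj₁ extension
      open PartialHom M (proj₁ (proj₂ (proj₂ extension))) using (Member; unique; ∙-closed; ⁻¹-closed; ε-closed)

      retract : ∀ e → ∃ λ x → Member (e , x)
      retract = proj₂ (proj₂ (proj₂ extension))

      φ : Hom E (X ×ᴳ G)
      φ = record
        { ⟦_⟧ = λ e → proj₁ (retract e) , π.⟦ e ⟧
        ; isGroupHomomorphism = record
          { isMonoidHomomorphism = record
            { isMagmaHomomorphism = record
              { isRelHomomorphism = record
                { cong = λ {e} {e′} p → unique (proj₂ (retract e)) (proj₂ (retract e′)) p , π.⟦⟧-cong p }
              ; homo = λ e e′ → unique (proj₂ (retract _)) (∙-closed (proj₂ (retract e)) (proj₂ (retract e′))) E.≈-refl
                              , π.homo e e′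
              }
            ; ε-homo = unique (proj₂ (retract _)) ε-closed E.≈-refl , π.ε-homo
            }
          ; ⁻¹-homo = λ e → unique (proj₂ (retract _)) (⁻¹-closed (proj₂ (retract e))) E.≈-refl , π.⁻¹-homo e
          }
        }

      onX : ∀ x → proj₁ (retract ι.⟦ x ⟧) X.≈ x × π.⟦ ι.⟦ x ⟧ ⟧ G.≈ G.ε
      onX x = unique (proj₂ (retract _)) (proj₁ (proj₂ extension) E.≈-refl) E.≈-refl ,
              Equivalence.from (exact _) (x , E.≈-refl)

  -- The group ℤ^ω / ℤ^⟨ω⟩

  𝕏 : AbGroup
  𝕏 = ℤ^ω / ℤ^⟨ω⟩

  module 𝕏 = Module 𝕏

  ·-pointwise : {A : Set} → let open Module (Pointwise.abelianGroup A ℤ.+-0-abelianGroup) in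
                ∀ n (x : A → ℤ) i → (n · x) i ≡ n ℤ.* x i
  ·-pointwise {A} = λ { (+ n) → ℕ-pointwise n ; -[1+ n ] x i →
      trans (cong ℤ.-_ (ℕ-pointwise (suc n) x i)) (ℤ.neg-distribˡ-* (+ suc n) (x i)) }
    where
    open Module (Pointwise.abelianGroup A ℤ.+-0-abelianGroup)
    ℕ-pointwise : ∀ n (x : A → ℤ) i → (n ·ℕ x) i ≡ + n ℤ.* x i
    ℕ-pointwise zero x i = sym (ℤ.*-zeroˡ (x i))
    ℕ-pointwise (suc n) x i = trans (cong (ℤ._+_ (x i)) (ℕ-pointwise n x i)) (sym (ℤ.suc-* (+ n) (x i)))

  𝕏-torsionFree : TorsionFree 𝕏
  𝕏-torsionFree n x n≢0 (N , p) = N , λ i N≤i → trans (ℤ.+-identityʳ (x i))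
    (Sum.[ (λ n≡0 → contradiction n≡0 n≢0) , id ] (ℤ.i*j≡0⇒i≡0∨j≡0 n
      (trans (sym (·-pointwise n x i)) (trans (sym (ℤ.+-identityʳ _)) (p i N≤i)))))

  -- A telescoping diagonal: x i is the value at i of the i-th partial sum.
  𝕏-complete : Complete 𝕏
  𝕏-complete L v chain steps = x , divides-x
    where
    open ≡-Reasoning
    open ℤSolver using (_:*_; _:+_; :-_; _:-_; _:=_; con)
    q : ℕ → ℕ → ℤ
    q j = proj₁ (steps j)

    -- `partial j` represents the same class as v j, but its increments are multiples of L j at
    -- every coordinate, whereas those of v are so only from some coordinate on.
    partial : ℕ → ℕ → ℤ
    partial zero i = v 0 i
    partial (suc j) i = partial j i ℤ.+ L j ℤ.* q j i

    partial≈v : ∀ j → ∃ λ N → ∀ i → N ℕ.≤ i → partial j i ≡ v j i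
    partial≈v zero = 0 , λ _ _ → refl
    partial≈v (suc j) =
      let N , p = partial≈v j
          M , r = proj₂ (steps j)
      in N ℕ.⊔ M , λ i b → begin
        partial j i ℤ.+ L j ℤ.* q j i
          ≡⟨ cong₂ ℤ._+_ (p i (ℕ.m⊔n≤o⇒m≤o N M b)) (sym (·-pointwise (L j) (q j) i)) ⟩
        v j i ℤ.+ (L j 𝕏.· q j) i
          ≡⟨ cong (ℤ._+_ (v j i)) (ℤ.i-j≡0⇒i≡j _ _ (r i (ℕ.m⊔n≤o⇒n≤o N M b))) ⟩
        v j i ℤ.+ (v (suc j) i ℤ.- v j i)
          ≡⟨ ℤSolver.solve 2 (λ a b → a :+ (b :- a) := b) refl (v j i) (v (suc j) i) ⟩
        v (suc j) i ∎

    -- The sign is there because `Complete` asks L j to divide x + v j.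
    x : ℕ → ℤ
    x i = ℤ.- partial i i

    tail : ∀ j i k → ∃ λ b → ∃ λ u → L (k ℕ.+ j) ≡ L j ℤ.* u × partial (k ℕ.+ j) i ≡ partial j i ℤ.+ L j ℤ.* b
    tail j i zero = 0ℤ , 1ℤ , sym (ℤ.*-identityʳ (L j)) ,
      sym (trans (cong (ℤ._+_ (partial j i)) (ℤ.*-zeroʳ (L j))) (ℤ.+-identityʳ _))
    tail j i (suc k) =
      let b , u , p , r = tail j i k
          u′ , p′ = chain (k ℕ.+ j)
          c = q (k ℕ.+ j) i
      in b ℤ.+ u ℤ.* c , u ℤ.* u′ , trans p′ (trans (cong (ℤ._* u′) p) (ℤ.*-assoc (L j) u u′)) , (begin
        partial (k ℕ.+ j) i ℤ.+ L (k ℕ.+ j) ℤ.* c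
          ≡⟨ cong₂ (λ s l → s ℤ.+ l ℤ.* c) r p ⟩
        partial j i ℤ.+ L j ℤ.* b ℤ.+ L j ℤ.* u ℤ.* c
          ≡⟨ ℤSolver.solve 5 (λ s l b u c → s :+ l :* b :+ l :* u :* c := s :+ l :* (b :+ u :* c)) refl
               (partial j i) (L j) b u c ⟩
        partial j i ℤ.+ L j ℤ.* (b ℤ.+ u ℤ.* c) ∎)

    divides-x : ∀ j → Divides 𝕏 (L j) (x 𝕏.∙ v j)
    divides-x j = r , N ℕ.⊔ j , λ i N⊔j≤i →
      let partial≡v = p i (ℕ.m⊔n≤o⇒m≤o N j N⊔j≤i)
          i≡ = ℕ.m∸n+n≡m (ℕ.m⊔n≤o⇒n≤o N j N⊔j≤i)
          b , u , _ , split = tail j i (i ℕ.∸ j)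
      in ℤ.i≡j⇒i-j≡0 (begin
        (L j 𝕏.· r) i
          ≡⟨ ·-pointwise (L j) r i ⟩
        L j ℤ.* ℤ.- b
          ≡⟨ ℤSolver.solve 3 (λ s l b → l :* :- b := :- (s :+ l :* b) :+ s) refl (partial j i) (L j) b ⟩
        ℤ.- (partial j i ℤ.+ L j ℤ.* b) ℤ.+ partial j i
          ≡⟨ cong₂ (λ s t → ℤ.- s ℤ.+ t) (trans (sym split) (cong (λ k → partial k i) i≡)) partial≡v ⟩
        x i ℤ.+ v j i ∎)
      where
      N = proj₁ (partial≈v j)
      p = proj₂ (partial≈v j)
      r : ℕ → ℤ
      r i = ℤ.- proj₁ (tail j i (i ℕ.∸ j))

  -- Groups in ⊥(ℤ^ω / ℤ^⟨ω⟩) are torsion-free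

  ℤ-ideal-principal : (P : ℤ → Set) → P 0ℤ → (∀ {i j} q → P i → P j → P (i ℤ.- q ℤ.* j)) →
                      ∃ λ d → P d × (∀ k → P k → ∃ λ q → k ≡ q ℤ.* d)
  ℤ-ideal-principal P P0 closed with dec (∃ λ m → P (+ suc m))
  ... | no none = 0ℤ , P0 , λ
    { (+ zero) _ → 0ℤ , refl
    ; (+ suc m) Pk → contradiction (m , Pk) none
    ; -[1+ m ] Pk → contradiction (m , subst P (negate -[1+ m ]) (closed 1ℤ P0 Pk)) none
    }
    where
    negate : ∀ k → 0ℤ ℤ.- 1ℤ ℤ.* k ≡ ℤ.- k
    negate k = trans (ℤ.+-identityˡ (ℤ.- (1ℤ ℤ.* k))) (cong ℤ.-_ (ℤ.*-identityˡ k))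
  ... | yes some with minimal <-wellFounded (λ m → P (+ suc m)) some
  ...   | m , Pd , least-m = d , Pd , λ k Pk → k ℤ./ℕ suc m , divisible k Pk
    where
    d = + suc m
    divisible : ∀ k → P k → k ≡ (k ℤ./ℕ suc m) ℤ.* d
    divisible k Pk with k ℤ.%ℕ suc m | ℤ.n%ℕd<d k (suc m) | ℤ.a≡a%ℕn+[a/ℕn]*n k (suc m)
    ... | zero | _ | e = trans e (ℤ.+-identityˡ _)
    ... | suc r | ℕ.s≤s r<m | e = contradiction (subst P remainder (closed (k ℤ./ℕ suc m) Pk Pd)) (least-m r<m)
      where
      remainder : k ℤ.- (k ℤ./ℕ suc m) ℤ.* d ≡ + suc r
      remainder = trans (cong (ℤ._- (k ℤ./ℕ suc m) ℤ.* d) e)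
        (ℤSolver.solve 2 (λ r n → r ℤSolver.:+ n ℤSolver.:- n ℤSolver.:= r) refl (+ suc r) ((k ℤ./ℕ suc m) ℤ.* d))

  adjoin : {H : AbGroup} → Subgroup H → AbelianGroup.Carrier H → Subgroup H
  adjoin {H} S h = record
    { Member    = λ x → ∃ λ k → ∃ λ s → Member s × x ≈ k · h ∙ s
    ; resp      = λ x≈y (k , s , m , p) → k , s , m , ≈-trans (≈-sym x≈y) p
    ; ε-closed  = 0ℤ , ε , ε-closed , ≈-sym (identityˡ ε)
    ; ∙-closed  = λ (k , s , m , p) (l , t , m′ , q) → k ℤ.+ l , s ∙ t , ∙-closed m m′ , ≈-trans (∙-cong p q)
        (solve (k ∷ l ∷ []) (h ∷ s ∷ t ∷ []) (λ { (k ∷ l ∷ []) (h ∷ s ∷ t ∷ []) →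
           (k ⊙ h ⊕ s) ⊕ (l ⊙ h ⊕ t) ⊜ (k ℤSolver.:+ l) ⊙ h ⊕ (s ⊕ t) }) refl)
    ; ⁻¹-closed = λ (k , s , m , p) → ℤ.- k , s ⁻¹ , ⁻¹-closed m , ≈-trans (⁻¹-cong p)
        (solve (k ∷ []) (h ∷ s ∷ []) (λ { (k ∷ []) (h ∷ s ∷ []) →
           ⊖ (k ⊙ h ⊕ s) ⊜ (ℤSolver.:- k) ⊙ h ⊕ ⊖ s }) refl)
    }
    where
    open Module H
    open Subgroup S

  ⊆adjoin : ∀ {H} (S : Subgroup H) h {x} → Subgroup.Member S x → Subgroup.Member (adjoin {H} S h) x
  ⊆adjoin {H} S h {x} m = 0ℤ , x , m , ≈-sym (identityˡ x)
    where open Module H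

  ∈adjoin : ∀ {H} (S : Subgroup H) h → Subgroup.Member (adjoin {H} S h) h
  ∈adjoin {H} S h = 1ℤ , ε , Subgroup.ε-closed S , ≈-sym (≈-trans (identityʳ _) (1· h))
    where open Module H

  -- Characters into ℚ/ℤ and the non-split extension

  ℚ⁺ : AbGroup
  ℚ⁺ = ℚ.+-0-abelianGroup

  module ℚ⁺ = Module ℚ⁺

  ·-ℚ : ∀ n p → n ℚ⁺.· p ℚ.≃ ℚ.mkℚᵘ n 0 ℚ.* p
  ·-ℚ = λ
    { (+ n) p → ℕ-·-ℚ n p
    ; -[1+ n ] p → ℚ.≃-trans (ℚ.-‿cong (ℕ-·-ℚ (suc n) p)) (ℚ.neg-distribˡ-* (ℚ.mkℚᵘ (+ suc n) 0) p)
    }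
    where
    ℕ-·-ℚ : ∀ n p → n ℚ⁺.·ℕ p ℚ.≃ ℚ.mkℚᵘ (+ n) 0 ℚ.* p
    ℕ-·-ℚ zero p = ℚ.≃-sym (ℚ.*-zeroˡ p)
    ℕ-·-ℚ (suc n) p = begin
      p ℚ.+ n ℚ⁺.·ℕ p                              ≈⟨ ℚ.+-cong (ℚ.≃-sym (ℚ.*-identityˡ p)) (ℕ-·-ℚ n p) ⟩
      ℚ.1ℚᵘ ℚ.* p ℚ.+ ℚ.mkℚᵘ (+ n) 0 ℚ.* p         ≈⟨ ℚ.*-distribʳ-+ p ℚ.1ℚᵘ (ℚ.mkℚᵘ (+ n) 0) ⟨
      (ℚ.1ℚᵘ ℚ.+ ℚ.mkℚᵘ (+ n) 0) ℚ.* p             ≈⟨ ℚ.*-congʳ {p} 1+n ⟩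
      ℚ.mkℚᵘ (+ suc n) 0 ℚ.* p                     ∎
      where
      open SetoidReasoning ℚ⁺.setoid
      1+n : ℚ.1ℚᵘ ℚ.+ ℚ.mkℚᵘ (+ n) 0 ℚ.≃ ℚ.mkℚᵘ (+ suc n) 0
      1+n = ℚ.*≡* (cong (λ i → (1ℤ ℤ.+ i) ℤ.* 1ℤ) (ℤ.*-identityʳ (+ n)))

  ℚ-divisible : ∀ n q → ¬ n ≡ 0ℤ → Divides ℚ⁺ n q
  ℚ-divisible n q n≢0 = (ℚ.1/ p) ℚ.* q , (begin
    n ℚ⁺.· ((ℚ.1/ p) ℚ.* q)     ≈⟨ ·-ℚ n _ ⟩
    p ℚ.* ((ℚ.1/ p) ℚ.* q)      ≈⟨ ℚ.*-assoc p (ℚ.1/ p) q ⟨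
    p ℚ.* (ℚ.1/ p) ℚ.* q        ≈⟨ ℚ.*-congʳ (ℚ.*-inverseʳ p) ⟩
    ℚ.1ℚᵘ ℚ.* q                 ≈⟨ ℚ.*-identityˡ q ⟩
    q                           ∎)
    where
    open SetoidReasoning ℚ⁺.setoid
    p = ℚ.mkℚᵘ n 0
    instance
      p≢0 : ℚ.NonZero p
      p≢0 = ℤ.≢-nonZero n≢0

  ℤ→ℚ-injective : ∀ {i j} → i ℚ⁺.· ℚ.1ℚᵘ ℚ.≃ j ℚ⁺.· ℚ.1ℚᵘ → i ≡ j
  ℤ→ℚ-injective {i} {j} p with ℚ.≃-trans (ℚ.≃-sym (toℚ i)) (ℚ.≃-trans p (toℚ j))
    where
    toℚ : ∀ i → i ℚ⁺.· ℚ.1ℚᵘ ℚ.≃ ℚ.mkℚᵘ i 0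
    toℚ i = ℚ.≃-trans (·-ℚ i ℚ.1ℚᵘ) (ℚ.*-identityʳ _)
  ... | ℚ.*≡* e = trans (sym (ℤ.*-identityʳ i)) (trans e (ℤ.*-identityʳ j))

  Integral : Pred ℚ.ℚᵘ 0ℓ
  Integral q = ∃ λ k → k ℚ⁺.· ℚ.1ℚᵘ ℚ.≃ q

  -- A homomorphism G → ℚ/ℤ is represented by its graph, as a subgroup of G × ℚ whose fibre
  -- over ε is ℤ.
  module _ (G : AbGroup) where
    private
      module G = Module G
      module P = Module (G ×ᴳ ℚ⁺)

    IntegralFibre : Pred P.Carrier 0ℓ → Pred P.Carrier 0ℓ
    IntegralFibre Γ (z , q) = z G.≈ G.ε → Integral q

    trivialCharacter : Subgroup (G ×ᴳ ℚ⁺)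
    trivialCharacter = record
      { Member    = λ (z , q) → z G.≈ G.ε × Integral q
      ; resp      = λ (p , q) (z≈ε , k , e) → G.≈-trans (G.≈-sym p) z≈ε , k , ℚ.≃-trans e q
      ; ε-closed  = G.≈-refl , 0ℤ , ℚ.≃-refl
      ; ∙-closed  = λ (p , k , e) (q , l , e′) → G.≈-trans (G.∙-cong p q) (G.identityˡ _) ,
          k ℤ.+ l , ℚ.≃-trans (ℚ⁺.·-+ k l ℚ.1ℚᵘ) (ℚ.+-cong e e′)
      ; ⁻¹-closed = λ (p , k , e) → G.≈-trans (G.⁻¹-cong p) G.ε⁻¹≈ε ,
          ℤ.- k , ℚ.≃-trans (ℚ⁺.·-neg k ℚ.1ℚᵘ) (ℚ.-‿cong e)
      }

    -- This is the injectivity of ℚ/ℤ: the k for which k · e lies in the domain are the multiples of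
    -- d, so prescribing y with d · y a value at d · e is consistent with Γ at all of them, and only
    -- integers appear over ε.
    adjoin-integral : (Γ : Subgroup (G ×ᴳ ℚ⁺)) → (∀ {p} → Subgroup.Member Γ p → IntegralFibre (Subgroup.Member Γ) p) →
      ∀ d e y → Subgroup.Member Γ (d G.· e , d ℚ⁺.· y) →
      (∀ k → (∃ λ v → Subgroup.Member Γ (k G.· e , v)) → ∃ λ q → k ≡ q ℤ.* d) →
      ∀ {p} → Subgroup.Member (adjoin {G ×ᴳ ℚ⁺} Γ (e , y)) p →
      IntegralFibre (Subgroup.Member (adjoin {G ×ᴳ ℚ⁺} Γ (e , y))) p
    adjoin-integral Γ integral d e y de∈ generates {z , q} (k , (w , v) , m , p) z≈ε =
      integral {z , q} (resp (P.≈-sym p) (∙-closed ky∈ m)) z≈ε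
      where
      open Subgroup Γ
      zSplit : z G.≈ k G.· e G.∙ w
      zSplit = G.≈-trans (proj₁ p) (G.∙-congʳ (proj₁ (·-pair G ℚ⁺ k e y)))
      ke≈ : w G.⁻¹ G.≈ k G.· e
      ke≈ = G.≈-sym (AbelianGroupProperties.inverseˡ-unique G (k G.· e) w (G.≈-trans (G.≈-sym zSplit) z≈ε))
      multiple = generates k (v ℚ⁺.⁻¹ , resp (ke≈ , ℚ.≃-refl) (⁻¹-closed m))
      ky∈ : Member (k P.· (e , y))
      ky∈ = resp (P.≈-trans (P.·-cong (proj₁ multiple) (P.≈-sym (·-pair G ℚ⁺ d e y)))
               (P.≈-trans (P.≈-sym (P.·-* (proj₁ multiple) d (e , y)))
               (P.≈-reflexive (cong (P._· (e , y)) (sym (proj₂ multiple))))))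
             (·-closed Γ (proj₁ multiple) de∈)

    Domain : Subgroup (G ×ᴳ ℚ⁺) → G.Carrier → ℤ → Set
    Domain Γ e k = ∃ λ v → Subgroup.Member Γ (k G.· e , v)

    domain-principal : ∀ Γ e → ∃ λ d → Domain Γ e d × (∀ k → Domain Γ e k → ∃ λ q → k ≡ q ℤ.* d)
    domain-principal Γ e = ℤ-ideal-principal (Domain Γ e) (ℚ.0ℚᵘ , ε-closed)
      λ {i} {j} q (v , m) (u , m′) → _ , resp
        (G.≈-trans (G.∙-congˡ (G.⁻¹-cong (proj₁ (·-pair G ℚ⁺ q (j G.· e) u))))
          (G.solve (i ∷ q ∷ j ∷ []) (e ∷ []) (λ { (i ∷ q ∷ j ∷ []) (e ∷ []) →
            i G.⊙ e G.⊕ G.⊖ (q G.⊙ (j G.⊙ e)) G.⊜ (i ℤSolver.:- q ℤSolver.:* j) G.⊙ e }) refl) , ℚ.≃-refl)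
        (∙-closed m (⁻¹-closed (·-closed Γ q m′)))
      where open Subgroup Γ

    totalCharacter : (Γ : Subgroup (G ×ᴳ ℚ⁺)) → (∀ {p} → Subgroup.Member Γ p → IntegralFibre (Subgroup.Member Γ) p) →
      Σ[ M ∈ Subgroup (G ×ᴳ ℚ⁺) ] (∀ {p} → Subgroup.Member Γ p → Subgroup.Member M p) ×
        (∀ {p} → Subgroup.Member M p → IntegralFibre (Subgroup.Member M) p) ×
        (∀ x → ∃ λ q → Subgroup.Member M (x , q))
    totalCharacter Γ integral with maximalSubgroup (G ×ᴳ ℚ⁺) IntegralFibre (λ _ p → p) Γ integral
    ... | M , Γ⊆M , integralM , maximal = M , Γ⊆M , integralM , total
      where
      open Subgroup M
      total : ∀ x → ∃ λ q → Member (x , q)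
      total x with domain-principal M x
      ... | d , (v , m) , generates with dec (d ≡ 0ℤ)
      -- No nonzero multiple of x lies in the domain, so any value is admissible.
      ...   | yes refl = ℚ.0ℚᵘ , maximal (adjoin M (x , ℚ.0ℚᵘ))
                (adjoin-integral M integralM 0ℤ x ℚ.0ℚᵘ ε-closed generates) (⊆adjoin M _) (∈adjoin M _)
      ...   | no d≢0 = let y , dy≈v = ℚ-divisible d v d≢0 in
                y , maximal (adjoin M (x , y))
                (adjoin-integral M integralM d x y (resp (G.≈-refl , ℚ.≃-sym dy≈v) m) generates)
                (⊆adjoin M _) (∈adjoin M _)

    abstract
      -- The value at g is 1/d, where d is the order of g.
      characterAt : ∀ g n → ¬ n ≡ 0ℤ → n G.· g G.≈ G.ε → Σ[ M ∈ Subgroup (G ×ᴳ ℚ⁺) ]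
        (∀ {p} → Subgroup.Member trivialCharacter p → Subgroup.Member M p) ×
        (∀ {p} → Subgroup.Member M p → IntegralFibre (Subgroup.Member M) p) ×
        (∀ x → ∃ λ q → Subgroup.Member M (x , q)) ×
        (∃ λ d → ∃ λ y → d G.· g G.≈ G.ε × d ℚ⁺.· y ℚ.≃ ℚ.1ℚᵘ × Subgroup.Member M (g , y))
      characterAt g n n≢0 ng≈ε with domain-principal trivialCharacter g
      ... | d , (_ , dg≈ε , _) , generates =
        let y , dy≈1 = ℚ-divisible d ℚ.1ℚᵘ d≢0
            Γ = adjoin trivialCharacter (g , y)
            M , Γ⊆M , integral , total = totalCharacter Γ (adjoin-integral trivialCharacter (λ (_ , i) _ → i) d g y
              (dg≈ε , 1ℤ , ℚ.≃-trans (ℚ⁺.1· ℚ.1ℚᵘ) (ℚ.≃-sym dy≈1)) generates)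
        in M , (λ m → Γ⊆M (⊆adjoin trivialCharacter _ m)) , integral , total ,
           d , y , dg≈ε , dy≈1 , Γ⊆M (∈adjoin trivialCharacter _)
        where
        d≢0 : ¬ d ≡ 0ℤ
        d≢0 d≡0 = let q , n≡ = generates n (ℚ.0ℚᵘ , ng≈ε , 0ℤ , ℚ.≃-refl) in
          n≢0 (trans n≡ (trans (cong (q ℤ.*_) d≡0) (ℤ.*-zeroʳ q)))

  inclusion : ∀ {H} (S : Subgroup H) → Hom (asGroup S) H
  inclusion {H} S = record
    { ⟦_⟧ = proj₁
    ; isGroupHomomorphism = record
      { isMonoidHomomorphism = record
        { isMagmaHomomorphism = record
          { isRelHomomorphism = record { cong = id }
          ; homo = λ _ _ → H.refl
          }
        ; ε-homo = H.refl
        }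
      ; ⁻¹-homo = λ _ → H.refl
      }
    }
    where module H = AbelianGroup H

  evaluation : ∀ (H : AbGroup) → ℕ → Hom (Pointwise.abelianGroup ℕ H) H
  evaluation H i = record
    { ⟦_⟧ = λ f → f i
    ; isGroupHomomorphism = record
      { isMonoidHomomorphism = record
        { isMagmaHomomorphism = record
          { isRelHomomorphism = record { cong = λ p → p i }
          ; homo = λ _ _ → H.refl
          }
        ; ε-homo = H.refl
        }
      ; ⁻¹-homo = λ _ → H.refl
      }
    }
    where module H = AbelianGroup H

  -- The pullback of 0 → ℤ^ω/ℤ^⟨ω⟩ → ℚ^ω/ℤ^⟨ω⟩ → (ℚ/ℤ)^ω → 0 along the diagonal of a character.
  module DiagonalExtension (G : AbGroup) (Γ : Subgroup (G ×ᴳ ℚ⁺))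
    (trivial⊆ : ∀ {p} → Subgroup.Member (trivialCharacter G) p → Subgroup.Member Γ p)
    (integral : ∀ {p} → Subgroup.Member Γ p → IntegralFibre G (Subgroup.Member Γ) p)
    (total : ∀ x → ∃ λ q → Subgroup.Member Γ (x , q)) where

    module G = Module G
    open Subgroup Γ

    ℚ^ω×G : AbGroup
    ℚ^ω×G = Pointwise.abelianGroup ℕ ℚ⁺ ×ᴳ G
    module H = Module ℚ^ω×G

    lifts : Subgroup ℚ^ω×G
    lifts = record
      { Member    = λ (f , x) → ∀ i → Member (x , f i)
      ; resp      = λ (p , q) m i → resp (q , p i) (m i)
      ; ε-closed  = λ i → ε-closed
      ; ∙-closed  = λ m m′ i → ∙-closed (m i) (m′ i)
      ; ⁻¹-closed = λ m i → ⁻¹-closed (m i)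
      }

    -- Over ε the members of `lifts` are sequences of integers, so this is a copy of ℤ^⟨ω⟩.
    null : Subgroup (asGroup lifts)
    null = record
      { Member    = λ ((f , x) , _) → x G.≈ G.ε × ∃ λ N → ∀ i → N ℕ.≤ i → f i ℚ.≃ ℚ.0ℚᵘ
      ; resp      = λ (p , q) (x≈ε , N , r) → G.≈-trans (G.≈-sym q) x≈ε , N , λ i b → ℚ.≃-trans (ℚ.≃-sym (p i)) (r i b)
      ; ε-closed  = G.≈-refl , 0 , λ _ _ → ℚ.≃-refl
      ; ∙-closed  = λ (p , N , r) (q , M , s) → G.≈-trans (G.∙-cong p q) (G.identityˡ _) , N ℕ.⊔ M , λ i b →
          ℚ.≃-trans (ℚ.+-cong (r i (ℕ.m⊔n≤o⇒m≤o N M b)) (s i (ℕ.m⊔n≤o⇒n≤o N M b))) (ℚ.+-identityˡ ℚ.0ℚᵘ)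
      ; ⁻¹-closed = λ (p , N , r) → G.≈-trans (G.⁻¹-cong p) G.ε⁻¹≈ε , N , λ i b →
          ℚ⁺.≈-trans (ℚ⁺.⁻¹-cong (r i b)) ℚ⁺.ε⁻¹≈ε
      }

    Total : AbGroup
    Total = asGroup lifts / null
    module E = Module Total

    ≈-intro : ∀ {e e′ : E.Carrier} → proj₂ (proj₁ e) G.≈ proj₂ (proj₁ e′) →
              (∃ λ N → ∀ i → N ℕ.≤ i → proj₁ (proj₁ e) i ℚ.≃ proj₁ (proj₁ e′) i) → e E.≈ e′
    ≈-intro {e} {e′} p (N , q) = G.≈-trans (G.∙-congʳ p) (G.inverseʳ _) , N , λ i b →
      ℚ.≃-trans (ℚ.+-congˡ (ℚ.- proj₁ (proj₁ e′) i) (q i b)) (ℚ.+-inverseʳ (proj₁ (proj₁ e′) i))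

    ≈-elim : ∀ {e e′ : E.Carrier} → e E.≈ e′ → proj₂ (proj₁ e) G.≈ proj₂ (proj₁ e′) ×
             (∃ λ N → ∀ i → N ℕ.≤ i → proj₁ (proj₁ e) i ℚ.≃ proj₁ (proj₁ e′) i)
    ≈-elim (p , N , q) = G.x∙y⁻¹≈ε⇒x≈y p , N , λ i b → ℚ⁺.x∙y⁻¹≈ε⇒x≈y (q i b)

    constants : 𝕏.Carrier → E.Carrier
    constants z = ((λ i → z i ℚ⁺.· ℚ.1ℚᵘ) , G.ε) , λ i → trivial⊆ (G.≈-refl , z i , ℚ.≃-refl)

    ι : Hom 𝕏 Total
    ι = record
      { ⟦_⟧ = constants
      ; isGroupHomomorphism = record
        { isMonoidHomomorphism = record
          { isMagmaHomomorphism = record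
            { isRelHomomorphism = record
              { cong = λ {z} {z′} (N , p) → ≈-intro {constants z} {constants z′} G.≈-refl
                  (N , λ i b → ℚ⁺.≈-reflexive (cong (ℚ⁺._· ℚ.1ℚᵘ) (ℤ.i-j≡0⇒i≡j (z i) (z′ i) (p i b)))) }
            ; homo = λ z z′ → ≈-intro {constants (z 𝕏.∙ z′)} {constants z E.∙ constants z′} (G.≈-sym (G.identityˡ G.ε))
                  (0 , λ i _ → ℚ⁺.·-+ (z i) (z′ i) ℚ.1ℚᵘ)
            }
          ; ε-homo = ≈-intro {constants 𝕏.ε} {E.ε} G.≈-refl (0 , λ _ _ → ℚ.≃-refl)
          }
        ; ⁻¹-homo = λ z → ≈-intro {constants (z 𝕏.⁻¹)} {constants z E.⁻¹} (G.≈-sym G.ε⁻¹≈ε)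
            (0 , λ i _ → ℚ⁺.·-neg (z i) ℚ.1ℚᵘ)
        }
      }

    π : Hom Total G
    π = record
      { ⟦_⟧ = λ ((_ , x) , _) → x
      ; isGroupHomomorphism = record
        { isMonoidHomomorphism = record
          { isMagmaHomomorphism = record
            { isRelHomomorphism = record { cong = λ {e} {e′} p → proj₁ (≈-elim {e} {e′} p) }
            ; homo = λ _ _ → G.≈-refl
            }
          ; ε-homo = G.≈-refl
          }
        ; ⁻¹-homo = λ _ → G.≈-refl
        }
      }

    extension : Extension G 𝕏
    extension = record
      { E = Total ; ι = ι ; π = π
      ; ι-inj  = λ {z} {z′} p → let _ , N , q = ≈-elim {constants z} {constants z′} p in
          N , λ i b → ℤ.i≡j⇒i-j≡0 (ℤ→ℚ-injective {z i} {z′ i} (q i b))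
      ; π-surj = λ x → let q , m = total x in (((λ _ → q) , x) , λ _ → m) ,
          λ {e} p → proj₁ (≈-elim {e} {((λ _ → q) , x) , λ _ → m} p)
      ; exact  = λ e@((f , x) , m) → mk⇔
          (λ x≈ε → (λ i → proj₁ (integral (m i) x≈ε)) ,
            ≈-intro {constants λ i → proj₁ (integral (m i) x≈ε)} {e} (G.≈-sym x≈ε)
              (0 , λ i _ → proj₂ (integral (m i) x≈ε)))
          (λ (z , p) → G.≈-sym (proj₁ (≈-elim {constants z} {e} p)))
      }

    ·-components : ∀ n (e : E.Carrier) → proj₂ (proj₁ (n E.· e)) G.≈ n G.· proj₂ (proj₁ e) ×
                   (∀ i → proj₁ (proj₁ (n E.· e)) i ℚ.≃ n ℚ⁺.· proj₁ (proj₁ e) i)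
    ·-components n e@((f , x) , m) = G.≈-trans (proj₂ inH) (proj₂ inPair) ,
      λ i → ℚ.≃-trans (proj₁ inH i) (ℚ.≃-trans (proj₁ inPair i)
              (·-homo {Pointwise.abelianGroup ℕ ℚ⁺} {ℚ⁺} (evaluation ℚ⁺ i) n f))
      where
      inH = ·-homo {asGroup lifts} {ℚ^ω×G} (inclusion lifts) n e
      inPair = ·-pair (Pointwise.abelianGroup ℕ ℚ⁺) G n f x

    -- If the extension splits, the value 1/d of the character becomes integral.
    split⇒unit : extension ~ splitExtension G 𝕏 → ∀ {g} d y → Member (g , y) → d G.· g G.≈ G.ε →
                 d ℚ⁺.· y ℚ.≃ ℚ.1ℚᵘ → ∃ λ r → d ℤ.* r ≡ 1ℤ
    split⇒unit (φ , onX , _) {g} d y m dg≈ε dy≈1 = r N , trans (sym (·-pointwise d r N))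
        (ℤ.i-j≡0⇒i≡j ((d 𝕏.· r) N) 1ℤ (proj₂ dr≈1 N ℕ.≤-refl))
      where
      module φ = GroupHomomorphism φ
      module Split = Module (𝕏 ×ᴳ G)
      -- The constant lift of g. Its d-fold multiple is the image under ι of the constant sequence
      -- 1, so its component `r` in 𝕏 satisfies d · r ≈ 1, which holds as an equation of integers at
      -- every coordinate from some N on.
      ê : E.Carrier
      ê = ((λ _ → y) , g) , λ _ → m
      r : 𝕏.Carrier
      r = proj₁ φ.⟦ ê ⟧
      one : 𝕏.Carrier
      one _ = 1ℤ
      dê≈ : d E.· ê E.≈ constants one
      dê≈ = ≈-intro {d E.· ê} {constants one} (G.≈-trans (proj₁ (·-components d ê)) dg≈ε)
        (0 , λ i _ → ℚ.≃-trans (proj₂ (·-components d ê) i) (ℚ.≃-trans dy≈1 (ℚ.≃-sym (ℚ⁺.1· ℚ.1ℚᵘ))))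
      step₁ : proj₁ φ.⟦ d E.· ê ⟧ 𝕏.≈ proj₁ (d Split.· φ.⟦ ê ⟧)
      step₁ = proj₁ (·-homo {Total} {𝕏 ×ᴳ G} φ d ê)
      step₂ : proj₁ (d Split.· φ.⟦ ê ⟧) 𝕏.≈ (d 𝕏.· r)
      step₂ = proj₁ (·-pair 𝕏 G d r (proj₂ φ.⟦ ê ⟧))
      step₃ : proj₁ φ.⟦ d E.· ê ⟧ 𝕏.≈ proj₁ φ.⟦ constants one ⟧
      step₃ = proj₁ (φ.⟦⟧-cong {d E.· ê} {constants one} dê≈)
      step₄ : proj₁ φ.⟦ constants one ⟧ 𝕏.≈ one
      step₄ = proj₁ (onX one)
      dr≈1 : (d 𝕏.· r) 𝕏.≈ one
      dr≈1 = begin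
        d 𝕏.· r                        ≈⟨ step₂ ⟨
        proj₁ (d Split.· φ.⟦ ê ⟧)      ≈⟨ step₁ ⟨
        proj₁ φ.⟦ d E.· ê ⟧            ≈⟨ step₃ ⟩
        proj₁ φ.⟦ constants one ⟧      ≈⟨ step₄ ⟩
        one                            ∎
        where open SetoidReasoning 𝕏.setoid
      N = proj₁ dr≈1

  character⇒unit : ∀ {G} → Perp 𝕏 G → let open Module G in ∀ g n → ¬ n ≡ 0ℤ → n · g ≈ ε →
                   ∃ λ d → d · g ≈ ε × ∃ λ r → d ℤ.* r ≡ 1ℤ
  character⇒unit {G} perp g n n≢0 ng≈ε =
    let Γ , trivial⊆ , integral , total , d , y , dg≈ε , dy≈1 , m = characterAt G g n n≢0 ng≈ε
    in d , dg≈ε , DiagonalExtension.split⇒unit G Γ trivial⊆ integral total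
         (perp (DiagonalExtension.extension G Γ trivial⊆ integral total)) d y m dg≈ε dy≈1

  Perp⇒torsionFree : ∀ {G} → Perp 𝕏 G → TorsionFree G
  Perp⇒torsionFree {G} perp n g n≢0 ng≈ε =
    let d , dg≈ε , r , dr≡1 = character⇒unit perp g n n≢0 ng≈ε in begin
      g                        ≈⟨ 1· g ⟨
      1ℤ · g                   ≡⟨ cong (_· g) (trans (ℤ.*-comm r d) dr≡1) ⟨
      (r ℤ.* d) · g            ≈⟨ ·-* r d g ⟩
      r · (d · g)              ≈⟨ ·-cong r dg≈ε ⟩
      r · ε                    ≈⟨ ·-ε r ⟩
      ε                        ∎
    where
    open Module G
    open SetoidReasoning setoid

  -- Galois types

  torsionFree-asGroup : ∀ {H} (S : Subgroup H) → TorsionFree H → TorsionFree (asGroup S)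
  torsionFree-asGroup {H} S tf n x n≢0 p =
    tf n (proj₁ x) n≢0 (Module.≈-trans H (Module.≈-sym H (·-homo {asGroup S} {H} (inclusion S) n x)) p)

  open PerpGalois 𝕏 renaming (_·_ to infixl 20 _•_) public

  inClass : ∀ {G} → TorsionFree G → Perp 𝕏 G
  inClass = torsionFree⇒Perp 𝕏-torsionFree 𝕏-complete

  PureHom : {M N : AbGroup} → Hom M N → Set
  PureHom {M} {N} f = ∀ n y m → ¬ n ≡ 0ℤ → ⟦ m ⟧ ≈ n · y → ∃ λ m′ → ⟦ m′ ⟧ ≈ y
    where
    open Module N
    open GroupHomomorphism f

  pureEmbedding : ∀ {M N} (f : Hom M N) → IsInjective {M} {N} f → TorsionFree N → PureHom {M} {N} f →
                  StrongEmbedding M N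
  pureEmbedding {M} {N} f inj tf pure = record { hom = f ; injective = inj ; strong = strong }
    where
    open Module N
    strong : PerpStrong 𝕏 (image {M} {N} f)
    strong = inClass (torsionFree-asGroup (image {M} {N} f) tf) , inClass λ n y n≢0 (m , p) →
      let m′ , q = pure n y m n≢0 (≈-trans p (x-ε≈x (n · y))) in m′ , ≈-trans q (≈-sym (x-ε≈x y))

  strong⇒pure : ∀ {M N} (f : StrongEmbedding M N) → PureHom {M} {N} (StrongEmbedding.hom f)
  strong⇒pure {M} {N} f n y m n≢0 p =
    let m′ , q = Perp⇒torsionFree (proj₂ (StrongEmbedding.strong f)) n y n≢0 (m , ≈-trans p (≈-sym (x-ε≈x (n · y))))
    in m′ , ≈-trans q (x-ε≈x y)
    where
    open Module N

  divides-resp : ∀ {N} n {x y} → AbelianGroup._≈_ N x y → Divides N n x → Divides N n y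
  divides-resp {N} n p (z , q) = z , AbelianGroup.trans N q p

  divides-hom : ∀ {M N} (f : Hom M N) n {m} → Divides M n m → Divides N n (GroupHomomorphism.⟦ f ⟧ m)
  divides-hom {M} {N} f n (z , p) = f.⟦ z ⟧ , N.≈-trans (N.≈-sym (·-homo {M} {N} f n z)) (f.⟦⟧-cong p)
    where
    module N = Module N
    module f = GroupHomomorphism f

  divides-strong : ∀ {M N} (f : StrongEmbedding M N) n {m} → Divides N n (f • m) → Divides M n m
  divides-strong {M} {N} f n {m} (z , p) with dec (n ≡ 0ℤ)
  ... | yes refl = M.ε , M.≈-sym (StrongEmbedding.injective f (N.≈-trans (N.≈-sym p) (N.≈-sym f.ε-homo)))
    where
    module M = Module M
    module N = Module N
    module f = GroupHomomorphism (StrongEmbedding.hom f)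
  ... | no n≢0 = let z′ , q = strong⇒pure f n z m n≢0 (N.≈-sym p) in
      z′ , StrongEmbedding.injective f (N.≈-trans (·-homo {M} {N} (StrongEmbedding.hom f) n z′)
        (N.≈-trans (N.·-cong n q) p))
    where module N = Module N

  -- Divisibility over M as a complete invariant of Galois types

  module _ {M : AbGroup} where
    private module M = Module M

    -- The case n = 0 is included: it records whether a + m ≈ ε, that is, whether and where a lies
    -- in M.
    DividesAt : Triple M → ℕ → M.Carrier → Set
    DividesAt t n m = Divides t.N (+ n) (t.a ∙ t.incl • m)
      where
      module t = Triple t
      open AbelianGroup t.N

    SameDivisibility : Rel (Triple M) 0ℓ
    SameDivisibility s t = ∀ n m → DividesAt s n m ⇔ DividesAt t n m

    sameDivisibility-isEquivalence : IsEquivalence SameDivisibility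
    sameDivisibility-isEquivalence = record
      { refl  = λ n m → mk⇔ id id
      ; sym   = λ p n m → mk⇔ (Equivalence.from (p n m)) (Equivalence.to (p n m))
      ; trans = λ p q n m → mk⇔ (Equivalence.to (q n m) ∘ Equivalence.to (p n m))
                                (Equivalence.from (p n m) ∘ Equivalence.from (q n m))
      }

    -- Divisibility passes up along any homomorphism and comes back down along a strong one, by
    -- purity.
    related⇒sameDivisibility : ∀ {s t} → DirectlyRelated s t → SameDivisibility s t
    related⇒sameDivisibility {s} {t} r n m = mk⇔
      (λ d → divides-strong g (+ n) (divides-resp {N″} (+ n) a+m
        (divides-hom {s.N} {N″} (StrongEmbedding.hom f) (+ n) d)))
      (λ d → divides-strong f (+ n) (divides-resp {N″} (+ n) (≈-sym a+m)
        (divides-hom {t.N} {N″} (StrongEmbedding.hom g) (+ n) d)))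
      where
      open DirectlyRelated r
      open Module N″ using (_≈_; ≈-sym; ≈-trans; ∙-cong)
      module s = Triple s
      module t = Triple t
      a+m : f • (AbelianGroup._∙_ s.N s.a (s.incl • m)) ≈ g • (AbelianGroup._∙_ t.N t.a (t.incl • m))
      a+m = ≈-trans (GroupHomomorphism.homo (StrongEmbedding.hom f) _ _) (≈-trans (∙-cong agreeOna (agreeOnM m))
        (≈-sym (GroupHomomorphism.homo (StrongEmbedding.hom g) _ _)))

    sameType⇒sameDivisibility : ∀ {s t} → Setoid._≈_ (GaloisTypes M) s t → SameDivisibility s t
    sameType⇒sameDivisibility = EqClosure.fold sameDivisibility-isEquivalence related⇒sameDivisibility

    -- The partial isomorphism of s.N and t.N over M sending s.a to t.a, on pure closures.
    module PartialIsomorphism (s t : Triple M) (same : SameDivisibility s t) where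
      module s = Triple s
      module t = Triple t
      module S = Module s.N
      module T = Module t.N
      module i = GroupHomomorphism (StrongEmbedding.hom s.incl)
      module j = GroupHomomorphism (StrongEmbedding.hom t.incl)

      graph : Subgroup (s.N ×ᴳ t.N)
      graph = record
        { Member    = λ (w , v) → ∃ λ m → i.⟦ m ⟧ S.≈ w × j.⟦ m ⟧ T.≈ v
        ; resp      = λ (p , q) (m , r , u) → m , S.≈-trans r p , T.≈-trans u q
        ; ε-closed  = M.ε , i.ε-homo , j.ε-homo
        ; ∙-closed  = λ (m , p , q) (m′ , p′ , q′) → m M.∙ m′ ,
            S.≈-trans (i.homo m m′) (S.∙-cong p p′) , T.≈-trans (j.homo m m′) (T.∙-cong q q′)
        ; ⁻¹-closed = λ (m , p , q) → m M.⁻¹ ,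
            S.≈-trans (i.⁻¹-homo m) (S.⁻¹-cong p) , T.≈-trans (j.⁻¹-homo m) (T.⁻¹-cong q)
        }

      compatible : ∀ {p} → Subgroup.Member graph p → Compatible s.N t.N (Subgroup.Member graph) p
      compatible (m , p , q) =
        (λ w≈ε → T.≈-trans (T.≈-sym q) (T.≈-trans (j.⟦⟧-cong {m} {M.ε} (StrongEmbedding.injective s.incl
          (S.≈-trans p (S.≈-trans w≈ε (S.≈-sym i.ε-homo))))) j.ε-homo)) ,
        λ n z n≢0 r → let m′ , u = strong⇒pure s.incl n z m n≢0 (S.≈-trans p (S.≈-sym r)) in
          j.⟦ m′ ⟧ , m′ , u , T.≈-refl

      open PartialHom graph compatible public using (module Adjoin)
      open Adjoin s.a t.a public

      transfer : ∀ n {w v} → Subgroup.Member graph (w , v) →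
                 Divides s.N (+ n) (s.a S.∙ w) → Divides t.N (+ n) (t.a T.∙ v)
      transfer n (m , p , q) d = divides-resp {t.N} (+ n) (T.∙-congˡ q)
        (Equivalence.to (same n m) (divides-resp {s.N} (+ n) (S.∙-congˡ (S.≈-sym p)) d))

      isCompatible : ∀ {p} → Closure p → Compatible s.N t.N Closure p
      isCompatible = closure-compatible (Perp⇒torsionFree t.inClass) transfer

      functional : ∀ {z y} → Closure (z , y) → z S.≈ S.ε → y T.≈ T.ε
      functional c = proj₁ (isCompatible c)

      pure : ∀ n z {w v} → ¬ n ≡ 0ℤ → n S.· z S.≈ w → Closure (w , v) → ∃ λ y → Closure (z , y)
      pure n z n≢0 p c = proj₂ (isCompatible c) n z n≢0 p

    -- `N″` glues along the whole partial isomorphism and not only along M, which identifies the two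
    -- elements a and keeps the quotient torsion-free. Injectivity and purity of the left embedding
    -- come from the inverse partial isomorphism `Op`, those of the right one from the partial
    -- isomorphism itself.
    module Amalgam (s t : Triple M) (same : SameDivisibility s t) where
      open PartialIsomorphism s t same
      private
        module Op = PartialIsomorphism t s (IsEquivalence.sym sameDivisibility-isEquivalence {s} {t} same)

        opposite : ∀ {z y} → Closure (z , y) → Op.Closure (y , z)
        opposite (n , k , w , v , n≢0 , (m , p , q) , r , u) = n , k , v , w , n≢0 , (m , q , p) , u , r

        opposite⁻¹ : ∀ {z y} → Op.Closure (y , z) → Closure (z , y)
        opposite⁻¹ (n , k , w , v , n≢0 , (m , p , q) , r , u) = n , k , v , w , n≢0 , (m , q , p) , u , r

      module P = Module (s.N ×ᴳ t.N)

      N″ : AbGroup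
      N″ = (s.N ×ᴳ t.N) / closure

      module N″ = Module N″

      resp : ∀ {p q} → p P.≈ q → Closure p → Closure q
      resp = Subgroup.resp closure

      fromEq : ∀ {p q : P.Carrier} → p P.≈ q → p N″.≈ q
      fromEq {p} {q} e = resp (P.≈-sym (P.≈-trans (P.∙-congʳ {q P.⁻¹} e) (P.inverseʳ q))) (Subgroup.ε-closed closure)

      N″-torsionFree : TorsionFree N″
      N″-torsionFree n (z , y) n≢0 c = resp (P.≈-sym (P.x-ε≈x (z , y)))
        (closure-pure n n≢0 (resp (P.≈-trans (P.x-ε≈x (n P.· (z , y))) (·-pair s.N t.N n z y)) c))

      left : Hom s.N N″
      left = record
        { ⟦_⟧ = λ z → z , T.ε
        ; isGroupHomomorphism = record
          { isMonoidHomomorphism = record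
            { isMagmaHomomorphism = record
              { isRelHomomorphism = record { cong = λ p → fromEq (p , T.≈-refl) }
              ; homo = λ _ _ → fromEq (S.≈-refl , T.≈-sym (T.identityˡ T.ε))
              }
            ; ε-homo = fromEq P.≈-refl
            }
          ; ⁻¹-homo = λ _ → fromEq (S.≈-refl , T.≈-sym T.ε⁻¹≈ε)
          }
        }

      -- The sign turns the identification of z with y into the relation (z, y) ∈ closure.
      right : Hom t.N N″
      right = record
        { ⟦_⟧ = λ y → S.ε , y T.⁻¹
        ; isGroupHomomorphism = record
          { isMonoidHomomorphism = record
            { isMagmaHomomorphism = record
              { isRelHomomorphism = record { cong = λ p → fromEq (S.≈-refl , T.⁻¹-cong p) }
              ; homo = λ x y → fromEq (S.≈-sym (S.identityˡ S.ε) , T.≈-sym (T.⁻¹-∙-comm x y))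
              }
            ; ε-homo = fromEq (S.≈-refl , T.ε⁻¹≈ε)
            }
          ; ⁻¹-homo = λ _ → fromEq (S.≈-sym S.ε⁻¹≈ε , T.≈-refl)
          }
        }

      -- Modulo `closure`, the hypothesis puts n · y⁻¹ into the range of the partial isomorphism.
      -- Since the range is pure, y⁻¹ is the partner of some w, and then (z, y) is identified with
      -- (w ∙ z, ε).
      left-pure : ∀ n z y x → ¬ n ≡ 0ℤ → Closure ((x , T.ε) P.- n P.· (z , y)) →
                  ∃ λ w → Closure ((w , T.ε) P.- (z , y))
      left-pure n z y x n≢0 c =
        let w , d = Op.pure n (y T.⁻¹) n≢0 T.≈-refl (opposite swapped)
        in w S.∙ z , resp {w , y T.⁻¹} {(w S.∙ z , T.ε) P.- (z , y)}
             (S.≈-sym (S.x∙y-y≈x w z) , T.≈-sym (T.identityˡ _)) (opposite⁻¹ d)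
        where
        x′ : S.Carrier
        x′ = x S.- proj₁ (n P.· (z , y))
        swapped : Closure (x′ , n T.· (y T.⁻¹))
        swapped = resp {(x , T.ε) P.- n P.· (z , y)} {x′ , n T.· (y T.⁻¹)} (S.≈-refl , T.≈-trans (T.identityˡ _)
          (T.≈-trans (T.⁻¹-cong (proj₂ (·-pair s.N t.N n z y))) (T.≈-sym (T.·-⁻¹ n y)))) c

      right-pure : ∀ n z y x → ¬ n ≡ 0ℤ → Closure ((S.ε , x T.⁻¹) P.- n P.· (z , y)) →
                   ∃ λ w → Closure ((S.ε , w T.⁻¹) P.- (z , y))
      right-pure n z y x n≢0 c =
        let w , d = pure n (z S.⁻¹) n≢0 S.≈-refl moved
        in (w T.∙ y) T.⁻¹ , resp {z S.⁻¹ , w} {(S.ε , (w T.∙ y) T.⁻¹ T.⁻¹) P.- (z , y)}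
             (S.≈-sym (S.identityˡ _) , T.≈-sym (T.≈-trans (T.∙-congʳ (T.⁻¹-involutive _)) (T.x∙y-y≈x w y))) d
        where
        x′ : T.Carrier
        x′ = x T.⁻¹ T.- proj₂ (n P.· (z , y))
        moved : Closure (n S.· (z S.⁻¹) , x′)
        moved = resp {(S.ε , x T.⁻¹) P.- n P.· (z , y)} {n S.· (z S.⁻¹) , x′} (S.≈-trans (S.identityˡ _)
          (S.≈-trans (S.⁻¹-cong (proj₁ (·-pair s.N t.N n z y))) (S.≈-sym (S.·-⁻¹ n z))) , T.≈-refl) c

      left-injective : ∀ {z z′} → Closure (z S.- z′ , T.ε T.- T.ε) → z S.≈ z′
      left-injective c = S.x∙y⁻¹≈ε⇒x≈y (Op.functional (opposite c) (T.inverseʳ T.ε))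

      right-injective : ∀ {y y′} → Closure (S.ε S.- S.ε , y T.⁻¹ T.- y′ T.⁻¹) → y T.≈ y′
      right-injective c = T.⁻¹-injective (T.x∙y⁻¹≈ε⇒x≈y (functional c (S.inverseʳ S.ε)))

      left-pureHom : PureHom {s.N} {N″} left
      left-pureHom n (z , y) x n≢0 c = left-pure n z y x n≢0 c

      right-pureHom : PureHom {t.N} {N″} right
      right-pureHom n (z , y) x n≢0 c = right-pure n z y x n≢0 c

      f : StrongEmbedding s.N N″
      f = pureEmbedding {s.N} {N″} left (λ {z} {z′} → left-injective {z} {z′}) N″-torsionFree left-pureHom

      g : StrongEmbedding t.N N″
      g = pureEmbedding {t.N} {N″} right (λ {y} {y′} → right-injective {y} {y′}) N″-torsionFree right-pureHom

      related : DirectlyRelated s t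
      related = record
        { N″ = N″
        ; inClass = inClass N″-torsionFree
        ; f = f
        ; g = g
        ; agreeOnM = λ m → resp (difference (i.⟦ m ⟧) (j.⟦ m ⟧)) (⊆closure (m , S.≈-refl , T.≈-refl))
        ; agreeOna = resp (difference s.a t.a) ∈closure
        }
        where
        difference : ∀ z y → (z , y) P.≈ (z , T.ε) P.- (S.ε , y T.⁻¹)
        difference z y = S.≈-sym (S.x-ε≈x z) , T.≈-sym (T.≈-trans (T.identityˡ _) (T.⁻¹-involutive y))

    sameDivisibility⇒sameType : ∀ {s t} → SameDivisibility s t → Setoid._≈_ (GaloisTypes M) s t
    sameDivisibility⇒sameType {s} {t} same = EqClosure.return (Amalgam.related s t same)

    -- The set of m with n ∣ a + m is empty or a coset of nM, recorded by a representative.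
    Code : Triple M → (ℕ → List M.Carrier) → Set
    Code t c = ∀ n → (c n ≡ [] × ¬ ∃ (DividesAt t n)) ⊎ (∃ λ m → c n ≡ m ∷ [] × DividesAt t n m)

    -- The difference of k and m is divisible by n in s.N, hence already in M because M is pure
    -- there. That quotient can be carried over to t.N and added to the solution for m′.
    dividesAt-coset : ∀ (s t : Triple M) n {m m′} → m M.≈ m′ → DividesAt s n m → DividesAt t n m′ →
                      ∀ k → DividesAt s n k → DividesAt t n k
    dividesAt-coset s t n {m} {m′} m≈m′ (z , p) (y , q) k (z′ , r) = y T.∙ j.⟦ x ⟧ , (begin
      + n T.· (y T.∙ j.⟦ x ⟧)                            ≈⟨ T.·-∙ (+ n) _ _ ⟩
      + n T.· y T.∙ + n T.· j.⟦ x ⟧                      ≈⟨ T.∙-cong q (T.≈-sym (·-homo {M} {t.N} (StrongEmbedding.hom t.incl) (+ n) x)) ⟩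
      (t.a T.∙ j.⟦ m′ ⟧) T.∙ j.⟦ + n M.· x ⟧             ≈⟨ T.∙-congˡ (j.⟦⟧-cong nx≈) ⟩
      (t.a T.∙ j.⟦ m′ ⟧) T.∙ j.⟦ k M.∙ m M.⁻¹ ⟧          ≈⟨ T.assoc _ _ _ ⟩
      t.a T.∙ (j.⟦ m′ ⟧ T.∙ j.⟦ k M.∙ m M.⁻¹ ⟧)          ≈⟨ T.∙-congˡ (j.homo _ _) ⟨
      t.a T.∙ j.⟦ m′ M.∙ (k M.∙ m M.⁻¹) ⟧                ≈⟨ T.∙-congˡ (j.⟦⟧-cong m′+k-m≈k) ⟩
      t.a T.∙ j.⟦ k ⟧                                    ∎)
      where
      module s = Triple s
      module t = Triple t
      module S = Module s.N
      module T = Module t.N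
      module i = GroupHomomorphism (StrongEmbedding.hom s.incl)
      module j = GroupHomomorphism (StrongEmbedding.hom t.incl)
      open SetoidReasoning T.setoid
      m′+k-m≈k : m′ M.∙ (k M.∙ m M.⁻¹) M.≈ k
      m′+k-m≈k = M.≈-trans (M.∙-congʳ (M.≈-sym m≈m′))
        (M.solve [] (m ∷ k ∷ []) (λ { [] (m ∷ k ∷ []) → m M.⊕ (k M.⊕ M.⊖ m) M.⊜ k }) refl)
      inM : Divides M (+ n) (k M.∙ m M.⁻¹)
      inM = divides-strong s.incl (+ n) (z′ S.∙ z S.⁻¹ , S.≈-trans (S.·-∙ (+ n) _ _) (S.≈-trans
        (S.∙-cong r (S.≈-trans (S.·-⁻¹ (+ n) z) (S.⁻¹-cong p))) (S.≈-trans
        (S.solve [] (s.a ∷ i.⟦ k ⟧ ∷ i.⟦ m ⟧ ∷ []) (λ { [] (a ∷ k ∷ m ∷ []) →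
          (a S.⊕ k) S.⊕ S.⊖ (a S.⊕ m) S.⊜ k S.⊕ S.⊖ m }) refl)
        (S.≈-sym (S.≈-trans (i.homo _ _) (S.∙-congˡ (i.⁻¹-homo m)))))))
      x = proj₁ inM
      nx≈ = proj₂ inM

    code-separates : ∀ {s t c d} → Code s c → Code t d → Setoid._≈_ (Sequences (ListOf ∣ M ∣)) c d →
                     SameDivisibility s t
    code-separates {s} {t} {c} {d} codeS codeT c≈d n m = compare (codeS n) (codeT n) (c≈d n)
      where
      compare : (c n ≡ [] × ¬ ∃ (DividesAt s n)) ⊎ (∃ λ k → c n ≡ k ∷ [] × DividesAt s n k) →
                (d n ≡ [] × ¬ ∃ (DividesAt t n)) ⊎ (∃ λ k → d n ≡ k ∷ [] × DividesAt t n k) →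
                Pointwise M._≈_ (c n) (d n) → DividesAt s n m ⇔ DividesAt t n m
      compare (inj₁ (_ , none)) (inj₁ (_ , none′)) _ =
        mk⇔ (λ p → contradiction (m , p) none) (λ p → contradiction (m , p) none′)
      compare (inj₂ (k , e , p)) (inj₂ (k′ , e′ , p′)) eq with c n | d n
      compare (inj₂ (k , refl , p)) (inj₂ (k′ , refl , p′)) (k≈k′ ∷ []) | _ | _ =
        mk⇔ (dividesAt-coset s t n k≈k′ p p′ m) (dividesAt-coset t s n (M.≈-sym k≈k′) p′ p m)
      compare (inj₁ (e , _)) (inj₂ (k , e′ , _)) eq with c n | d n
      compare (inj₁ (refl , _)) (inj₂ (k , refl , _)) () | _ | _
      compare (inj₂ (k , e , _)) (inj₁ (e′ , _)) eq with c n | d n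
      compare (inj₂ (k , refl , _)) (inj₁ (refl , _)) () | _ | _

    types-≼ : Injection (GaloisTypes M) (Sequences (ListOf ∣ M ∣))
    types-≼ = choose-injection (GaloisTypes M) (Sequences (ListOf ∣ M ∣)) Code
      (λ {s} {t} s≈t code n → transport s t (sameType⇒sameDivisibility {s} {t} s≈t) n (code n)) total
      (λ {s} {t} p q e → sameDivisibility⇒sameType {s} {t} (code-separates {s} {t} p q e))
      where
      transport : ∀ s t → SameDivisibility s t → ∀ n {l} →
        (l ≡ [] × ¬ ∃ (DividesAt s n)) ⊎ (∃ λ m → l ≡ m ∷ [] × DividesAt s n m) →
        (l ≡ [] × ¬ ∃ (DividesAt t n)) ⊎ (∃ λ m → l ≡ m ∷ [] × DividesAt t n m)
      transport s t same n (inj₁ (e , none)) = inj₁ (e , λ (m , p) → none (m , Equivalence.from (same n m) p))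
      transport s t same n (inj₂ (m , e , p)) = inj₂ (m , e , Equivalence.to (same n m) p)
      codeAt : ∀ t n → Dec (∃ (DividesAt t n)) →
               ∃ λ l → (l ≡ [] × ¬ ∃ (DividesAt t n)) ⊎ (∃ λ m → l ≡ m ∷ [] × DividesAt t n m)
      codeAt t n (yes (m , p)) = m ∷ [] , inj₂ (m , refl , p)
      codeAt t n (no none) = [] , inj₁ (refl , none)
      total : ∀ t → ∃ (Code t)
      total t = (λ n → proj₁ (codeAt t n (dec _))) , λ n → proj₂ (codeAt t n (dec _))

  ω-closed⇒stable : ∀ {κ} → ListClosed κ → Sequences κ ≼ κ → Stable κ
  ω-closed⇒stable (_ , lists) seqs M _ b = Composition.injection types-≼
    (≼-trans (Π-mono λ _ → ≼-trans (List-mono (Bijection.injection b)) lists) seqs)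

  -- Many Galois types

  abstract
    indicator : Set ℓ → ℤ
    indicator P = if isYes (dec P) then 1ℤ else 0ℤ

    indicator-yes : {P : Set ℓ} → P → indicator P ≡ 1ℤ
    indicator-yes {P = P} p with dec P
    ... | yes _ = refl
    ... | no ¬p = contradiction p ¬p

    indicator-no : {P : Set ℓ} → ¬ P → indicator P ≡ 0ℤ
    indicator-no {P = P} ¬p with dec P
    ... | yes p = contradiction p ¬p
    ... | no _ = refl

    indicator-cong : {P : Set ℓ} {Q : Set ℓ₁} → (P → Q) → (Q → P) → indicator P ≡ indicator Q
    indicator-cong {P = P} to from with dec P
    ... | yes p = sym (indicator-yes (to p))
    ... | no ¬p = sym (indicator-no λ q → ¬p (from q))

    indicator≢0 : {P : Set ℓ} → ¬ indicator P ≡ 0ℤ → P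
    indicator≢0 ≢0 = by-contradiction λ ¬p → ≢0 (indicator-no ¬p)

  module Functions (κ : Card) where
    private module κ = Setoid κ

    ℤ^κ : AbGroup
    ℤ^κ = Pointwise.abelianGroup κ.Carrier ℤ.+-0-abelianGroup

    respecting : Subgroup ℤ^κ
    respecting = record
      { Member    = λ f → ∀ x y → x κ.≈ y → f x ≡ f y
      ; resp      = λ e p x y x≈y → trans (sym (e x)) (trans (p x y x≈y) (e y))
      ; ε-closed  = λ _ _ _ → refl
      ; ∙-closed  = λ p q x y x≈y → cong₂ ℤ._+_ (p x y x≈y) (q x y x≈y)
      ; ⁻¹-closed = λ p x y x≈y → cong ℤ.-_ (p x y x≈y)
      }

    N : AbGroup
    N = asGroup respecting

    private module N = Module N

    infix 30 _⟨_⟩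
    _⟨_⟩ : N.Carrier → κ.Carrier → ℤ
    f ⟨ x ⟩ = proj₁ f x

    finite : Subgroup N
    finite = record
      { Member    = λ f → ∃ λ l → ∀ x → ¬ f ⟨ x ⟩ ≡ 0ℤ → Any (x κ.≈_) l
      ; resp      = λ e (l , p) → l , λ x ≢0 → p x λ ≡0 → ≢0 (trans (sym (e x)) ≡0)
      ; ε-closed  = [] , λ x ≢0 → contradiction refl ≢0
      ; ∙-closed  = λ {f} {g} (l , p) (k , q) → l ++ k , λ x ≢0 → union {f} {g} l k p q x ≢0
      ; ⁻¹-closed = λ (l , p) → l , λ x ≢0 → p x λ ≡0 → ≢0 (cong ℤ.-_ ≡0)
      }
      where
      union : ∀ {f g : N.Carrier} l k → (∀ x → ¬ f ⟨ x ⟩ ≡ 0ℤ → Any (x κ.≈_) l) →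
              (∀ x → ¬ g ⟨ x ⟩ ≡ 0ℤ → Any (x κ.≈_) k) →
              ∀ x → ¬ f ⟨ x ⟩ ℤ.+ g ⟨ x ⟩ ≡ 0ℤ → Any (x κ.≈_) (l ++ k)
      union {f} {g} l k p q x ≢0 with f ⟨ x ⟩ ℤ.≟ 0ℤ
      ... | no fx≢0 = Any.++⁺ˡ (p x fx≢0)
      ... | yes fx≡0 = Any.++⁺ʳ l (q x λ gx≡0 → ≢0 (cong₂ ℤ._+_ fx≡0 gx≡0))

    M : AbGroup
    M = asGroup finite

    private module M = Module M

    N-scale : ∀ n f x → (n N.· f) ⟨ x ⟩ ≡ n ℤ.* f ⟨ x ⟩
    N-scale n f x = trans (·-homo {N} {ℤ^κ} (inclusion respecting) n f x) (·-pointwise n (proj₁ f) x)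

    N-torsionFree : TorsionFree N
    N-torsionFree n f n≢0 e x = Sum.[ (λ n≡0 → contradiction n≡0 n≢0) , id ]
      (ℤ.i*j≡0⇒i≡0∨j≡0 n (trans (sym (N-scale n f x)) (e x)))

    M-torsionFree : TorsionFree M
    M-torsionFree = torsionFree-asGroup finite N-torsionFree

    M⊂N : StrongEmbedding M N
    M⊂N = pureEmbedding {M} {N} (inclusion finite) id N-torsionFree
      λ n f (g , l , p) n≢0 e → (f , l , λ x ≢0 → p x λ gx≡0 →
        Sum.[ n≢0 , ≢0 ] (ℤ.i*j≡0⇒i≡0∨j≡0 n (trans (sym (N-scale n f x)) (trans (sym (e x)) gx≡0)))) , λ _ → refl

    divides-pointwise : ∀ n (f : N.Carrier) → ¬ n ≡ 0ℤ → (∀ x → ∃ λ z → n ℤ.* z ≡ f ⟨ x ⟩) → Divides N n f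
    divides-pointwise n f n≢0 d = (quotient , respects) , λ x → trans (N-scale n (quotient , respects) x) (proj₂ (d x))
      where
      quotient : κ.Carrier → ℤ
      quotient x = proj₁ (d x)
      respects : ∀ x y → x κ.≈ y → quotient x ≡ quotient y
      respects x y x≈y = ℤ.*-cancelˡ-≡ n _ _ {{ℤ.≢-nonZero n≢0}}
        (trans (proj₂ (d x)) (trans (proj₂ f x y x≈y) (sym (proj₂ (d y)))))

    pointwise-divides : ∀ n (f : N.Carrier) → Divides N n f → ∀ x → ∃ λ z → n ℤ.* z ≡ f ⟨ x ⟩
    pointwise-divides n f (g , e) x = g ⟨ x ⟩ , trans (sym (N-scale n g x)) (e x)

    κ≼M : κ ≼ ∣ M ∣
    κ≼M = record
      { to = λ x → ((λ y → indicator (y κ.≈ x)) , λ y z y≈z → indicator-cong (κ.trans (κ.sym y≈z)) (κ.trans y≈z)) ,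
          x ∷ [] , λ y ≢0 → here (indicator≢0 ≢0)
      ; cong = λ x≈y z → indicator-cong (λ p → κ.trans p x≈y) (λ p → κ.trans p (κ.sym x≈y))
      ; injective = λ {x} {y} e → indicator≢0 λ ≡0 →
          contradiction (trans (sym (indicator-yes κ.refl)) (trans (e x) ≡0)) λ ()
      }

    SupportedIn : (κ.Carrier → Set) → M.Carrier → Set
    SupportedIn Q (f , _) = ∀ x → ¬ f ⟨ x ⟩ ≡ 0ℤ → Q x

    -- A finitely supported function is determined by any finite table of its values that covers the
    -- support; tables are not unique, so one is chosen. Q allows the same count for all of M and
    -- for the functions living on the first few fibres.
    finite-≼ : (Q : κ.Carrier → Set) → ∣ M ∣ ↾ SupportedIn Q ≼ ListOf (≡-setoid ℤ ×ᶜ (κ ↾ Q))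
    finite-≼ Q = choose-injection (∣ M ∣ ↾ SupportedIn Q) (ListOf (≡-setoid ℤ ×ᶜ (κ ↾ Q)))
      (λ ((f , _) , _) → Table f)
      (λ {((f , _) , _)} {((g , _) , _)} → resp {f} {g})
      (λ ((f , l , p) , q) → let t , all , any = table f q l in t , all , λ x ≢0 → any x ≢0 (p x ≢0))
      (λ {((f , _) , _)} {((g , _) , _)} → separates {f} {g})
      where
      Entry : Set
      Entry = ℤ × Σ κ.Carrier Q

      Table : N.Carrier → List Entry → Set
      Table f t = All (λ (z , x , _) → f ⟨ x ⟩ ≡ z) t ×
                  (∀ x → ¬ f ⟨ x ⟩ ≡ 0ℤ → Any (λ (z , y , _) → z ≡ f ⟨ x ⟩ × y κ.≈ x) t)

      resp : ∀ {f g t} → f N.≈ g → Table f t → Table g t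
      resp e (all , any) = All.map (λ {(_ , x , _)} p → trans (sym (e x)) p) all ,
        λ x ≢0 → Any.map (λ (p , q) → trans p (e x) , q) (any x λ ≡0 → ≢0 (trans (sym (e x)) ≡0))

      table : ∀ f → (∀ x → ¬ f ⟨ x ⟩ ≡ 0ℤ → Q x) → ∀ l → ∃ λ t → All (λ (z , x , _) → f ⟨ x ⟩ ≡ z) t ×
        (∀ x → ¬ f ⟨ x ⟩ ≡ 0ℤ → Any (x κ.≈_) l → Any (λ (z , y , _) → z ≡ f ⟨ x ⟩ × y κ.≈ x) t)
      table f q [] = [] , [] , λ _ _ ()
      -- Points where f vanishes are dropped, since Q is known only on the support.
      table f q (y ∷ l) with table f q l | f ⟨ y ⟩ ℤ.≟ 0ℤ
      ... | t , all , any | yes ≡0 = t , all , λ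
        { x ≢0 (here x≈y) → contradiction (trans (proj₂ f x y x≈y) ≡0) ≢0
        ; x ≢0 (there m) → any x ≢0 m }
      ... | t , all , any | no ≢0 = (f ⟨ y ⟩ , y , q y ≢0) ∷ t , refl ∷ all , λ
        { x _ (here x≈y) → here (proj₂ f y x (κ.sym x≈y) , κ.sym x≈y)
        ; x ≢0 (there m) → there (any x ≢0 m) }

      agree : ∀ {f g t u} x → Any (λ (z , y , _) → z ≡ f ⟨ x ⟩ × y κ.≈ x) t →
              Setoid._≈_ (ListOf (≡-setoid ℤ ×ᶜ (κ ↾ Q))) t u →
              All (λ (z , y , _) → g ⟨ y ⟩ ≡ z) u → g ⟨ x ⟩ ≡ f ⟨ x ⟩
      agree {f} {g} x (here (z≡ , y≈x)) ((z≡z′ , y≈y′) ∷ _) (p ∷ _) =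
        trans (proj₂ g x _ (κ.trans (κ.sym y≈x) y≈y′)) (trans p (trans (sym z≡z′) z≡))
      agree {f} {g} x (there m) (_ ∷ e) (_ ∷ ps) = agree {f} {g} x m e ps

      separates : ∀ {f g t u} → Table f t → Table g u → Setoid._≈_ (ListOf (≡-setoid ℤ ×ᶜ (κ ↾ Q))) t u → f N.≈ g
      separates {f} {g} (all , any) (all′ , any′) e x with f ⟨ x ⟩ ℤ.≟ 0ℤ | g ⟨ x ⟩ ℤ.≟ 0ℤ
      ... | yes p | yes q = trans p (sym q)
      ... | no ≢0 | _ = sym (agree {f} {g} x (any x ≢0) e all′)
      ... | yes _ | no ≢0 = agree {g} {f} x (any′ x ≢0) (Setoid.sym (ListOf (≡-setoid ℤ ×ᶜ (κ ↾ Q))) e) all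

  module Sections (κ : ℕ → Card) where
    open Functions (Σᶜ κ) public
    private
      module N = Module N
      module κ n = Setoid (κ n)

    2^_ : ℕ → ℤ
    2^ n = + (2 ℕ.^ n)

    2^≢0 : ∀ n → ¬ 2^ n ≡ 0ℤ
    2^≢0 n e = ℕ.≢-nonZero⁻¹ (2 ℕ.^ n) {{ℕ.m^n≢0 2 n}} (ℤ.+-injective e)

    spread : (∀ n → κ.Carrier n) → N.Carrier
    spread f = (λ (n , y) → 2^ n ℤ.* indicator (κ._≈_ n y (f n))) ,
      λ { _ _ (inFibre {n} y≈z) → cong (2^ n ℤ.*_) (indicator-cong (κ.trans n (κ.sym n y≈z)) (κ.trans n y≈z)) }

    -- Negated because `DividesAt` is about a + m: adding it to `spread f` erases the fibres below
    -- i, and what remains is a multiple of 2ⁱ.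
    cutoff : ℕ → (∀ n → κ.Carrier n) → N.Carrier
    cutoff i f = (λ (n , y) → indicator (n < i) ℤ.* ℤ.- spread f ⟨ n , y ⟩) ,
      λ { x y e@(inFibre {n} _) → cong (λ z → indicator (n < i) ℤ.* ℤ.- z) (proj₂ (spread f) x y e) }

    truncation : ℕ → (∀ n → κ.Carrier n) → AbelianGroup.Carrier M
    truncation i f = cutoff i f , support i , supported
      where
      support : ℕ → List (Setoid.Carrier (Σᶜ κ))
      support zero = []
      support (suc i) = (i , f i) ∷ support i
      member : ∀ i {n y} → n < i → κ._≈_ n y (f n) → Any (SameFibre κ (n , y)) (support i)
      member (suc i) (ℕ.s≤s n≤i) e with ℕ.m≤n⇒m<n∨m≡n n≤i
      ... | inj₁ n<i = there (member i n<i e)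
      ... | inj₂ refl = here (inFibre e)
      supported : ∀ x → ¬ cutoff i f ⟨ x ⟩ ≡ 0ℤ → Any (SameFibre κ x) (support i)
      supported (n , y) ≢0 = member i
        (indicator≢0 λ ≡0 → ≢0 (trans (cong (ℤ._* ℤ.- spread f ⟨ n , y ⟩) ≡0) (ℤ.*-zeroˡ (ℤ.- spread f ⟨ n , y ⟩))))
        (indicator≢0 λ ≡0 → ≢0 (trans
          (cong (λ z → indicator (n < i) ℤ.* ℤ.- z) (trans (cong (2^ n ℤ.*_) ≡0) (ℤ.*-zeroʳ (2^ n))))
          (ℤ.*-zeroʳ (indicator (n < i)))))

    triple : (∀ n → κ.Carrier n) → Triple M
    triple f = record { N = N ; inClass = inClass N-torsionFree ; incl = M⊂N ; a = spread f }

    spread-divisible : ∀ f i → DividesAt (triple f) (2 ℕ.^ i) (truncation i f)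
    spread-divisible f i = divides-pointwise (2^ i) (spread f N.∙ cutoff i f) (2^≢0 i) at
      where
      at : ∀ x → ∃ λ z → 2^ i ℤ.* z ≡ spread f ⟨ x ⟩ ℤ.+ cutoff i f ⟨ x ⟩
      at (n , y) with dec (n < i)
      ... | yes n<i = 0ℤ , trans (ℤ.*-zeroʳ (2^ i)) (sym (trans
            (cong (λ z → s ℤ.+ z ℤ.* ℤ.- s) (indicator-yes n<i))
            (trans (cong (ℤ._+_ s) (ℤ.*-identityˡ (ℤ.- s))) (ℤ.+-inverseʳ s))))
        where s = spread f ⟨ n , y ⟩
      ... | no n≮i = 2^ (n ℕ.∸ i) ℤ.* δ , (begin
            2^ i ℤ.* (2^ (n ℕ.∸ i) ℤ.* δ)            ≡⟨ ℤ.*-assoc (2^ i) (2^ (n ℕ.∸ i)) δ ⟨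
            2^ i ℤ.* 2^ (n ℕ.∸ i) ℤ.* δ              ≡⟨ cong (ℤ._* δ) (ℤ.pos-* (2 ℕ.^ i) (2 ℕ.^ (n ℕ.∸ i))) ⟨
            + (2 ℕ.^ i ℕ.* 2 ℕ.^ (n ℕ.∸ i)) ℤ.* δ    ≡⟨ cong (λ k → + k ℤ.* δ) (ℕ.^-distribˡ-+-* 2 i (n ℕ.∸ i)) ⟨
            2^ (i ℕ.+ (n ℕ.∸ i)) ℤ.* δ               ≡⟨ cong (λ k → 2^ k ℤ.* δ) (ℕ.m+[n∸m]≡n (ℕ.≮⇒≥ n≮i)) ⟩
            2^ n ℤ.* δ                               ≡⟨ ℤ.+-identityʳ _ ⟨
            2^ n ℤ.* δ ℤ.+ 0ℤ                        ≡⟨ cong (ℤ._+_ (2^ n ℤ.* δ)) (ℤ.*-zeroˡ (ℤ.- (2^ n ℤ.* δ))) ⟨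
            2^ n ℤ.* δ ℤ.+ 0ℤ ℤ.* ℤ.- (2^ n ℤ.* δ)   ≡⟨ cong (λ z → t ℤ.+ z ℤ.* ℤ.- t) (indicator-no n≮i) ⟨
            2^ n ℤ.* δ ℤ.+ cutoff i f ⟨ n , y ⟩       ∎)
        where
        open ≡-Reasoning
        δ = indicator (κ._≈_ n y (f n))
        t = 2^ n ℤ.* δ

    2^n∤ : ∀ n z → ¬ 2^ (suc n) ℤ.* z ≡ ℤ.- 2^ n
    2^n∤ n z e = double≢odd ℤ.∣ z ∣ 0 (ℕ.*-cancelˡ-≡ _ _ (2 ℕ.^ n) {{ℕ.m^n≢0 2 n}} (begin
      2 ℕ.^ n ℕ.* double ℤ.∣ z ∣            ≡⟨ cong (λ k → 2 ℕ.^ n ℕ.* (ℤ.∣ z ∣ ℕ.+ k)) (ℕ.+-identityʳ ℤ.∣ z ∣) ⟨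
      2 ℕ.^ n ℕ.* (2 ℕ.* ℤ.∣ z ∣)           ≡⟨ ℕ.*-assoc (2 ℕ.^ n) 2 ℤ.∣ z ∣ ⟨
      2 ℕ.^ n ℕ.* 2 ℕ.* ℤ.∣ z ∣             ≡⟨ cong (ℕ._* ℤ.∣ z ∣) (ℕ.*-comm (2 ℕ.^ n) 2) ⟩
      2 ℕ.^ suc n ℕ.* ℤ.∣ z ∣               ≡⟨ ℤ.abs-* (2^ (suc n)) z ⟨
      ℤ.∣ 2^ (suc n) ℤ.* z ∣                ≡⟨ cong ℤ.∣_∣ e ⟩
      ℤ.∣ ℤ.- 2^ n ∣                        ≡⟨ ℤ.∣-i∣≡∣i∣ (2^ n) ⟩
      2 ℕ.^ n                               ≡⟨ ℕ.*-identityʳ (2 ℕ.^ n) ⟨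
      2 ℕ.^ n ℕ.* 1                         ∎))
      where open ≡-Reasoning

    -- 2ⁿ⁺¹ divides spread f up to its truncation, which determines f n.
    sameDivisibility⇒≈ : ∀ f g → SameDivisibility (triple f) (triple g) → ∀ n → κ._≈_ n (f n) (g n)
    sameDivisibility⇒≈ f g same n = by-contradiction λ f≉g →
      -- At the point f n of fibre n, the truncation contributes -2ⁿ, and `spread g` contributes 0
      -- when g n differs from f n. The sum would be -2ⁿ, not a multiple of 2ⁿ⁺¹.
      let z , e = pointwise-divides (2^ (suc n)) (spread g N.∙ cutoff (suc n) f)
                    (Equivalence.to (same (2 ℕ.^ suc n) (truncation (suc n) f)) (spread-divisible f (suc n))) (n , f n)
      in 2^n∤ n z (begin
        2^ (suc n) ℤ.* z
          ≡⟨ e ⟩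
        2^ n ℤ.* indicator (κ._≈_ n (f n) (g n)) ℤ.+ indicator (n < suc n) ℤ.* ℤ.- (2^ n ℤ.* δ)
          ≡⟨ cong₂ (λ u v → 2^ n ℤ.* u ℤ.+ v ℤ.* ℤ.- (2^ n ℤ.* δ)) (indicator-no f≉g) (indicator-yes ℕ.≤-refl) ⟩
        2^ n ℤ.* 0ℤ ℤ.+ 1ℤ ℤ.* ℤ.- (2^ n ℤ.* δ)
          ≡⟨ cong (λ u → 2^ n ℤ.* 0ℤ ℤ.+ 1ℤ ℤ.* ℤ.- (2^ n ℤ.* u)) (indicator-yes (κ.refl n)) ⟩
        2^ n ℤ.* 0ℤ ℤ.+ 1ℤ ℤ.* ℤ.- (2^ n ℤ.* 1ℤ)
          ≡⟨ ℤSolver.solve 1 (λ t → t :* con 0ℤ :+ con 1ℤ :* :- (t :* con 1ℤ) := :- t) refl (2^ n) ⟩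
        ℤ.- 2^ n ∎)
      where
      open ≡-Reasoning
      open ℤSolver using (_:*_; _:+_; :-_; _:=_; con)
      δ = indicator (κ._≈_ n (f n) (f n))

    Π≼types : Injection (Π κ) (GaloisTypes M)
    Π≼types = record
      { to = triple
      ; cong = λ {f} {g} f≈g → sameDivisibility⇒sameType {M} {triple f} {triple g}
          λ n m → mk⇔ (move n m f g f≈g) (move n m g f λ k → κ.sym k (f≈g k))
      ; injective = λ {f} {g} e → sameDivisibility⇒≈ f g (sameType⇒sameDivisibility {M} {triple f} {triple g} e)
      }
      where
      spread-cong : ∀ f g → Setoid._≈_ (Π κ) f g → spread f N.≈ spread g
      spread-cong f g f≈g (n , y) = cong (2^ n ℤ.*_)
        (indicator-cong (λ p → κ.trans n p (f≈g n)) (λ p → κ.trans n p (κ.sym n (f≈g n))))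
      move : ∀ n m f g → Setoid._≈_ (Π κ) f g → DividesAt (triple f) n m → DividesAt (triple g) n m
      move n m f g f≈g = divides-resp {N} (+ n) {spread f N.∙ proj₁ m} {spread g N.∙ proj₁ m}
        λ x → cong (ℤ._+ proj₁ m ⟨ x ⟩) (spread-cong f g f≈g x)

  -- Stability and instability

  ListOf-absorbs : ∀ {κ μ} → ListClosed μ → κ ≼ μ → ListOf (≡-setoid ℤ ×ᶜ κ) ≼ μ
  ListOf-absorbs {κ} {μ} closed i =
    ≼-trans (List-mono (ListClosed-× closed (≼-trans ℤ≼ℕ (proj₁ closed)) i)) (proj₂ closed)
    where
    ℤ≼ℕ : ≡-setoid ℤ ≼ ≡-setoid ℕ
    ℤ≼ℕ = record
      { to = λ { (+ n) → double n ; -[1+ n ] → suc (double n) }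
      ; cong = λ { refl → refl }
      ; injective = λ
        { {+ m} {+ n} e → cong +_ (double-injective m n e)
        ; {+ m} { -[1+ n ]} e → contradiction e (double≢odd m n)
        ; { -[1+ m ]} {+ n} e → contradiction (sym e) (double≢odd n m)
        ; { -[1+ m ]} { -[1+ n ]} e → cong -[1+_] (double-injective m n (ℕ.suc-injective e))
        }
      }

  Σᶜ-const : ∀ κ → Σᶜ (λ _ → κ) ≼ ≡-setoid ℕ ×ᶜ κ
  Σᶜ-const κ = record
    { to = id
    ; cong = λ { (inFibre p) → refl , p }
    ; injective = λ { (refl , p) → inFibre p }
    }

  ¬CH⇒unstable : ¬ CH → ¬ StableInAleph 1
  ¬CH⇒unstable ¬ch stable = ¬ch (CH-if (ℵ-isAleph 1) (≼-trans bits (≼-trans types M≼ℵ₁)))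
    where
    open Sections (λ _ → ℵ 1)
    closed = aleph-ListClosed 1 (ℵ-isAleph 1)

    M≼ℵ₁ : ∣ M ∣ ≼ ℵ 1
    M≼ℵ₁ = ≼-trans record { to = λ f → f , λ _ _ → tt ; cong = id ; injective = id }
      (≼-trans (finite-≼ (λ _ → ⊤)) (ListOf-absorbs closed (≼-trans (↾-≼ _) (≼-trans (Σᶜ-const (ℵ 1))
        (ListClosed-× closed (proj₁ closed) (≼-refl (ℵ 1)))))))

    ℵ₁≼M : ℵ 1 ≼ ∣ M ∣
    ℵ₁≼M = ≼-trans (fibre-≼ (λ _ → ℵ 1) 0) κ≼M

    -- Stability is applied to the cardinal ∣ M ∣ itself, which is an ℵ₁ by the two injections, so
    -- no bijection between M and `ℵ 1` has to be constructed.
    types : Sequences (ℵ 1) ≼ ∣ M ∣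
    types = Composition.injection Π≼types
      (stable ∣ M ∣ (aleph-resp 0 (ℵ-isAleph 1) ℵ₁≼M M≼ℵ₁) M (inClass M-torsionFree) (Identity.bijection ∣ M ∣))

    bits : 2^ω ≼ Sequences (ℵ 1)
    bits = ≼-trans (Π-mono λ _ → bool) (Π-mono λ _ → proj₁ closed)
      where
      bool : ≡-setoid Bool ≼ ≡-setoid ℕ
      bool = record
        { to = λ b → if b then 1 else 0
        ; cong = cong _
        ; injective = λ { {false} {false} _ → refl ; {true} {true} _ → refl }
        }

  CH⇒stable : CH → ∀ n → 0 < n → StableInAleph n
  CH⇒stable ch (suc n) _ κ isAleph =
    ω-closed⇒stable (aleph-ListClosed (suc n) isAleph) (CH⇒aleph-Sequences ch n isAleph)

  unstable-ℵω : ¬ StableInAlephω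
  unstable-ℵω stable = könig (≼-trans types (M-least UpperBound-Σℵ))
    where
    -- The shift by one is what König's theorem needs: the product of the ℵₙ₊₁ does not embed in the
    -- sum of the ℵₙ, whereas M does, because that sum bounds all alephs and M is least.
    κ : ℕ → Card
    κ n = ℵ (suc n)
    open Sections κ

    bounded : ∀ n → ∣ M ∣ ↾ SupportedIn (λ (i , _) → i ℕ.≤ n) ≼ ℵ (suc n)
    bounded n = ≼-trans (finite-≼ _)
      (ListOf-absorbs closed (≼-trans level (ListClosed-× closed (proj₁ closed) (≼-refl _))))
      where
      closed = aleph-ListClosed (suc n) (ℵ-isAleph (suc n))
      raise : ∀ {i} → i ℕ.≤ n → ℵ (suc i) ≼ ℵ (suc n)
      raise i≤n = ℵ-mono (ℕ.≤⇒≤′ (ℕ.s≤s i≤n))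
      level : Σᶜ κ ↾ (λ (i , _) → i ℕ.≤ n) ≼ ≡-setoid ℕ ×ᶜ ℵ (suc n)
      level = record
        { to = λ ((i , y) , i≤n) → i , Injection.to (raise i≤n) y
        ; cong = λ {((i , y) , p)} {((j , z) , q)} e → level-cong p q e
        ; injective = λ {((i , y) , p)} {((j , z) , q)} e → level-injective p q e
        }
        where
        -- `raise` depends on the proof of i ≤ n; irrelevance of such proofs makes the two maps
        -- agree.
        level-cong : ∀ {i j y z} (p : i ℕ.≤ n) (q : j ℕ.≤ n) → SameFibre κ (i , y) (j , z) →
                     i ≡ j × Setoid._≈_ (ℵ (suc n)) (Injection.to (raise p) y) (Injection.to (raise q) z)
        level-cong p q (inFibre e) with ℕ.≤-irrelevant p q
        ... | refl = refl , Injection.cong (raise p) e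
        level-injective : ∀ {i j y z} (p : i ℕ.≤ n) (q : j ℕ.≤ n) →
                          i ≡ j × Setoid._≈_ (ℵ (suc n)) (Injection.to (raise p) y) (Injection.to (raise q) z) →
                          SameFibre κ (i , y) (j , z)
        level-injective p q (refl , e) with ℕ.≤-irrelevant p q
        ... | refl = inFibre (Injection.injective (raise p) e)

    -- A finite support meets finitely many fibres, so M is the increasing union of the pieces
    -- counted by `bounded`.
    M-least : ∀ {ν} → UpperBoundOfAlephs ν → ∣ M ∣ ≼ ν
    M-least = filtered⇒≼ ∣ M ∣ (λ n → SupportedIn λ (i , _) → i ℕ.≤ n)
      (λ e s x ≢0 → s x λ ≡0 → ≢0 (trans (sym (e x)) ≡0))
      (λ (f , l , p) → bound l , λ x ≢0 → below (p x ≢0))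
      (λ m≤n s x ≢0 → ℕ.≤-trans (s x ≢0) m≤n)
      bounded
      where
      bound : List (Setoid.Carrier (Σᶜ κ)) → ℕ
      bound [] = 0
      bound ((i , _) ∷ l) = i ℕ.⊔ bound l
      below : ∀ {x l} → Any (SameFibre κ x) l → proj₁ x ℕ.≤ bound l
      below {l = (i , _) ∷ l} (here (inFibre _)) = ℕ.m≤m⊔n i (bound l)
      below {l = (i , _) ∷ l} (there m) = ℕ.≤-trans (below m) (ℕ.m≤n⊔m i (bound l))

    isAlephω : IsAlephω ∣ M ∣
    isAlephω = (λ n μ isAleph → ≼-trans (aleph-unique n isAleph (ℵ-isAleph n))
      (≼-trans (proj₁ (proj₁ (ℵ-suc n))) (≼-trans (fibre-≼ κ n) κ≼M))) , λ ν → M-least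

    types : Π κ ≼ ∣ M ∣
    types = Composition.injection Π≼types (stable ∣ M ∣ isAlephω M (inClass M-torsionFree) (Identity.bijection ∣ M ∣))

corollary3p2 : (∀ ℓ → ExcludedMiddle ℓ) →
    (∀ a ℓ₁ b ℓ₂ → SurjectionsSplit a ℓ₁ b ℓ₂) →
    let open PerpGalois (ℤ^ω / ℤ^⟨ω⟩) in
    (CH → StableInAleph 1 × (∀ n → 0 < n → StableInAleph n) × ¬ StableInAlephω) ×
    (¬ CH → ¬ StableInAleph 1)
corollary3p2 em ac =
  (λ ch → CH⇒stable ch 1 ℕ.z<s , CH⇒stable ch , unstable-ℵω) , ¬CH⇒unstable
  where open Classical em ac
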